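{- Let $G=(V,E)$ be a chordal graph, let $s\in V$, and let $\rho$ be an arbitrary vertex order of $V$ whose last vertex is $s$. Then, on input $(G,s,\rho)$, the procedure LexDFS$^+$-Chordal described in the context outputs the LexDFS$^+(\rho)$ order of $G$, which starts at $s$, and it runs in time $O(n+m)$, where $n=|V|$ and $m=|E|$.
   Context: All graphs are finite, simple, undirected and connected; $n=|V|$, $m=|E|$, $N(v)$ denotes the neighborhood of $v$. A graph is chordal if it has no induced cycle of length greater than 3. A vertex order is a linear order $\sigma=(v_1,\dots,v_n)$ of $V$; $\sigma(i)=v_i$; $u\prec_\sigma v$ means $u$ appears before (to the left of) $v$; $\sigma^-=(v_n,\dots,v_1)$ is the reverse order. Partition refinement: for an ordered partition $\mathcal Q=(Q_1,\dots,Q_k)$ of $V$ and $S'\subseteq V$, refining $\mathcal Q$ with $S'$ replaces each $Q_i$ by the two consecutive classes $(Q_i\cap S',\,Q_i\setminus S')$ whenever both are nonempty. DFS: a search that starts at a vertex and repeatedly visits an unvisited neighbor of the most recently visited vertex that still has an unvisited neighbor. For a vertex order $\tau$ and a graph $H$, DFS$^+(\tau)$ on $H$ is the DFS of $H$ that starts at the last vertex of $\tau$ and, whenever several vertices may be visited next, visits the one that is rightmost in $\tau$. LexDFS (started at $s$): give $s$ the label $(0)$ and all other vertices the empty label; for $i=1,\dots,n$, pick an unnumbered vertex $v$ with lexicographically largest label, set $\sigma(i)=v$, and prepend $i$ to the label of every unnumbered neighbor of $v$. LexBFS (started at $s$): same, except $s$ gets label $(n)$ and the update appends $n-i$ to the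 label of every unnumbered neighbor of $v$. (Labels are compared lexicographically as integer sequences, a proper prefix being smaller.) For a vertex order $\rho$ ending in $s$, LexDFS$^+(\rho)$ (resp. LexBFS$^+(\rho)$) is the LexDFS (resp. LexBFS) started at $s$ in which, among the unnumbered vertices with lexicographically largest label, the rightmost one in $\rho$ is always chosen; its output is unique. $\mathcal L$-tree: for a vertex order $\sigma=(v_1,\dots,v_n)$ of a connected graph $G$ such that every $v_i$, $i>1$, has a neighbor among $v_1,\dots,v_{i-1}$, the $\mathcal L$-tree of $\sigma$ is the spanning tree rooted at $v_1$ containing, for each $i>1$, the edge from $v_i$ to its rightmost neighbor $v_j$ with $j<i$. Procedure Ordering$(G,T,s,\rho)$ (input: connected $G$, a spanning tree $T$ of $G$ rooted at $s$ that is the $\mathcal L$-tree of some DFS order of $G$, and a vertex order $\rho$ ending with $s$): let $\beta$ be the reverse of a BFS order of $T$ starting at $s$; set $\mathcal Q=(V)$; for $i=1,\dots,n$ let $v=\beta(i)$ and refine $\mathcal Q$ with $\{w\in N(v): w\prec_\beta v\}$; then order the vertices inside every class of $\mathcal Q$ according to $\rho^-$ and move the class $\{s\}$ to the leftmost position; let $\tau$ be the reverse of the resulting order of all vertices (classes concatenated left to right); output $\sigma=$ DFS$^+(\tau)$ on $T$. Procedure LexDFS$^+$-Chordal$(G,s,\rho)$: compute the LexBFS$^+(\rho)$ order $\pi$ of $G$; let $T$ be the $\mathcal L$-tree of $\pi$; output Ordering$(G,T,s,\rho)$. -}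

module Defs where

open import Data.Bool.Base using (Bool; true; false; if_then_else_; _∧_)
import Data.Bool.Properties as Bool
open import Data.Fin.Base as Fin using (Fin; toℕ)
import Data.Fin.Properties as Fin
open import Data.Fin.Permutation as Perm using (Permutation′; _⟨$⟩ʳ_; _⟨$⟩ˡ_; _∘ₚ_)
open import Data.Fin.Subset using (Subset; _∈_; _∉_; _∩_; _─_; ⊤; ⁅_⁆)
open import Data.Fin.Subset.Properties using (_∈?_; nonempty?)
open import Data.List.Base as List
  using (List; []; _∷_; _++_; length; map; filter; concatMap; foldl; take; upTo; allFin; cartesianProduct)
open import Data.List.Relation.Binary.Lex.Strict using (Lex-≤)
import Data.List.Membership.Propositional as List
open import Data.List.Relation.Unary.Unique.Propositional using (Unique)
open import Data.Nat.Base as ℕ using (ℕ; zero; suc; pred; _+_; _∸_; _≡ᵇ_; _<ᵇ_)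
open import Data.Product.Base using (∃; _×_; _,_)
open import Data.Sum.Base using (_⊎_)
import Data.Vec.Base as Vec
import Data.Vec.Properties as Vec
open import Function.Bundles using (_⇔_)
open import Function.Definitions using (Injective)
open import Relation.Binary.Construct.Closure.ReflexiveTransitive using (Star)
open import Relation.Binary.Definitions using (DecidableEquality)
open import Relation.Binary.PropositionalEquality.Core using (_≡_; _≢_)
open import Relation.Nullary.Decidable.Core using (does; _×-dec_; ¬?)
open import Relation.Nullary.Negation.Core using (¬_)

-- Simple undirected graphs with vertex set Fin n; N v is the neighbourhood of v.
record Graph (n : ℕ) : Set where
  field
    N      : Fin n → Subset n
    sym    : ∀ {u v} → u ∈ N v → v ∈ N u
    irrefl : ∀ v → v ∉ N v

open Graph public using (N)

Connected : ∀ {n} → Graph n → Set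
Connected G = ∀ u v → Star (λ x y → y ∈ N G x) u v

edges : ∀ {n} → Graph n → List (Fin n × Fin n)
edges {n} G =
  filter (λ (u , v) → (u Fin.<? v) ×-dec (v ∈? N G u)) (cartesianProduct (allFin n) (allFin n))

∣E∣ : ∀ {n} → Graph n → ℕ
∣E∣ G = length (edges G)

Next : ∀ k → Fin k → Fin k → Set
Next k i j = toℕ j ≡ suc (toℕ i) ⊎ (suc (toℕ i) ≡ k × toℕ j ≡ 0)

record InducedCycle {n} (G : Graph n) (k : ℕ) : Set where
  field
    vertex    : Fin k → Fin n
    injective : Injective _≡_ _≡_ vertex
    adjacent  : ∀ i j → vertex j ∈ N G (vertex i) ⇔ (Next k i j ⊎ Next k j i)

Chordal : ∀ {n} → Graph n → Set
Chordal G = ∀ k → 3 ℕ.< k → ¬ InducedCycle G k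

-- Positions are counted from 0: the vertex σ(i) of the usual 1-based
-- notation is at σ (i - 1).
Order : ℕ → Set
Order = Permutation′

at : ∀ {n} → Order n → Fin n → Fin n
at σ i = σ ⟨$⟩ʳ i

pos : ∀ {n} → Order n → Fin n → Fin n
pos σ v = σ ⟨$⟩ˡ v

toList : ∀ {n} → Order n → List (Fin n)
toList σ = List.tabulate (at σ)

infix 8 _⁻
_⁻ : ∀ {n} → Order n → Order n
σ ⁻ = Perm.reverse ∘ₚ σ

infix 4 Before NotAfter
Before NotAfter : ∀ {n} → Order n → Fin n → Fin n → Set
Before   σ u v = pos σ u Fin.< pos σ v
NotAfter σ u v = pos σ u Fin.≤ pos σ v
syntax Before   σ u v = u ≺[ σ ] v
syntax NotAfter σ u v = u ≼[ σ ] v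

Starts : ∀ {n} → Order n → Fin n → Set
Starts σ s = toℕ (pos σ s) ≡ 0

Ends : ∀ {n} → Order n → Fin n → Set
Ends {n} σ s = suc (toℕ (pos σ s)) ≡ n

-- The situation just before position i of σ is filled.
Visited Unvisited : ∀ {n} → Order n → Fin n → Fin n → Set
Visited   σ i w = pos σ w Fin.< i
Unvisited σ i w = i Fin.≤ pos σ w

-- u is visited before position i and still has an unvisited neighbour.
Active : ∀ {n} → Graph n → Order n → Fin n → Fin n → Set
Active H σ i u = Visited σ i u × ∃ λ w → w ∈ N H u × Unvisited σ i w

MostRecent Earliest : ∀ {n} → Graph n → Order n → Fin n → Fin n → Set
MostRecent H σ i u = Active H σ i u × (∀ x → Active H σ i x → x ≼[ σ ] u)
Earliest   H σ i u = Active H σ i u × (∀ x → Active H σ i x → u ≼[ σ ] x)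

IsDFS : ∀ {n} → Graph n → Order n → Set
IsDFS H σ = ∀ i → 0 ℕ.< toℕ i → ∃ λ u → MostRecent H σ i u × at σ i ∈ N H u

-- Processing the queue in first-in-first-out order means that the next vertex
-- is always a neighbour of the earliest vertex with an unvisited neighbour.
record IsBFS {n} (H : Graph n) (s : Fin n) (σ : Order n) : Set where
  field
    start : Starts σ s
    step  : ∀ i → 0 ℕ.< toℕ i → ∃ λ u → Earliest H σ i u × at σ i ∈ N H u

record IsDFS⁺ {n} (τ : Order n) (H : Graph n) (σ : Order n) : Set where
  field
    start : ∀ v → Starts σ v → Ends τ v
    step  : ∀ i → 0 ℕ.< toℕ i → ∃ λ u →
            MostRecent H σ i u × at σ i ∈ N H u ×
            (∀ w → w ∈ N H u → Unvisited σ i w → w ≼[ τ ] at σ i)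

Labels : ℕ → Set
Labels n = Fin n → List ℕ

infix 4 _≤ₗₑₓ_
_≤ₗₑₓ_ : List ℕ → List ℕ → Set
_≤ₗₑₓ_ = Lex-≤ _≡_ ℕ._<_

initial : ∀ {n} → Fin n → List ℕ → Labels n
initial s l v = if does (v Fin.≟ s) then l else []

-- The labels just before position i of σ is filled.  The function upd k
-- changes the label of an unnumbered neighbour of the k-th vertex, where k
-- is counted from 1.
labels : ∀ {n} → Graph n → (ℕ → List ℕ → List ℕ) → Labels n → Order n → Fin n → Labels n
labels {n} G upd init σ i = foldl number init (take (toℕ i) (allFin n))
  where
  number : Labels n → Fin n → Labels n
  number lab j w =
    if does (j Fin.<? pos σ w) ∧ does (w ∈? N G (at σ j)) then upd (suc (toℕ j)) (lab w) else lab w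

lexDFSLabels lexBFSLabels : ∀ {n} → Graph n → Fin n → Order n → Fin n → Labels n
lexDFSLabels     G s = labels G (λ k l → k ∷ l)              (initial s (0 ∷ []))
lexBFSLabels {n} G s = labels G (λ k l → l ++ (n ∸ k) ∷ []) (initial s (n ∷ []))

Largest : ∀ {n} → (Fin n → Labels n) → Order n → Fin n → Fin n → Set
Largest lab σ i v = Unvisited σ i v × (∀ w → Unvisited σ i w → lab i w ≤ₗₑₓ lab i v)

IsLexSearch⁺ : ∀ {n} → (Order n → Fin n → Labels n) → Order n → Order n → Set
IsLexSearch⁺ lab ρ σ =
  ∀ i → Largest (lab σ) σ i (at σ i) × (∀ w → Largest (lab σ) σ i w → w ≼[ ρ ] at σ i)

IsLexDFS⁺ IsLexBFS⁺ : ∀ {n} → Graph n → Fin n → Order n → Order n → Set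
IsLexDFS⁺ G s = IsLexSearch⁺ (lexDFSLabels G s)
IsLexBFS⁺ G s = IsLexSearch⁺ (lexBFSLabels G s)

Parent : ∀ {n} → Graph n → Order n → Fin n → Fin n → Set
Parent G σ v p = (p ∈ N G v × p ≺[ σ ] v) × (∀ w → w ∈ N G v → w ≺[ σ ] v → w ≼[ σ ] p)

record Is𝓛Tree {n} (G : Graph n) (σ : Order n) (T : Graph n) (r : Fin n) : Set where
  field
    root  : Starts σ r
    left  : ∀ v → v ≢ r → ∃ λ u → u ∈ N G v × u ≺[ σ ] v
    edge  : ∀ u v → u ∈ N T v ⇔ (Parent G σ v u ⊎ Parent G σ u v)

split : ∀ {n} → Subset n → Subset n → List (Subset n)
split S X =
  if does (nonempty? (X ∩ S)) ∧ does (nonempty? (X ─ S))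
  then (X ∩ S) ∷ (X ─ S) ∷ []
  else X ∷ []

refine : ∀ {n} → List (Subset n) → Subset n → List (Subset n)
refine Q S = concatMap (split S) Q

earlierNeighbours : ∀ {n} → Graph n → Order n → Fin n → Subset n
earlierNeighbours G β v =
  Vec.tabulate λ w → does (w ∈? N G v) ∧ does (pos β w Fin.<? pos β v)

classes : ∀ {n} → Graph n → Order n → List (Subset n)
classes G β = foldl refine (⊤ ∷ []) (map (earlierNeighbours G β) (toList β))

_≟ˢ_ : ∀ {n} → DecidableEquality (Subset n)
_≟ˢ_ = Vec.≡-dec Bool._≟_

moveLeft : ∀ {n} → Subset n → List (Subset n) → List (Subset n)
moveLeft C Q = filter (_≟ˢ C) Q ++ filter (λ X → ¬? (X ≟ˢ C)) Q

sortClass : ∀ {n} → Order n → Subset n → List (Fin n)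
sortClass ρ X = filter (_∈? X) (toList (ρ ⁻))

arrangement : ∀ {n} → Graph n → Fin n → Order n → Order n → List (Fin n)
arrangement G s ρ β = concatMap (sortClass ρ) (moveLeft ⁅ s ⁆ (classes G β))

-- The procedures are relations, since the BFS order of T is an arbitrary one:
-- an element of  Ordering G T s ρ σ  is a run with output σ.  The field input
-- is the requirement on the input; it includes that T is a spanning tree.
record Ordering {n} (G T : Graph n) (s : Fin n) (ρ σ : Order n) : Set where
  field
    input  : ∃ λ δ → IsDFS G δ × Is𝓛Tree G δ T s
    bfs    : Order n
    isBFS  : IsBFS T s bfs

  β : Order n
  β = bfs ⁻

  field
    τ      : Order n
    isτ    : toList τ ≡ List.reverse (arrangement G s ρ β)
    output : IsDFS⁺ τ T σ

record LexDFS⁺-Chordal {n} (G : Graph n) (s : Fin n) (ρ σ : Order n) : Set where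
  field
    π         : Order n
    isLexBFS⁺ : IsLexBFS⁺ G s ρ π
    T         : Graph n
    is𝓛Tree   : Is𝓛Tree G π T s
    ordering  : Ordering G T s ρ σ

  open Ordering ordering public using (β; τ)

-- A store consists of arrays of natural numbers, with arrays named by
-- numbers.  A program mentions finitely many names; all indices are computed.
Store : Set
Store = ℕ → ℕ → ℕ

_[_,_]≔_ : Store → ℕ → ℕ → ℕ → Store
(M [ a , i ]≔ x) b j = if (b ≡ᵇ a) ∧ (j ≡ᵇ i) then x else M b j

-- The only arithmetic is successor and predecessor.  Hence in t steps the
-- stored values grow by O(t) only, so a linear-time run uses words of
-- O(log (n + m)) bits and the unit-cost measure cannot be abused.
data Expr : Set where
  lit  : ℕ → Expr
  _⟦_⟧ : ℕ → Expr → Expr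
  inc  : Expr → Expr
  dec  : Expr → Expr

data Test : Set where
  _≐_ _⋖_ : Expr → Expr → Test

infixr 5 _⨾_
data Program : Set where
  skip   : Program
  _⟦_⟧≔_ : ℕ → Expr → Expr → Program
  _⨾_    : Program → Program → Program
  branch : Test → Program → Program → Program
  while  : Test → Program → Program

eval : Store → Expr → ℕ
eval M (lit k)     = k
eval M (a ⟦ e ⟧)   = M a (eval M e)
eval M (inc e)     = suc (eval M e)
eval M (dec e)     = pred (eval M e)

test : Store → Test → Bool
test M (e ≐ f) = eval M e ≡ᵇ eval M f
test M (e ⋖ f) = eval M e <ᵇ eval M f

-- ⟨ P , M ⟩⇓[ t ] M′ : started on M, the program P halts with store M′ after
-- t steps.  Each assignment and each test takes one step: the expressions in
-- a fixed program have bounded size, so this changes running times by at most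
-- a constant factor.
infix 4 ⟨_,_⟩⇓[_]_
data ⟨_,_⟩⇓[_]_ : Program → Store → ℕ → Store → Set where
  skip : ∀ {M} → ⟨ skip , M ⟩⇓[ 1 ] M
  assign : ∀ {M a e f} →
    ⟨ a ⟦ e ⟧≔ f , M ⟩⇓[ 1 ] (M [ a , eval M e ]≔ eval M f)
  seq : ∀ {P Q M M′ M″ t t′} →
    ⟨ P , M ⟩⇓[ t ] M′ → ⟨ Q , M′ ⟩⇓[ t′ ] M″ → ⟨ P ⨾ Q , M ⟩⇓[ t + t′ ] M″
  if-true : ∀ {b P Q M M′ t} → test M b ≡ true →
    ⟨ P , M ⟩⇓[ t ] M′ → ⟨ branch b P Q , M ⟩⇓[ suc t ] M′
  if-false : ∀ {b P Q M M′ t} → test M b ≡ false →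
    ⟨ Q , M ⟩⇓[ t ] M′ → ⟨ branch b P Q , M ⟩⇓[ suc t ] M′
  while-true : ∀ {b P M M′ M″ t t′} → test M b ≡ true →
    ⟨ P , M ⟩⇓[ t ] M′ → ⟨ while b P , M′ ⟩⇓[ t′ ] M″ →
    ⟨ while b P , M ⟩⇓[ suc (t + t′) ] M″
  while-false : ∀ {b P M} → test M b ≡ false →
    ⟨ while b P , M ⟩⇓[ 1 ] M

record AdjacencyLists {n} (G : Graph n) : Set where
  field
    list     : Fin n → List (Fin n)
    unique   : ∀ v → Unique (list v)
    complete : ∀ u v → u List.∈ list v ⇔ u ∈ N G v

  -- Entry k is the total length of the first k lists.
  offsets : List ℕ
  offsets = map (λ k → length (List.concat (take k (List.tabulate list)))) (upTo (suc n))

  targets : List ℕ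
  targets = map toℕ (List.concat (List.tabulate list))

cells : List ℕ → ℕ → ℕ
cells []       _       = 0
cells (x ∷ xs) zero    = x
cells (x ∷ xs) (suc i) = cells xs i

-- Array 0 holds n and s, arrays 1 and 2 hold the concatenated adjacency
-- lists, and array 3 holds ρ.
inputStore : ∀ {n} {G : Graph n} → AdjacencyLists G → Fin n → Order n → Store
inputStore {n} L s ρ 0 = cells (n ∷ toℕ s ∷ [])
inputStore     L s ρ 1 = cells (AdjacencyLists.offsets L)
inputStore     L s ρ 2 = cells (AdjacencyLists.targets L)
inputStore     L s ρ 3 = cells (map toℕ (toList ρ))
inputStore     L s ρ _ = λ _ → 0

Holds : ∀ {n} → Store → ℕ → Order n → Set
Holds M a σ = ∀ i → M a (toℕ i) ≡ toℕ (at σ i)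

-- The final store contains the output σ together with every intermediate
-- object of the run: π, T (as an array of parents), β and τ.
record Records {n} {G : Graph n} {s : Fin n} {ρ σ : Order n}
               (M : Store) (run : LexDFS⁺-Chordal G s ρ σ) : Set where
  open LexDFS⁺-Chordal run using (π; β; τ)
  field
    output  : Holds M 4 σ
    lexBFS  : Holds M 5 π
    tree    : ∀ v p → Parent G π v p → M 6 (toℕ v) ≡ toℕ p
    revBFS  : Holds M 7 β
    refined : Holds M 8 τ

{-# OPTIONS --safe #-}
-- In a chordal graph, the visited neighbours of a connected set of unvisited
-- vertices always form a clique K during a maximal neighbourhood search, and the
-- first vertex of the set that is visited is adjacent to all of K.  So with ties
-- broken by ρ, the next vertex in the set depends on ρ only and not on the search,
-- and LexBFS⁺(ρ) has the same 𝓛-tree T as LexDFS⁺(ρ).  Every edge of G joins two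
-- comparable vertices of T, whence a DFS of T is a DFS of G; at each step it has
-- to choose the right child of the most recent vertex u that has an unvisited
-- child.  The labels of the children consist of ancestors of u, of which the
-- reverse BFS order lists the most recent first.  Hence the refinement sorts the
-- children by their LexDFS labels, with ties broken by ρ, and the best child
-- beats all its descendants since its label contains theirs.
--
-- For the running time, vertices are kept in one doubly linked list in which the
-- classes are contiguous.  As the adjacency lists are sorted by ρ, a refinement
-- moves each vertex, in constant time, in front of what is left of its class.

module Submission where

open import Defs
open import Data.Bool.Base using (Bool; true; false; if_then_else_; _∧_; T)
import Data.Bool.Properties as Bool
open import Data.Empty using (⊥; ⊥-elim)
open import Data.Fin.Base as Fin using (Fin; zero; suc; toℕ)
import Data.Fin.Properties as Fin
import Data.Fin.Induction as Fin
import Data.Fin.Permutation as Perm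
open import Data.Fin.Subset using (Subset; _∈_; _∉_; _∩_; _─_; ⊤; ⁅_⁆; Nonempty)
open import Data.Fin.Subset.Properties using (_∈?_; nonempty?)
import Data.Fin.Subset.Properties as Subset
open import Data.List.Base as List
  using (List; []; _∷_; _++_; _∷ʳ_; length; map; filter; concat; concatMap; foldl; reverse; take; drop; tabulate; allFin)
import Data.List.Properties as List
open import Data.List.Membership.Propositional using () renaming (_∈_ to _∈ₗ_; _∉_ to _∉ₗ_)
import Data.List.Membership.Propositional.Properties as ∈ₗ
open import Data.List.Membership.Propositional.Properties.WithK using (unique∧set⇒bag)
open import Data.List.Relation.Unary.All as All using (All; []; _∷_)
import Data.List.Relation.Unary.All.Properties as All
open import Data.List.Relation.Unary.AllPairs as AllPairs using (AllPairs; []; _∷_)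
import Data.List.Relation.Unary.AllPairs.Properties as AllPairs
open import Data.List.Relation.Unary.Any as Any using (Any; here; there)
import Data.List.Relation.Unary.Any.Properties as Any
open import Data.List.Relation.Unary.Unique.Propositional using (Unique)
import Data.List.Relation.Unary.Unique.Propositional.Properties as Unique
open import Data.List.Relation.Binary.BagAndSetEquality using (∼bag⇒↭)
open import Data.List.Relation.Binary.Lex using (Lex; base; halt; this; next)
open import Data.List.Relation.Binary.Permutation.Propositional as ↭ using (_↭_; ↭-refl; ↭-sym; ↭-trans; prep; ↭-reflexive)
import Data.List.Relation.Binary.Permutation.Propositional.Properties as ↭
open import Data.Nat.Base as ℕ using (ℕ; zero; suc; pred; _+_; _*_; _∸_; _≤_; _<_; z≤n; s≤s; _≡ᵇ_; _<ᵇ_)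
open import Data.Nat.Induction using (<-rec; <-wellFounded)
open import Data.Nat.ListAction using (sum)
import Data.Nat.ListAction.Properties as ListAction
import Data.Nat.Properties as ℕ
open import Data.Product.Base using (Σ; Σ-syntax; ∃; ∃₂; ∃-syntax; _×_; _,_; proj₁; proj₂)
open import Data.Sum.Base as Sum using (_⊎_; inj₁; inj₂)
open import Data.Unit.Base using (tt) renaming (⊤ to 𝟙)
import Data.Vec.Base as Vec
import Data.Vec.Properties as Vec
open import Function.Base using (_∘_; id; flip; _on_; case_of_)
open import Function.Bundles using (_⇔_; mk⇔; Equivalence)
open import Induction.WellFounded using (Acc; acc)
open import Relation.Binary.Construct.Closure.ReflexiveTransitive as Star using (Star; ε; _◅_; _◅◅_)
open import Relation.Binary.Definitions using (tri<; tri≈; tri>; Asymmetric)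
open import Relation.Binary.PropositionalEquality
  using (_≡_; _≢_; refl; sym; trans; cong; cong₂; subst; subst₂; module ≡-Reasoning)
open import Relation.Nullary using (¬_; Dec; yes; no)
open import Relation.Nullary.Decidable using (does; _×-dec_; _⊎-dec_; ¬?; dec-true; dec-false)
import Relation.Nullary.Decidable as Dec

-- Lists and vertex orders

-- LexBFS labels, LexDFS labels and refined classes all compare vertices by their membership in a
-- sequence of sets, and differ only in which set counts most: that of the oldest visited vertex for
-- LexBFS, that of the most recent one for LexDFS, that of the first vertex of `β` for the
-- refinement. `Gt` and `Eq` capture this comparison once. For the same reason one program,
-- `refineBy`, drives both LexBFS and the refinement along `β`; flags tell it which members of an
-- adjacency list to skip. The existence of a run needs no argument of its own: total correctness of
-- the program produces `π`, `T`, `β`, `τ` and `σ`, and so also a run. The requirement of `Ordering`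
-- that `T` be the 𝓛-tree of some DFS order of `G` is met by the output `σ` itself. All costs are
-- charged to `total`, the sum of degree plus one over all vertices, which is at most twice
-- `n + ∣E∣ G`.

AllPairs-tabulate⁻ : ∀ {A : Set} {R : A → A → Set} {m} {f : Fin m → A} →
  AllPairs R (tabulate f) → ∀ {i j} → i Fin.< j → R (f i) (f j)
AllPairs-tabulate⁻ (px ∷ _)  {zero}  {suc j} _         = All.tabulate⁻ px j
AllPairs-tabulate⁻ (_ ∷ pxs) {suc i} {suc j} (s≤s i<j) = AllPairs-tabulate⁻ pxs i<j

All-reverse : ∀ {A : Set} {P : A → Set} {xs : List A} → All P xs → All P (reverse xs)
All-reverse pxs = All.tabulate λ v∈ → All.lookup pxs (Any.reverse⁻ v∈)

AllPairs-reverse : ∀ {A : Set} {R : A → A → Set} {xs} → AllPairs R xs → AllPairs (flip R) (reverse xs)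
AllPairs-reverse []                            = []
AllPairs-reverse {R = R} {x ∷ xs} (px ∷ pxs) =
  subst (AllPairs (flip R)) (sym (List.unfold-reverse x xs))
    (AllPairs.++⁺ (AllPairs-reverse pxs) ([] ∷ []) (All.map (λ r → r ∷ []) (All-reverse px)))

unique-reverse : ∀ {A : Set} {xs : List A} → Unique xs → Unique (reverse xs)
unique-reverse u = AllPairs.map (λ p e → p (sym e)) (AllPairs-reverse u)

AllPairs-map∈ : ∀ {A : Set} {R S : A → A → Set} {xs} →
  (∀ {x y} → x ∈ₗ xs → y ∈ₗ xs → R x y → S x y) → AllPairs R xs → AllPairs S xs
AllPairs-map∈ f []         = []
AllPairs-map∈ f (px ∷ pxs) =
  All.tabulate (λ y∈ → f (here refl) (there y∈) (All.lookup px y∈)) ∷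
  AllPairs-map∈ (λ x∈ y∈ → f (there x∈) (there y∈)) pxs

AllPairs-++⁻ : ∀ {A : Set} {R : A → A → Set} xs {ys} → AllPairs R (xs ++ ys) →
  AllPairs R xs × AllPairs R ys × (∀ {x y} → x ∈ₗ xs → y ∈ₗ ys → R x y)
AllPairs-++⁻ []       ps       = [] , ps , λ ()
AllPairs-++⁻ (x ∷ xs) (p ∷ ps) with AllPairs-++⁻ xs ps
... | a , b , c = All.++⁻ˡ xs p ∷ a , b ,
  λ { (here refl) y∈ → All.lookup (All.++⁻ʳ xs p) y∈ ; (there x∈) y∈ → c x∈ y∈ }

AllPairs-++⁺ : ∀ {A : Set} {R : A → A → Set} {xs ys} → AllPairs R xs → AllPairs R ys →
  (∀ {x y} → x ∈ₗ xs → y ∈ₗ ys → R x y) → AllPairs R (xs ++ ys)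
AllPairs-++⁺ ps qs r = AllPairs.++⁺ ps qs (All.tabulate λ x∈ → All.tabulate (r x∈))

-- This identifies a list found in memory with the list that the procedure prescribes: it is enough
-- that both are sorted by one relation and have the same members.
sorted-unique : ∀ {A : Set} {R : A → A → Set} → Asymmetric R → ∀ {xs ys} →
  AllPairs R xs → AllPairs R ys → (∀ {v} → v ∈ₗ xs → v ∈ₗ ys) → (∀ {v} → v ∈ₗ ys → v ∈ₗ xs) → xs ≡ ys
sorted-unique asym [] [] f g = refl
sorted-unique asym [] (q ∷ qs) f g with () ← g (here refl)
sorted-unique asym (p ∷ ps) [] f g with () ← f (here refl)
sorted-unique {R = R} asym {x ∷ xs} {y ∷ ys} (p ∷ ps) (q ∷ qs) f g =
  cong₂ _∷_ x≡y (sorted-unique asym ps qs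
    (λ v∈ → case f (there v∈) of λ
      { (here refl) → ⊥-elim (irr (subst (λ z → R z _) x≡y (All.lookup p v∈))) ; (there v∈′) → v∈′ })
    (λ v∈ → case g (there v∈) of λ
      { (here refl) → ⊥-elim (irr (subst (λ z → R z _) (sym x≡y) (All.lookup q v∈))) ; (there v∈′) → v∈′ }))
  where
  irr : ∀ {v} → ¬ R v v
  irr r = asym r r
  x≡y : x ≡ y
  x≡y with f (here refl) | g (here refl)
  ... | here e   | _         = e
  ... | there _  | here e    = sym e
  ... | there x∈ | there y∈ = ⊥-elim (asym (All.lookup q x∈) (All.lookup p y∈))

module _ {A : Set} where
  unique-↭ : ∀ {xs ys : List A} → Unique xs → Unique ys →
    (∀ {v} → v ∈ₗ xs → v ∈ₗ ys) → (∀ {v} → v ∈ₗ ys → v ∈ₗ xs) → xs ↭ ys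
  unique-↭ ux uy f g = ∼bag⇒↭ (unique∧set⇒bag ux uy (mk⇔ f g))

  unique-⊆-length : ∀ {xs ys : List A} → Unique xs → (∀ {v} → v ∈ₗ xs → v ∈ₗ ys) → length xs ≤ length ys
  unique-⊆-length {[]} _ f = z≤n
  unique-⊆-length {x ∷ xs} (x∉ ∷ ux) f with ∈ₗ.∈-∃++ (f (here refl))
  ... | as , bs , refl =
    ℕ.≤-trans (s≤s (unique-⊆-length ux (λ v∈ → case ↭.∈-resp-↭ (↭.shift x as bs) (f (there v∈)) of λ
      { (here refl) → ⊥-elim (All.lookup x∉ v∈ refl) ; (there v∈′) → v∈′ })))
    (ℕ.≤-reflexive (sym (↭.↭-length (↭.shift x as bs))))

  lookup-injective : ∀ {xs : List A} → Unique xs → ∀ {i j} → List.lookup xs i ≡ List.lookup xs j → i ≡ j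
  lookup-injective {_ ∷ _} (_ ∷ _)  {zero}  {zero}  e = refl
  lookup-injective {_ ∷ xs} (p ∷ _)  {zero}  {suc j} e = ⊥-elim (All.lookup p (∈ₗ.∈-lookup {xs = xs} j) e)
  lookup-injective {_ ∷ xs} (p ∷ _)  {suc i} {zero}  e = ⊥-elim (All.lookup p (∈ₗ.∈-lookup {xs = xs} i) (sym e))
  lookup-injective {_ ∷ _} (_ ∷ ps) {suc i} {suc j} e = cong suc (lookup-injective ps e)

at-pos : ∀ {n} (σ : Order n) v → at σ (pos σ v) ≡ v
at-pos σ v = Perm.inverseʳ σ

pos-at : ∀ {n} (σ : Order n) i → pos σ (at σ i) ≡ i
pos-at σ i = Perm.inverseˡ σ

pos-injective : ∀ {n} (σ : Order n) {u v} → pos σ u ≡ pos σ v → u ≡ v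
pos-injective σ {u} {v} e = trans (sym (at-pos σ u)) (trans (cong (at σ) e) (at-pos σ v))

≼⇒≡⊎≺ : ∀ {n} (σ : Order n) {u v} → u ≼[ σ ] v → u ≡ v ⊎ u ≺[ σ ] v
≼⇒≡⊎≺ σ u≼v with ℕ.m≤n⇒m<n∨m≡n u≼v
... | inj₁ u≺v = inj₂ u≺v
... | inj₂ e   = inj₁ (pos-injective σ (Fin.toℕ-injective e))

AllPairs-toList⁻ : ∀ {n} (σ : Order n) {R : Fin n → Fin n → Set} →
  AllPairs R (toList σ) → ∀ {u v} → u ≺[ σ ] v → R u v
AllPairs-toList⁻ σ {R} ps {u} {v} u≺v =
  subst₂ R (at-pos σ u) (at-pos σ v) (AllPairs-tabulate⁻ ps u≺v)

AllPairs-toList⁺ : ∀ {n} (σ : Order n) {R : Fin n → Fin n → Set} →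
  (∀ {u v} → u ≺[ σ ] v → R u v) → AllPairs R (toList σ)
AllPairs-toList⁺ σ r = AllPairs.tabulate⁺-< λ {i} {j} i<j →
  r (subst₂ Fin._<_ (sym (pos-at σ i)) (sym (pos-at σ j)) i<j)

∈-toList : ∀ {n} (σ : Order n) v → v ∈ₗ toList σ
∈-toList σ v = subst (_∈ₗ toList σ) (at-pos σ v) (∈ₗ.∈-tabulate⁺ (pos σ v))

toList-unique : ∀ {n} (σ : Order n) → Unique (toList σ)
toList-unique σ = AllPairs-toList⁺ σ λ u≺v e → ℕ.<-irrefl (cong (toℕ ∘ pos σ) e) u≺v

unique-length : ∀ {n} {xs : List (Fin n)} → Unique xs → (∀ v → v ∈ₗ xs) → n ≡ length xs
unique-length {n} u all = trans (sym (List.length-tabulate {n = n} id))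
  (↭.↭-length (unique-↭ (Unique.allFin⁺ n) u (λ {v} _ → all v) (λ {v} _ → ∈ₗ.∈-allFin v)))

tabulate-lookup-cast : ∀ {A : Set} {m} (xs : List A) (e : m ≡ length xs) →
  tabulate (List.lookup xs ∘ Fin.cast e) ≡ xs
tabulate-lookup-cast xs refl =
  trans (List.tabulate-cong λ i → cong (List.lookup xs) (Fin.cast-is-id refl i)) (List.tabulate-lookup xs)

fromList : ∀ {n} {xs : List (Fin n)} → Unique xs → (∀ v → v ∈ₗ xs) → ∃ λ (σ : Order n) → toList σ ≡ xs
fromList {n} {xs} u all = Perm.permutation f g fg (λ i → f-inj (fg (f i))) , tabulate-lookup-cast xs e
  where
  e : n ≡ length xs
  e = unique-length u all
  f g : Fin n → Fin n
  f i = List.lookup xs (Fin.cast e i)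
  g v = Fin.cast (sym e) (Any.index (all v))
  fg : ∀ v → f (g v) ≡ v
  fg v = trans (cong (List.lookup xs) (Fin.cast-involutive e (sym e) (Any.index (all v))))
               (sym (Any.lookup-index (all v)))
  f-inj : ∀ {i j} → f i ≡ f j → i ≡ j
  f-inj {i} {j} p = Fin.toℕ-injective (trans (sym (Fin.toℕ-cast e i))
    (trans (cong toℕ (lookup-injective u p)) (Fin.toℕ-cast e j)))

⁻-≺ : ∀ {n} (σ : Order n) {u v} → u ≺[ σ ⁻ ] v → v ≺[ σ ] u
⁻-≺ {n} σ {u} {v} lt = ℕ.≰⇒> λ le → ℕ.<⇒≱ lt
  (subst₂ _≤_ (sym (Fin.opposite-prop (pos σ v))) (sym (Fin.opposite-prop (pos σ u)))
    (ℕ.∸-monoʳ-≤ n (s≤s le)))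

≺-⁻ : ∀ {n} (σ : Order n) {u v} → v ≺[ σ ] u → u ≺[ σ ⁻ ] v
≺-⁻ {n} σ {u} {v} lt = subst₂ _<_ (sym (Fin.opposite-prop (pos σ u))) (sym (Fin.opposite-prop (pos σ v)))
    (ℕ.∸-monoʳ-< (s≤s lt) (Fin.toℕ<n (pos σ u)))

toList-⁻ : ∀ {n} (σ : Order n) → toList (σ ⁻) ≡ reverse (toList σ)
toList-⁻ σ = sorted-unique {R = λ u v → u ≺[ σ ⁻ ] v} ℕ.<-asym
  (AllPairs-toList⁺ (σ ⁻) id)
  (AllPairs.map (≺-⁻ σ) (AllPairs-reverse (AllPairs-toList⁺ σ id)))
  (λ _ → Any.reverse⁺ (∈-toList σ _)) (λ _ → ∈-toList (σ ⁻) _)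

index-0 : ∀ {n} → Fin n → ∃ λ (i : Fin n) → toℕ i ≡ 0
index-0 zero    = zero , refl
index-0 (suc _) = zero , refl

-- Chordal graphs and maximal neighbourhood searches

-- A walk rather than a path: interior vertices may repeat. `P` holds inside and fails at both ends,
-- which keeps the ends apart from the interior; it also carries whatever is to be known about the
-- vertex that will be found inside.
record ClosedWalk {n} (G : Graph n) (P : Fin n → Set) (c : ℕ → Fin n) (L : ℕ) : Set where
  field
    chain  : ∀ {t} → t < L → c (suc t) ∈ N G (c t)
    close  : c L ∈ N G (c 0)
    inside : ∀ {t} → 0 < t → t < L → P (c t)
    start  : ¬ P (c 0)
    end    : ¬ P (c L)

-- The chord skips `suc e` vertices after position `i`, and `r` steps remain behind its far end.
-- Naming the gap and the remainder avoids subtraction.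
module Shortcut {n : ℕ} {G : Graph n} {P : Fin n → Set} {c : ℕ → Fin n} (i e r : ℕ)
  (W : ClosedWalk G P c (suc (suc i) + e + r))
  (chord : c (suc (suc i) + e) ∈ N G (c i)) where
  open ClosedWalk W

  shortcut : ℕ → Fin n
  shortcut t with t ℕ.≤? i
  ... | yes _ = c t
  ... | no  _ = c (suc e + t)

  shortcut-≤ : ∀ {t} → t ≤ i → shortcut t ≡ c t
  shortcut-≤ {t} le with t ℕ.≤? i
  ... | yes _ = refl
  ... | no ¬p = ⊥-elim (¬p le)

  shortcut-> : ∀ {t} → i < t → shortcut t ≡ c (suc e + t)
  shortcut-> {t} lt with t ℕ.≤? i
  ... | yes p = ⊥-elim (ℕ.<⇒≱ lt p)
  ... | no _  = refl

  shift : ∀ {t} → t < suc i + r → suc e + t < suc (suc i) + e + r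
  shift {t} lt = subst (suc (suc e + t) ≤_) eq (s≤s (ℕ.+-monoʳ-< e lt′))
    where
    lt′ : t < suc (i + r)
    lt′ = lt
    eq : suc (e + suc (i + r)) ≡ suc (suc i) + e + r
    eq = cong suc (trans (ℕ.+-suc e (i + r)) (cong suc (trans (sym (ℕ.+-assoc e i r)) (cong (_+ r) (ℕ.+-comm e i)))))

  last : shortcut (suc i + r) ≡ c (suc (suc i) + e + r)
  last = trans (shortcut-> (s≤s (ℕ.m≤m+n i r)))
    (cong (c ∘ suc) (trans (ℕ.+-suc e (i + r)) (cong suc (trans (sym (ℕ.+-assoc e i r)) (cong (_+ r) (ℕ.+-comm e i))))))

  first : shortcut 0 ≡ c 0
  first = shortcut-≤ z≤n

  shortcut-walk : ClosedWalk G P shortcut (suc i + r)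
  shortcut-walk = record
    { chain  = chain′
    ; close  = subst₂ (λ x y → x ∈ N G y) (sym last) (sym first) close
    ; inside = inside′
    ; start  = start ∘ subst P first
    ; end    = end ∘ subst P last
    }
    where
    chain′ : ∀ {t} → t < suc i + r → shortcut (suc t) ∈ N G (shortcut t)
    chain′ {t} lt with ℕ.<-cmp t i
    ... | tri< t<i _ _ = subst₂ (λ x y → x ∈ N G y) (sym (shortcut-≤ t<i)) (sym (shortcut-≤ (ℕ.<⇒≤ t<i)))
      (chain (ℕ.<-≤-trans t<i (ℕ.≤-trans (ℕ.n≤1+n i) (ℕ.≤-trans (ℕ.n≤1+n _) (ℕ.≤-trans (ℕ.m≤m+n _ e) (ℕ.m≤m+n _ r))))))
    ... | tri≈ _ refl _ = subst₂ (λ x y → x ∈ N G y) (sym (trans (shortcut-> ℕ.≤-refl)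
        (cong (c ∘ suc) (trans (ℕ.+-suc e t) (cong suc (ℕ.+-comm e t))))))
      (sym (shortcut-≤ ℕ.≤-refl)) chord
    ... | tri> _ _ i<t = subst₂ (λ x y → x ∈ N G y)
      (sym (trans (shortcut-> (ℕ.m≤n⇒m≤1+n i<t)) (cong (c ∘ suc) (ℕ.+-suc e t)))) (sym (shortcut-> i<t))
      (chain (shift lt))
    inside′ : ∀ {t} → 0 < t → t < suc i + r → P (shortcut t)
    inside′ {t} 0<t lt with ℕ.≤-<-connex t i
    ... | inj₁ t≤i = subst P (sym (shortcut-≤ t≤i)) (inside 0<t
      (s≤s (ℕ.≤-trans t≤i (ℕ.≤-trans (ℕ.n≤1+n i) (ℕ.≤-trans (ℕ.m≤m+n (suc i) e) (ℕ.m≤m+n (suc i + e) r))))))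
    ... | inj₂ i<t = subst P (sym (shortcut-> i<t)) (inside (s≤s z≤n) (shift lt))

module _ {n : ℕ} {G : Graph n} {P : Fin n → Set} where

  Chord : (ℕ → Fin n) → ℕ → ℕ → ℕ → Set
  Chord c L i j = suc i < j × ¬ (i ≡ 0 × j ≡ L) × c j ∈ N G (c i)

  chordless-cycle : ∀ {c L} → ClosedWalk G P c L →
    (∀ {i j} → i < L → j < suc L → ¬ Chord c L i j) → InducedCycle G (suc L)
  chordless-cycle {c} {L} W none = record
    { vertex    = c ∘ toℕ
    ; injective = λ {i} {j} e → case ℕ.<-cmp (toℕ i) (toℕ j) of λ
        { (tri< lt _ _) → ⊥-elim (distinct lt (Fin.toℕ<n j) e)
        ; (tri≈ _ eq _) → Fin.toℕ-injective eq
        ; (tri> _ _ gt) → ⊥-elim (distinct gt (Fin.toℕ<n i) (sym e)) }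
    ; adjacent  = λ i j → mk⇔ (to i j) (from i j)
    }
    where
    open ClosedWalk W
    distinct : ∀ {i j} → i < j → j < suc L → c i ≢ c j
    distinct {zero} {j} lt (s≤s j≤L) e with ℕ.m≤n⇒m<n∨m≡n j≤L
    ... | inj₁ j<L  = start (subst P (sym e) (inside lt j<L))
    ... | inj₂ refl = Graph.irrefl G (c 0) (subst (_∈ N G (c 0)) (sym e) close)
    -- If an interior vertex recurs at position `j`, then the vertex after `j` is joined to the
    -- first occurrence by a chord.
    distinct {suc i} {j} lt (s≤s j≤L) e with ℕ.m≤n⇒m<n∨m≡n j≤L
    ... | inj₁ j<L  = none (ℕ.<-trans lt j<L) (s≤s j<L)
      (s≤s lt , (λ ()) , subst (λ x → c (suc j) ∈ N G x) (sym e) (chain j<L))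
    ... | inj₂ refl = end (subst P e (inside (s≤s z≤n) lt))
    neighbour : ∀ {i j} → i < j → j < suc L → c j ∈ N G (c i) → j ≡ suc i ⊎ (i ≡ 0 × j ≡ L)
    neighbour {i} {j} lt (s≤s j≤L) adj with ℕ.m≤n⇒m<n∨m≡n lt | (i ℕ.≟ 0) ×-dec (j ℕ.≟ L)
    ... | inj₂ e  | _     = inj₁ (sym e)
    ... | inj₁ _  | yes p = inj₂ p
    ... | inj₁ lt′ | no ¬p = ⊥-elim (none (ℕ.<-≤-trans lt j≤L) (s≤s j≤L) (lt′ , ¬p , adj))
    to : ∀ i j → c (toℕ j) ∈ N G (c (toℕ i)) → Next (suc L) i j ⊎ Next (suc L) j i
    to i j adj with ℕ.<-cmp (toℕ i) (toℕ j)
    ... | tri≈ _ e _ = ⊥-elim (Graph.irrefl G _ (subst (λ t → c t ∈ N G (c (toℕ i))) (sym e) adj))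
    ... | tri< lt _ _ with neighbour lt (Fin.toℕ<n j) adj
    ...   | inj₁ e       = inj₁ (inj₁ e)
    ...   | inj₂ (a , b) = inj₂ (inj₂ (cong suc b , a))
    to i j adj | tri> _ _ gt with neighbour gt (Fin.toℕ<n i) (Graph.sym G adj)
    ...   | inj₁ e       = inj₂ (inj₁ e)
    ...   | inj₂ (a , b) = inj₁ (inj₂ (cong suc b , a))
    next⇒ : ∀ i j → Next (suc L) i j → c (toℕ j) ∈ N G (c (toℕ i))
    next⇒ i j (inj₁ e) = subst (λ t → c t ∈ N G (c (toℕ i))) (sym e)
      (chain (ℕ.s≤s⁻¹ (subst (_< suc L) e (Fin.toℕ<n j))))
    next⇒ i j (inj₂ (a , b)) = subst₂ (λ s t → c s ∈ N G (c t)) (sym b) (sym (ℕ.suc-injective a)) (Graph.sym G close)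
    from : ∀ i j → Next (suc L) i j ⊎ Next (suc L) j i → c (toℕ j) ∈ N G (c (toℕ i))
    from i j (inj₁ x) = next⇒ i j x
    from i j (inj₂ x) = Graph.sym G (next⇒ j i x)

  CommonNeighbour : (ℕ → Fin n) → ℕ → Set
  CommonNeighbour c L = ∃ λ z → P z × z ∈ N G (c 0) × z ∈ N G (c L)

  -- Cutting off chords that do not join both ends keeps the closing edge and
  -- shortens the walk, until chordality forces it to be a triangle.
  common-neighbour : Chordal G → ∀ L c → 1 < L → ClosedWalk G P c L → CommonNeighbour c L
  common-neighbour chordal = <-rec (λ L → ∀ c → 1 < L → ClosedWalk G P c L → CommonNeighbour c L) step
    where
    step : ∀ L → (∀ {K} → K < L → ∀ c → 1 < K → ClosedWalk G P c K → CommonNeighbour c K) →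
           ∀ c → 1 < L → ClosedWalk G P c L → CommonNeighbour c L
    step L rec c 1<L W with ℕ.anyUpTo? (λ i → ℕ.anyUpTo? (λ j →
      (suc i ℕ.<? j) ×-dec ¬? ((i ℕ.≟ 0) ×-dec (j ℕ.≟ L)) ×-dec (c j ∈? N G (c i))) (suc L)) L
    ... | yes (i , i<L , j , s≤s j≤L , si<j , notEnds , adj)
      with ℕ.m≤n⇒∃[o]m+o≡n si<j | ℕ.m≤n⇒∃[o]m+o≡n j≤L
    ...   | e , refl | r , refl = z , Pz ,
      subst (λ x → z ∈ N G x) first z~0 , subst (λ x → z ∈ N G x) last z~L
      where
      open Shortcut i e r W adj
      1<L′ : ∀ i r → ¬ (i ≡ 0 × suc (suc i) + e ≡ suc (suc i) + e + r) → 1 < suc i + r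
      1<L′ (suc i) r       _  = s≤s (s≤s z≤n)
      1<L′ zero    (suc r) _  = s≤s (s≤s z≤n)
      1<L′ zero    zero    ne = ⊥-elim (ne (refl , sym (ℕ.+-identityʳ _)))
      shorter : suc i + r < suc (suc i) + e + r
      shorter = ℕ.+-monoˡ-≤ r (ℕ.m≤m+n (suc (suc i)) e)
      found = rec shorter shortcut (1<L′ i r notEnds) shortcut-walk
      z   = proj₁ found
      Pz  = proj₁ (proj₂ found)
      z~0 = proj₁ (proj₂ (proj₂ found))
      z~L = proj₂ (proj₂ (proj₂ found))
    step (suc (suc zero)) rec c 1<L W | no none = c 1 , inside (s≤s z≤n) (s≤s (s≤s z≤n)) ,
      chain (s≤s z≤n) , Graph.sym G (chain (s≤s (s≤s z≤n)))
      where open ClosedWalk W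
    step (suc zero) rec c (s≤s ()) W | no none
    -- The length is at least 3 here, so a chordless walk is an induced cycle on at least four
    -- vertices.
    step (suc (suc (suc L))) rec c 1<L W | no none =
      ⊥-elim (chordal _ (s≤s (s≤s (s≤s (s≤s z≤n))))
        (chordless-cycle W λ i< j< ch → none (_ , i< , _ , j< , ch)))

-- This is all that the chordal argument uses of LexBFS⁺. Both fields assume that `y` has every
-- visited neighbour of `x`; `maximal` turns this inclusion into equality, which is why `tie` may
-- start from the inclusion.
record MNS⁺ {n} (G : Graph n) (ρ π : Order n) : Set where
  field
    maximal : ∀ {x y} → x ≼[ π ] y → (∀ {a} → a ≺[ π ] x → a ∈ N G x → a ∈ N G y) →
              ∀ {a} → a ≺[ π ] x → a ∈ N G y → a ∈ N G x
    tie     : ∀ {x y} → x ≼[ π ] y → (∀ {a} → a ≺[ π ] x → a ∈ N G x → a ∈ N G y) → y ≼[ ρ ] x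

prepend : ∀ {n} → Fin n → (ℕ → Fin n) → ℕ → Fin n
prepend x c zero    = x
prepend x c (suc t) = c t

data Anc {n} (G : Graph n) (π : Order n) (a : Fin n) : Fin n → Set where
  here : Anc G π a a
  up   : ∀ {v p} → Parent G π v p → Anc G π a p → Anc G π a v

argmax : ∀ {n} (σ : Order n) {P : Fin n → Set} → (∀ v → Dec (P v)) → ∀ {v} → P v →
  ∃ λ p → P p × (∀ w → P w → w ≼[ σ ] p)
argmax {n} σ {P} P? {v} Pv = go v Pv (Fin.>-wellFounded (pos σ v))
  where
  go : ∀ v → P v → Acc Fin._>_ (pos σ v) → ∃ λ p → P p × (∀ w → P w → w ≼[ σ ] p)
  go v Pv (acc rs) with Fin.any? (λ w → P? w ×-dec (pos σ v Fin.<? pos σ w))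
  ... | yes (w , Pw , lt) = go w Pw (rs lt)
  ... | no none           = v , Pv , λ w Pw → ℕ.≮⇒≥ λ lt → none (w , Pw , lt)

module Ancestry {n : ℕ} (G : Graph n) (π : Order n) where

  parent-unique : ∀ {v p q} → Parent G π v p → Parent G π v q → p ≡ q
  parent-unique ((p∈ , p≺) , p-max) ((q∈ , q≺) , q-max) =
    pos-injective π (Fin.toℕ-injective (ℕ.≤-antisym (q-max _ p∈ p≺) (p-max _ q∈ q≺)))

  parent-exists : ∀ {v a} → a ∈ N G v → a ≺[ π ] v → ∃ (Parent G π v)
  parent-exists {v} a∈ a≺
    with argmax π (λ w → (w ∈? N G v) ×-dec (pos π w Fin.<? pos π v)) (a∈ , a≺)
  ... | p , (p∈ , p≺) , max = p , (p∈ , p≺) , λ w w∈ w≺ → max w (w∈ , w≺)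

  Anc-≼ : ∀ {a v} → Anc G π a v → a ≼[ π ] v
  Anc-≼ here                     = ℕ.≤-refl
  Anc-≼ (up ((_ , p≺v) , _) a-p) = ℕ.≤-trans (Anc-≼ a-p) (ℕ.<⇒≤ p≺v)

  Anc-trans : ∀ {a b c} → Anc G π a b → Anc G π b c → Anc G π a c
  Anc-trans ab here      = ab
  Anc-trans ab (up p bc) = up p (Anc-trans ab bc)

  Anc-chain : ∀ {a b v} → Anc G π a v → Anc G π b v → Anc G π a b ⊎ Anc G π b a
  Anc-chain here      b-v       = inj₂ b-v
  Anc-chain (up p a)  here      = inj₁ (up p a)
  Anc-chain (up p a)  (up q b)  with refl ← parent-unique p q = Anc-chain a b

  Anc-parent : ∀ {a v p} → Parent G π v p → a ≢ v → Anc G π a v → Anc G π a p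
  Anc-parent p a≢v here     = ⊥-elim (a≢v refl)
  Anc-parent p a≢v (up q a) with refl ← parent-unique p q = a

  Link : ℕ → Fin n → Fin n → Set
  Link i u w = w ∈ N G u × i ≤ toℕ (pos π u) × i ≤ toℕ (pos π w)

  Link-sym : ∀ {i u w} → Link i u w → Link i w u
  Link-sym (e , iu , iw) = Graph.sym G e , iw , iu

  Link-pred : ∀ {i u w} → Link (suc i) u w → Link i u w
  Link-pred (e , iu , iw) = e , ℕ.<⇒≤ iu , ℕ.<⇒≤ iw

  Anc-Link : ∀ {a v} → Anc G π a v → Star (Link (toℕ (pos π a))) a v
  Anc-Link here                         = ε
  Anc-Link (up ((p∈ , p≺) , _) a-p) =
    Anc-Link a-p ◅◅ (Graph.sym G p∈ , Anc-≼ a-p , ℕ.≤-trans (Anc-≼ a-p) (ℕ.<⇒≤ p≺)) ◅ ε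

  -- A walk in the unvisited part, cut off at the first neighbour y of k and then
  -- continued to k.
  record FirstHit (i : ℕ) (x k : Fin n) : Set where
    field
      y      : Fin n
      k∈     : k ∈ N G y
      unvis  : i ≤ toℕ (pos π y)
      L      : ℕ
      c      : ℕ → Fin n
      start  : c 0 ≡ x
      end    : c (suc L) ≡ k
      chain  : ∀ {t} → t < suc L → c (suc t) ∈ N G (c t)
      inside : ∀ {t} → t < suc L → i ≤ toℕ (pos π (c t)) × (k ∈ N G (c t) → c t ≡ y)

  first-hit : ∀ {i x y k} → Star (Link i) x y → i ≤ toℕ (pos π x) → k ∈ N G y → FirstHit i x k
  first-hit {i} {x} {y} {k} walk i≤x k∈y with k ∈? N G x
  ... | yes k∈x = record
    { y = x ; k∈ = k∈x ; unvis = i≤x ; L = 0 ; c = prepend x (λ _ → k) ; start = refl ; end = refl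
    ; chain = λ { {zero} _ → k∈x ; {suc _} (s≤s ()) }
    ; inside = λ { {zero} _ → i≤x , λ _ → refl ; {suc _} (s≤s ()) } }
  first-hit ε i≤x k∈y | no k∉x = ⊥-elim (k∉x k∈y)
  first-hit {x = x} ((e , _ , i≤w) ◅ walk) i≤x k∈y | no k∉x = record
    { y = H.y ; k∈ = H.k∈ ; unvis = H.unvis ; L = suc H.L ; c = prepend x H.c ; start = refl ; end = H.end
    ; chain = λ { {zero} _ → subst (_∈ N G x) (sym H.start) e ; {suc t} (s≤s t<) → H.chain t< }
    ; inside = λ { {zero} _ → i≤x , (λ k∈ → ⊥-elim (k∉x k∈)) ; {suc t} (s≤s t<) → H.inside t< } }
    where module H = FirstHit (first-hit walk i≤w k∈y)

  -- `i` is a point in time: positions below `i` are visited. The walk from `x` to `y` stands for a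
  -- connected component of the unvisited part.
  Clique : ℕ → Set
  Clique i = ∀ {x y} → Star (Link i) x y → i ≤ toℕ (pos π x) → i ≤ toℕ (pos π y) → ∀ {a b} →
    a ∈ N G x → toℕ (pos π a) < i → b ∈ N G y → toℕ (pos π b) < i → a ≢ b → a ∈ N G b

module MNSChordal {n : ℕ} {G : Graph n} {ρ π : Order n} (chordal : Chordal G) (mns : MNS⁺ G ρ π) where
  open MNS⁺ mns
  open Ancestry G π

  -- Suppose that `b` is not adjacent to `x`, and cut the walk at the first neighbour `H.y` of `b`.
  -- Every visited neighbour `a` of `x` is adjacent to `b` by the clique property, so `a`, the walk
  -- and `b` close up, and chordality gives `a` and `b` a common neighbour, which must be `H.y`.
  -- Thus `H.y` has all visited neighbours of `x`, and maximality forces its neighbour `b` on `x` as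
  -- well.
  absorb-clique : ∀ {x} → Clique (toℕ (pos π x)) → ∀ {y} → Star (Link (toℕ (pos π x))) x y →
    x ≼[ π ] y → ∀ {b} → b ∈ N G y → b ≺[ π ] x → b ∈ N G x
  absorb-clique {x} cl {y} walk x≼y {b} b∈y b≺x with b ∈? N G x
  ... | yes b∈x = b∈x
  ... | no b∉x  = maximal H.unvis common b≺x H.k∈
    where
    module H = FirstHit (first-hit walk ℕ.≤-refl b∈y)
    common : ∀ {a} → a ≺[ π ] x → a ∈ N G x → a ∈ N G H.y
    -- The second component of `P` is what identifies the common neighbour as `H.y`.
    common {a} a≺x a∈x with common-neighbour {P = λ z → x ≼[ π ] z × (b ∈ N G z → z ≡ H.y)} chordal
      (suc (suc H.L)) (prepend a H.c) (s≤s (s≤s z≤n)) (record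
      { chain  = λ { {zero} _ → subst (_∈ N G a) (sym H.start) (Graph.sym G a∈x) ; {suc t} (s≤s t<) → H.chain t< }
      ; close  = subst (_∈ N G a) (sym H.end)
                  (Graph.sym G (cl walk ℕ.≤-refl x≼y a∈x a≺x b∈y b≺x λ { refl → b∉x a∈x }))
      ; inside = λ { {suc t} _ (s≤s t<) → H.inside t< }
      ; start  = λ (x≼a , _) → ℕ.<⇒≱ a≺x x≼a
      ; end    = λ (x≼b , _) → ℕ.<⇒≱ b≺x (subst (λ z → x ≼[ π ] z) H.end x≼b)
      })
    ... | z , (_ , uniq) , z∈a , z∈b
      with refl ← uniq (Graph.sym G (subst (λ v → z ∈ N G v) H.end z∈b)) = Graph.sym G z∈a

  -- Only pairs that contain the vertex at position `i` are new. That vertex is the first of its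
  -- component to be visited, and `absorb-clique` with the previous clique applies to it.
  clique : ∀ i → i ≤ n → Clique i
  clique zero    _   walk _ _ _ ()
  clique (suc i) i<n {x} {y} walk i<x i<y {a} {b} a∈x (s≤s a≤i) b∈y (s≤s b≤i) a≢b
    with ℕ.m≤n⇒m<n∨m≡n a≤i | ℕ.m≤n⇒m<n∨m≡n b≤i
  ... | inj₁ a<i | inj₁ b<i = clique i (ℕ.<⇒≤ i<n) (Star.map Link-pred walk) (ℕ.<⇒≤ i<x) (ℕ.<⇒≤ i<y) a∈x a<i b∈y b<i a≢b
  ... | inj₂ a≡i | inj₂ b≡i = ⊥-elim (a≢b (pos-injective π (Fin.toℕ-injective (trans a≡i (sym b≡i)))))
  ... | inj₂ refl | inj₁ b<i = Graph.sym G (absorb-clique (clique i (ℕ.<⇒≤ i<n))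
        ((Graph.sym G a∈x , ℕ.≤-refl , ℕ.<⇒≤ i<x) ◅ Star.map Link-pred walk) (ℕ.<⇒≤ i<y) b∈y b<i)
  ... | inj₁ a<i | inj₂ refl = absorb-clique (clique i (ℕ.<⇒≤ i<n))
        ((Graph.sym G b∈y , ℕ.≤-refl , ℕ.<⇒≤ i<y) ◅ Star.reverse Link-sym (Star.map Link-pred walk)) (ℕ.<⇒≤ i<x) a∈x a<i

  absorb : ∀ {x y b} → Anc G π x y → b ∈ N G y → b ≺[ π ] x → b ∈ N G x
  absorb {x} anc = absorb-clique (clique _ (ℕ.<⇒≤ (Fin.toℕ<n (pos π x)))) (Anc-Link anc) (Anc-≼ anc)

  Anc-tie : ∀ {x y} → Anc G π x y → (∀ {a} → a ≺[ π ] x → a ∈ N G x → a ∈ N G y) → y ≼[ ρ ] x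
  Anc-tie anc = tie (Anc-≼ anc)

  -- The earlier neighbours of `v` form a clique, so one that differs from the parent `p` is an
  -- earlier neighbour of `p`, and the claim climbs up the tree.
  trémaux : ∀ {a v} → a ∈ N G v → a ≺[ π ] v → Anc G π a v
  trémaux {a} {v} a∈ a≺ = go v a∈ a≺ (Fin.<-wellFounded (pos π v))
    where
    go : ∀ v → a ∈ N G v → a ≺[ π ] v → Acc Fin._<_ (pos π v) → Anc G π a v
    go v a∈ a≺ (acc rs) with parent-exists a∈ a≺
    ... | p , par@((p∈ , p≺) , max) with a Fin.≟ p
    ...   | yes refl = up par here
    ...   | no a≢p with ≼⇒≡⊎≺ π (max a a∈ a≺)
    ...     | inj₁ a≡p = ⊥-elim (a≢p a≡p)
    ...     | inj₂ a≺p = up par (go p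
      (clique _ (ℕ.<⇒≤ (Fin.toℕ<n (pos π v))) ε ℕ.≤-refl ℕ.≤-refl a∈ a≺ p∈ p≺ a≢p) a≺p (rs p≺))

-- Searches of the 𝓛-tree.

module Tree {n : ℕ} {G : Graph n} {π : Order n} {T : Graph n} {s : Fin n} (is𝓛 : Is𝓛Tree G π T s) where
  open Is𝓛Tree is𝓛 public
  open Ancestry G π

  no-parent : ∀ {p} → ¬ Parent G π s p
  no-parent {p} ((_ , p≺s) , _) with () ← subst (toℕ (pos π p) <_) root p≺s

  parent : ∀ v → v ≢ s → ∃ (Parent G π v)
  parent v v≢s with left v v≢s
  ... | _ , u∈ , u≺ = parent-exists u∈ u≺

  Parent⇒T : ∀ {v p} → Parent G π v p → v ∈ N T p
  Parent⇒T par = Equivalence.from (edge _ _) (inj₂ par)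

  T⇒Parent : ∀ {u v} → u ∈ N T v → Parent G π v u ⊎ Parent G π u v
  T⇒Parent = Equivalence.to (edge _ _)

  Anc-root : ∀ v → Anc G π s v
  Anc-root v = go v (Fin.<-wellFounded (pos π v))
    where
    go : ∀ v → Acc Fin._<_ (pos π v) → Anc G π s v
    go v (acc rs) with v Fin.≟ s
    ... | yes refl = here
    ... | no v≢s with parent v v≢s
    ...   | p , par@((_ , p≺) , _) = up par (go p (rs p≺))

  -- What BFS and DFS of the tree have in common; it suffices for ancestors to precede descendants.
  Search : Order n → Set
  Search ω = Starts ω s × (∀ i → 0 < toℕ i → ∃ λ u → Visited ω i u × at ω i ∈ N T u)

  starts-unique : ∀ (ω : Order n) {u v} → Starts ω u → Starts ω v → u ≡ v
  starts-unique ω su sv = pos-injective ω (Fin.toℕ-injective (trans su (sym sv)))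

  -- The visited tree neighbour by which `v` was reached is its parent or one of its children. A
  -- child would, by induction, come after `v`.
  parent-first : ∀ ω → Search ω → ∀ {v p} → Parent G π v p → p ≺[ ω ] v
  parent-first ω (st , step) {v} {p} = go v p (Fin.<-wellFounded (pos ω v))
    where
    go : ∀ v p → Acc Fin._<_ (pos ω v) → Parent G π v p → p ≺[ ω ] v
    go v p (acc rs) par with ℕ.m≤n⇒m<n∨m≡n {0} {toℕ (pos ω v)} z≤n
    ... | inj₂ e with refl ← starts-unique ω (sym e) st = ⊥-elim (no-parent par)
    ... | inj₁ 0<v with step (pos ω v) 0<v
    ...   | u , u≺v , v∈u with T⇒Parent (subst (_∈ N T u) (at-pos ω v) v∈u)
    ...     | inj₁ u-par-v = ⊥-elim (ℕ.<-asym u≺v (go u v (rs u≺v) u-par-v))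
    ...     | inj₂ v-par-u with refl ← parent-unique par v-par-u = u≺v

  Anc-≼-search : ∀ ω → Search ω → ∀ {a v} → Anc G π a v → a ≼[ ω ] v
  Anc-≼-search ω S here       = ℕ.≤-refl
  Anc-≼-search ω S (up p a-p) = ℕ.≤-trans (Anc-≼-search ω S a-p) (ℕ.<⇒≤ (parent-first ω S p))

-- Lexicographic comparison, partition refinement and labels

module _ {A : Set} where

  -- Comparison with respect to a list of sets that starts with the least
  -- significant one: Gt 𝒮 x y holds if the most significant set that contains
  -- exactly one of x and y contains x.
  Eq Gt : List (A → Bool) → A → A → Set
  Eq []      x y = 𝟙
  Eq (S ∷ 𝒮) x y = Eq 𝒮 x y × S x ≡ S y
  Gt []      x y = ⊥
  Gt (S ∷ 𝒮) x y = Gt 𝒮 x y ⊎ (Eq 𝒮 x y × S x ≡ true × S y ≡ false)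

  Eq-refl : ∀ 𝒮 {x} → Eq 𝒮 x x
  Eq-refl []      = tt
  Eq-refl (S ∷ 𝒮) = Eq-refl 𝒮 , refl

  Eq-sym : ∀ 𝒮 {x y} → Eq 𝒮 x y → Eq 𝒮 y x
  Eq-sym []      _       = tt
  Eq-sym (S ∷ 𝒮) (p , e) = Eq-sym 𝒮 p , sym e

  Eq-trans : ∀ 𝒮 {x y z} → Eq 𝒮 x y → Eq 𝒮 y z → Eq 𝒮 x z
  Eq-trans []      _       _       = tt
  Eq-trans (S ∷ 𝒮) (p , e) (q , f) = Eq-trans 𝒮 p q , trans e f

  Gt-Eq : ∀ 𝒮 {x y z} → Gt 𝒮 x y → Eq 𝒮 y z → Gt 𝒮 x z
  Gt-Eq (S ∷ 𝒮) (inj₁ g)           (q , _) = inj₁ (Gt-Eq 𝒮 g q)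
  Gt-Eq (S ∷ 𝒮) (inj₂ (p , a , b)) (q , f) = inj₂ (Eq-trans 𝒮 p q , a , trans (sym f) b)

  Eq-Gt : ∀ 𝒮 {x y z} → Eq 𝒮 x y → Gt 𝒮 y z → Gt 𝒮 x z
  Eq-Gt (S ∷ 𝒮) (q , _) (inj₁ g)           = inj₁ (Eq-Gt 𝒮 q g)
  Eq-Gt (S ∷ 𝒮) (q , f) (inj₂ (p , a , b)) = inj₂ (Eq-trans 𝒮 q p , trans f a , b)

  Gt-trans : ∀ 𝒮 {x y z} → Gt 𝒮 x y → Gt 𝒮 y z → Gt 𝒮 x z
  Gt-trans (S ∷ 𝒮) (inj₁ g)           (inj₁ h)           = inj₁ (Gt-trans 𝒮 g h)
  Gt-trans (S ∷ 𝒮) (inj₁ g)           (inj₂ (q , _))     = inj₁ (Gt-Eq 𝒮 g q)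
  Gt-trans (S ∷ 𝒮) (inj₂ (p , _))     (inj₁ h)           = inj₁ (Eq-Gt 𝒮 p h)
  Gt-trans (S ∷ 𝒮) (inj₂ (p , a , b)) (inj₂ (q , _ , c)) = inj₂ (Eq-trans 𝒮 p q , a , c)

  Gt-irrefl : ∀ 𝒮 {x} → ¬ Gt 𝒮 x x
  Gt-irrefl (S ∷ 𝒮) (inj₁ g)           = Gt-irrefl 𝒮 g
  Gt-irrefl (S ∷ 𝒮) (inj₂ (_ , a , b)) with () ← trans (sym a) b

  Eq⇒¬Gt : ∀ 𝒮 {x y} → Eq 𝒮 x y → ¬ Gt 𝒮 x y
  Eq⇒¬Gt 𝒮 p g = Gt-irrefl 𝒮 (Gt-Eq 𝒮 g (Eq-sym 𝒮 p))

  Gt-asym : ∀ 𝒮 {x y} → Gt 𝒮 x y → ¬ Gt 𝒮 y x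
  Gt-asym 𝒮 g h = Gt-irrefl 𝒮 (Gt-trans 𝒮 g h)

  compare : ∀ 𝒮 x y → Eq 𝒮 x y ⊎ Gt 𝒮 x y ⊎ Gt 𝒮 y x
  compare []      x y = inj₁ tt
  compare (S ∷ 𝒮) x y with compare 𝒮 x y
  ... | inj₂ (inj₁ g) = inj₂ (inj₁ (inj₁ g))
  ... | inj₂ (inj₂ g) = inj₂ (inj₂ (inj₁ g))
  ... | inj₁ p with S x | S y
  ...   | true  | true  = inj₁ (p , refl)
  ...   | false | false = inj₁ (p , refl)
  ...   | true  | false = inj₂ (inj₁ (inj₂ (p , refl , refl)))
  ...   | false | true  = inj₂ (inj₂ (inj₂ (Eq-sym 𝒮 p , refl , refl)))

  Eq-∈ : ∀ {J : Set} {F : J → A → Bool} {js x y} → Eq (map F js) x y → ∀ {j} → j ∈ₗ js → F j x ≡ F j y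
  Eq-∈ {js = _ ∷ _} (_ , e) (here refl) = e
  Eq-∈ {js = _ ∷ _} (p , _) (there j∈)  = Eq-∈ p j∈

  -- Read `b <ⱼ a` as: `b` is more significant than `a`. The list has the least significant index
  -- first, as in `Gt`, so the witness found is the index that decides.
  Gt-witness : ∀ {J : Set} {F : J → A → Bool} {_<ⱼ_ : J → J → Set} → Asymmetric _<ⱼ_ →
    ∀ {js x y} → AllPairs (λ p q → q <ⱼ p) js → Gt (map F js) x y →
    ∃ λ a → a ∈ₗ js × F a x ≡ true × F a y ≡ false × (∀ {b} → b ∈ₗ js → b <ⱼ a → F b x ≡ F b y)
  Gt-witness asym {j ∷ js} (_ ∷ _) (inj₂ (p , a , b)) = j , here refl , a , b , λ
    { (here refl) lt → ⊥-elim (asym lt lt) ; (there b∈) lt → Eq-∈ p b∈ }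
  Gt-witness asym {j ∷ js} (j> ∷ ps) (inj₁ g) with Gt-witness asym ps g
  ... | a , a∈ , fx , fy , agree = a , there a∈ , fx , fy , λ
    { (here refl) lt → ⊥-elim (asym lt (All.lookup j> a∈)) ; (there b∈) lt → agree b∈ lt }

bits : ∀ {n} → Subset n → Fin n → Bool
bits S x = does (x ∈? S)

does⇒ : ∀ {P : Set} (P? : Dec P) → does P? ≡ true → P
does⇒ (yes p) _ = p

does-∧⇒ : ∀ {P Q : Set} (P? : Dec P) (Q? : Dec Q) → does P? ∧ does Q? ≡ true → P × Q
does-∧⇒ (yes p) (yes q) _ = p , q

bits⁺ : ∀ {n} {S : Subset n} {x} → x ∈ S → bits S x ≡ true
bits⁺ {S = S} {x} x∈ = dec-true (x ∈? S) x∈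

bits⁻ : ∀ {n} {S : Subset n} {x} → bits S x ≡ true → x ∈ S
bits⁻ {S = S} {x} = does⇒ (x ∈? S)

bits⁺′ : ∀ {n} {S : Subset n} {x} → x ∉ S → bits S x ≡ false
bits⁺′ {S = S} {x} x∉ = dec-false (x ∈? S) x∉

bits⁻′ : ∀ {n} {S : Subset n} {x} → bits S x ≡ false → x ∉ S
bits⁻′ {S = S} {x} e x∈ with () ← trans (sym (bits⁺ x∈)) e

-- The order of the refined list. `ρ` enters reversed because ties go to its rightmost vertex.
Ahead : ∀ {n} → Order n → List (Fin n → Bool) → Fin n → Fin n → Set
Ahead ρ 𝒮 x y = Gt 𝒮 x y ⊎ (Eq 𝒮 x y × y ≺[ ρ ] x)

Ahead-asym : ∀ {n} (ρ : Order n) 𝒮 → Asymmetric (Ahead ρ 𝒮)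
Ahead-asym ρ 𝒮 (inj₁ g)       (inj₁ h)       = Gt-asym 𝒮 g h
Ahead-asym ρ 𝒮 (inj₁ g)       (inj₂ (q , _)) = Eq⇒¬Gt 𝒮 (Eq-sym 𝒮 q) g
Ahead-asym ρ 𝒮 (inj₂ (p , _)) (inj₁ h)       = Eq⇒¬Gt 𝒮 (Eq-sym 𝒮 p) h
Ahead-asym ρ 𝒮 (inj₂ (_ , l)) (inj₂ (_ , k)) = ℕ.<-asym l k

record Classes {n} (Ss : List (Subset n)) (Q : List (Subset n)) : Set where
  field
    cover    : ∀ x → ∃ λ X → X ∈ₗ Q × x ∈ X
    same     : ∀ {X} → X ∈ₗ Q → ∀ {x y} → x ∈ X → y ∈ X → Eq (map bits Ss) x y
    sorted   : AllPairs (λ X Y → ∀ {x y} → x ∈ X → y ∈ Y → Gt (map bits Ss) x y) Q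
    nonempty : ∀ {X} → X ∈ₗ Q → Nonempty X

─⇒∉ : ∀ {n} (p q : Subset n) {x} → x ∈ p ─ q → x ∉ q
─⇒∉ (_ Vec.∷ p) (_ Vec.∷ q) (Vec.there x∈) (Vec.there x∈q) = ─⇒∉ p q x∈ x∈q

module _ {n : ℕ} (S X : Subset n) where

  split-part : ∀ {Y} → Y ∈ₗ split S X → Nonempty X →
    Nonempty Y × (∀ {y} → y ∈ Y → y ∈ X) × (∀ {x y} → x ∈ Y → y ∈ Y → bits S x ≡ bits S y)
  split-part Y∈ ne with nonempty? (X ∩ S) | nonempty? (X ─ S)
  split-part (here refl)         ne | yes p | yes q = p , proj₁ ∘ Subset.x∈p∩q⁻ X S ,
    λ x∈ y∈ → trans (bits⁺ (proj₂ (Subset.x∈p∩q⁻ X S x∈))) (sym (bits⁺ (proj₂ (Subset.x∈p∩q⁻ X S y∈))))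
  split-part (there (here refl)) ne | yes p | yes q = q , Subset.p─q⊆p X S ,
    λ x∈ y∈ → trans (bits⁺′ (─⇒∉ X S x∈)) (sym (bits⁺′ (─⇒∉ X S y∈)))
  split-part (here refl) ne | yes p | no ¬q = ne , id , λ x∈ y∈ → trans (all x∈) (sym (all y∈))
    where
    all : ∀ {x} → x ∈ X → bits S x ≡ true
    all {x} x∈ with x ∈? S
    ... | yes x∈S = refl
    ... | no x∉S  = ⊥-elim (¬q (x , Subset.x∈p∧x∉q⇒x∈p─q x∈ x∉S))
  split-part (here refl) ne | no ¬p | _ = ne , id , λ x∈ y∈ → trans (none x∈) (sym (none y∈))
    where
    none : ∀ {x} → x ∈ X → bits S x ≡ false
    none {x} x∈ = bits⁺′ λ x∈S → ¬p (x , Subset.x∈p∩q⁺ (x∈ , x∈S))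

  split-cover : ∀ {x} → x ∈ X → ∃ λ Y → Y ∈ₗ split S X × x ∈ Y
  split-cover {x} x∈ with nonempty? (X ∩ S) | nonempty? (X ─ S)
  ... | no _  | _    = X , here refl , x∈
  ... | yes _ | no _ = X , here refl , x∈
  ... | yes _ | yes _ with x ∈? S
  ...   | yes x∈S = X ∩ S , here refl , Subset.x∈p∩q⁺ (x∈ , x∈S)
  ...   | no x∉S  = X ─ S , there (here refl) , Subset.x∈p∧x∉q⇒x∈p─q x∈ x∉S

  split-sorted : AllPairs (λ Y Z → ∀ {x y} → x ∈ Y → y ∈ Z → bits S x ≡ true × bits S y ≡ false) (split S X)
  split-sorted with nonempty? (X ∩ S) | nonempty? (X ─ S)
  ... | no _  | _     = [] ∷ []
  ... | yes _ | no _  = [] ∷ []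
  ... | yes _ | yes _ =
    ((λ x∈ y∈ → bits⁺ (proj₂ (Subset.x∈p∩q⁻ X S x∈)) , bits⁺′ (─⇒∉ X S y∈)) ∷ []) ∷ [] ∷ []

∈-refine⁻ : ∀ {n} {S : Subset n} Q {Y} → Y ∈ₗ refine Q S → ∃ λ X → X ∈ₗ Q × Y ∈ₗ split S X
∈-refine⁻ {S = S} Q Y∈ with Any.satisfied {P = λ X → X ∈ₗ Q × _} (go Q (∈ₗ.∈-concatMap⁻ (split S) Y∈))
  where
  go : ∀ Q {P : _ → Set} → Any P Q → Any (λ X → X ∈ₗ Q × P X) Q
  go (_ ∷ _) (here p)  = here (here refl , p)
  go (_ ∷ Q) (there p) = there (Any.map (λ (m , q) → there m , q) (go Q p))
... | X , X∈ , Y∈split = X , X∈ , Y∈split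

-- Between different old classes nothing changes, and the new set decides only inside one of them;
-- hence it enters at the least significant end.
Classes-refine : ∀ {n} {Ss Q} {S : Subset n} → Classes Ss Q → Classes (S ∷ Ss) (refine Q S)
Classes-refine {Ss = Ss} {Q} {S} C = record
  { cover    = λ x → case C.cover x of λ (X , X∈ , x∈) → case split-cover S X x∈ of λ (Y , Y∈ , x∈Y) →
      Y , ∈ₗ.∈-concatMap⁺ (split S) (Any.map (λ { refl → Y∈ }) X∈) , x∈Y
  ; same     = λ Y∈ x∈ y∈ → case ∈-refine⁻ Q Y∈ of λ (X , X∈ , Y∈X) →
      case split-part S X Y∈X (C.nonempty X∈) of λ (_ , sub , eq) → C.same X∈ (sub x∈) (sub y∈) , eq x∈ y∈
  ; sorted   = AllPairs.concat⁺ (All.map⁺ (All.tabulate λ {X} X∈ →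
        AllPairs-map∈ (λ Y∈ Z∈ r x∈ y∈ → inj₂
           ( C.same X∈ (proj₁ (proj₂ (split-part S X Y∈ (C.nonempty X∈))) x∈)
                       (proj₁ (proj₂ (split-part S X Z∈ (C.nonempty X∈))) y∈)
           , r x∈ y∈)) (split-sorted S X)))
      (AllPairs.map⁺ (AllPairs-map∈ (λ {X} {Y} X∈ Y∈ r →
        All.tabulate λ Y′∈ → All.tabulate λ Z′∈ x∈ y∈ → inj₁ (r
          (proj₁ (proj₂ (split-part S X Y′∈ (C.nonempty X∈))) x∈)
          (proj₁ (proj₂ (split-part S Y Z′∈ (C.nonempty Y∈))) y∈))) C.sorted))
  ; nonempty = λ Y∈ → case ∈-refine⁻ Q Y∈ of λ (X , X∈ , Y∈X) → proj₁ (split-part S X Y∈X (C.nonempty X∈))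
  }
  where module C = Classes C

Classes-foldl : ∀ {n} {Ss Q} (Rs : List (Subset n)) → Classes Ss Q →
  Classes (foldl (flip _∷_) Ss Rs) (foldl refine Q Rs)
Classes-foldl []       C = C
Classes-foldl (R ∷ Rs) C = Classes-foldl Rs (Classes-refine C)

family : ∀ {n} → Graph n → Order n → Fin n → Fin n → Bool
family G β v = bits (earlierNeighbours G β v)

family⁺ : ∀ {n} (G : Graph n) (β : Order n) {v x} → x ∈ N G v → x ≺[ β ] v → family G β v x ≡ true
family⁺ G β {v} {x} x∈ x≺ = bits⁺ (Vec.lookup⇒[]= x _ (trans (Vec.lookup∘tabulate _ x)
  (cong₂ _∧_ (dec-true (x ∈? N G v) x∈) (dec-true (pos β x Fin.<? pos β v) x≺))))

family⁻ : ∀ {n} (G : Graph n) (β : Order n) {v x} → family G β v x ≡ true → x ∈ N G v × x ≺[ β ] v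
family⁻ G β {v} {x} e = does-∧⇒ (x ∈? N G v) (pos β x Fin.<? pos β v)
  (trans (sym (Vec.lookup∘tabulate (λ w → does (w ∈? N G v) ∧ does (pos β w Fin.<? pos β v)) x))
         (Vec.[]=⇒lookup (bits⁻ {S = earlierNeighbours G β v} {x} e)))

-- Reversed because the first refinement is the most significant one, while `Gt` expects the least
-- significant set first.
ranking : ∀ {n} → Graph n → Order n → List (Fin n → Bool)
ranking G β = map (family G β) (reverse (toList β))

-- The hypothesis puts `s` alone into the final class. Moving this class to the left thus rotates
-- the list of classes by one place.
module Arrangement {n : ℕ} (G : Graph n) (s : Fin n) (ρ β : Order n)
  (last : ∀ x → x ≢ s → Gt (ranking G β) x s) where

  Rs : List (Subset n)
  Rs = map (earlierNeighbours G β) (toList β)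

  classes-ranked : Classes (reverse Rs) (classes G β)
  classes-ranked = Classes-foldl Rs record
    { cover = λ x → ⊤ , here refl , Subset.∈⊤ ; same = λ _ _ _ → tt ; sorted = [] ∷ []
    ; nonempty = λ { (here refl) → s , Subset.∈⊤ } }

  ranking-bits : map bits (reverse Rs) ≡ ranking G β
  ranking-bits = trans (cong (map bits) (sym (List.reverse-map (earlierNeighbours G β) (toList β))))
                       (sym (List.map-∘ (reverse (toList β))))

  open Classes classes-ranked

  record Arranged : Set where
    field
      rest   : List (Fin n)
      shape  : arrangement G s ρ β ≡ s ∷ rest
      sorted : AllPairs (Ahead ρ (ranking G β)) rest
      ∈-rest : ∀ {v} → v ≢ s → v ∈ₗ rest
      s∉rest : s ∉ₗ rest

  sortClass-sorted : ∀ X → AllPairs (λ u v → v ≺[ ρ ] u) (sortClass ρ X)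
  sortClass-sorted X = AllPairs.filter⁺ (_∈? X) (AllPairs-toList⁺ (ρ ⁻) (⁻-≺ ρ))

  ∈-sortClass⁺ : ∀ {X v} → v ∈ X → v ∈ₗ sortClass ρ X
  ∈-sortClass⁺ {X} {v} = ∈ₗ.∈-filter⁺ (_∈? X) (∈-toList (ρ ⁻) v)

  ∈-sortClass⁻ : ∀ {X v} → v ∈ₗ sortClass ρ X → v ∈ X
  ∈-sortClass⁻ {X} v∈ = proj₂ (∈ₗ.∈-filter⁻ (_∈? X) {xs = toList (ρ ⁻)} v∈)

  eq : ∀ {X} → X ∈ₗ classes G β → ∀ {x y} → x ∈ X → y ∈ X → Eq (ranking G β) x y
  eq X∈ {x} {y} x∈ y∈ = subst (λ 𝒮 → Eq 𝒮 x y) ranking-bits (same X∈ x∈ y∈)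

  gt-sorted : AllPairs (λ X Y → ∀ {x y} → x ∈ X → y ∈ Y → Gt (ranking G β) x y) (classes G β)
  gt-sorted = subst (λ 𝒮 → AllPairs (λ X Y → ∀ {x y} → x ∈ X → y ∈ Y → Gt 𝒮 x y) (classes G β)) ranking-bits sorted

  only-s : ∀ {X} → X ∈ₗ classes G β → s ∈ X → X ≡ ⁅ s ⁆
  only-s {X} X∈ s∈ = Subset.⊆-antisym
    (λ {x} x∈ → case x Fin.≟ s of λ
      { (yes refl) → Subset.x∈⁅x⁆ s
      ; (no x≢s) → ⊥-elim (Eq⇒¬Gt (ranking G β) (eq X∈ x∈ s∈) (last x x≢s)) })
    (λ x∈ → case Subset.x∈⁅y⁆⇒x≡y s x∈ of λ { refl → s∈ })

  arranged : Arranged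
  arranged with cover s
  ... | X , X∈ , s∈ with ∈ₗ.∈-∃++ X∈
  ...   | Q₁ , Q₂ , e with AllPairs-++⁻ Q₁ (subst (AllPairs _) e gt-sorted)
  ...     | sorted₁ , X<Q₂ ∷ _ , Q₁<X with only-s X∈ s∈
  ...       | refl with Q₂
  -- A class behind that of `s` would have a member that ranks below `s`.
  ...         | Y ∷ _ = ⊥-elim (Gt-asym (ranking G β) s>y (last y λ y≡s → Gt-irrefl (ranking G β) (subst (Gt (ranking G β) s) y≡s s>y)))
    where
    ne = nonempty (subst (Y ∈ₗ_) (sym e) (∈ₗ.∈-++⁺ʳ Q₁ (there (here refl))))
    y = proj₁ ne
    s>y = All.head X<Q₂ s∈ (proj₂ ne)
  ...         | [] = record
    { rest   = concatMap (sortClass ρ) Q₁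
    ; shape  = shape
    ; sorted = AllPairs.concat⁺
        (All.map⁺ (All.tabulate λ {Y} Y∈ → AllPairs-map∈
          (λ x∈ y∈ lt → inj₂ (eq (∈classes Y∈) (∈-sortClass⁻ x∈) (∈-sortClass⁻ y∈) , lt)) (sortClass-sorted Y)))
        (AllPairs.map⁺ (AllPairs.map
          (λ r → All.tabulate λ x∈ → All.tabulate λ y∈ → inj₁ (r (∈-sortClass⁻ x∈) (∈-sortClass⁻ y∈))) sorted₁))
    ; ∈-rest = λ {v} v≢s → case cover v of λ (Y , Y∈ , v∈) →
        case ∈ₗ.∈-++⁻ Q₁ (subst (Y ∈ₗ_) e Y∈) of λ
          { (inj₁ Y∈Q₁) → ∈ₗ.∈-concatMap⁺ (sortClass ρ) (Any.map (λ { refl → ∈-sortClass⁺ v∈ }) Y∈Q₁)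
          ; (inj₂ (here refl)) → ⊥-elim (v≢s (Subset.x∈⁅y⁆⇒x≡y s v∈)) }
    ; s∉rest = λ s∈rest → Any¬ (∈ₗ.∈-concatMap⁻ (sortClass ρ) s∈rest)
    }
    where
    ∈classes : ∀ {Y} → Y ∈ₗ Q₁ → Y ∈ₗ classes G β
    ∈classes Y∈ = subst (_ ∈ₗ_) (sym e) (∈ₗ.∈-++⁺ˡ Y∈)
    s∉Q₁ : ∀ {Y} → Y ∈ₗ Q₁ → s ∉ Y
    s∉Q₁ Y∈ s∈Y = Gt-irrefl (ranking G β) (Q₁<X Y∈ (here refl) s∈Y s∈)
    Any¬ : ¬ Any (λ Y → s ∈ₗ sortClass ρ Y) Q₁
    Any¬ a = All.lookupWith (λ {Y} s∉ s∈Y → s∉ (∈-sortClass⁻ s∈Y)) (All.tabulate s∉Q₁) a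
    Q₁≢ : All (λ Y → ¬ Y ≡ ⁅ s ⁆) Q₁
    Q₁≢ = All.tabulate λ { Y∈ refl → s∉Q₁ Y∈ s∈ }
    sort-s : sortClass ρ ⁅ s ⁆ ≡ s ∷ []
    sort-s = sorted-unique {R = λ u v → v ≺[ ρ ] u} ℕ.<-asym (sortClass-sorted ⁅ s ⁆) ([] ∷ [])
      (λ v∈ → here (Subset.x∈⁅y⁆⇒x≡y s (∈-sortClass⁻ v∈))) (λ { (here refl) → ∈-sortClass⁺ (Subset.x∈⁅x⁆ s) })
    shape : arrangement G s ρ β ≡ s ∷ concatMap (sortClass ρ) Q₁
    shape = begin
      concatMap (sortClass ρ) (moveLeft ⁅ s ⁆ (classes G β))
        ≡⟨ cong (concatMap (sortClass ρ) ∘ moveLeft ⁅ s ⁆) e ⟩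
      concatMap (sortClass ρ) (moveLeft ⁅ s ⁆ (Q₁ ++ ⁅ s ⁆ ∷ []))
        ≡⟨ cong₂ (λ x y → concatMap (sortClass ρ) (x ++ y))
             (trans (List.filter-++ (_≟ˢ ⁅ s ⁆) Q₁ (⁅ s ⁆ ∷ []))
               (cong₂ _++_ (List.filter-none (_≟ˢ ⁅ s ⁆) Q₁≢) (List.filter-all (_≟ˢ ⁅ s ⁆) (refl ∷ []))))
             (trans (List.filter-++ (λ Y → ¬? (Y ≟ˢ ⁅ s ⁆)) Q₁ (⁅ s ⁆ ∷ []))
               (cong₂ _++_ (List.filter-all (λ Y → ¬? (Y ≟ˢ ⁅ s ⁆)) Q₁≢)
                           (List.filter-none (λ Y → ¬? (Y ≟ˢ ⁅ s ⁆)) ((λ ne → ne refl) ∷ [])))) ⟩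
      concatMap (sortClass ρ) (⁅ s ⁆ ∷ Q₁ ++ [])
        ≡⟨ cong₂ (λ x y → x ++ concatMap (sortClass ρ) y) sort-s (List.++-identityʳ Q₁) ⟩
      s ∷ concatMap (sortClass ρ) Q₁ ∎
      where open ≡-Reasoning

-- Labels of LexBFS and LexDFS.

infix 4 _<ₗₑₓ_
_<ₗₑₓ_ : List ℕ → List ℕ → Set
_<ₗₑₓ_ = Lex ⊥ _≡_ _<_

<ₗₑₓ⇒≤ₗₑₓ : ∀ {l m} → l <ₗₑₓ m → l ≤ₗₑₓ m
<ₗₑₓ⇒≤ₗₑₓ halt       = halt
<ₗₑₓ⇒≤ₗₑₓ (this lt)  = this lt
<ₗₑₓ⇒≤ₗₑₓ (next e l) = next e (<ₗₑₓ⇒≤ₗₑₓ l)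

<ₗₑₓ⇒≱ₗₑₓ : ∀ {l m} → l <ₗₑₓ m → ¬ m ≤ₗₑₓ l
<ₗₑₓ⇒≱ₗₑₓ (this lt)     (this gt)     = ℕ.<-asym lt gt
<ₗₑₓ⇒≱ₗₑₓ (this lt)     (next e _)    = ℕ.<-irrefl (sym e) lt
<ₗₑₓ⇒≱ₗₑₓ (next e _)    (this gt)     = ℕ.<-irrefl (sym e) gt
<ₗₑₓ⇒≱ₗₑₓ (next _ lt)   (next _ ge)   = <ₗₑₓ⇒≱ₗₑₓ lt ge

≤ₗₑₓ-refl : ∀ {l} → l ≤ₗₑₓ l
≤ₗₑₓ-refl {[]}    = base _
≤ₗₑₓ-refl {_ ∷ _} = next refl ≤ₗₑₓ-refl

-- l stays below m when further entries are appended to either list, provided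
-- that they are smaller than all entries of m.
infix 4 _≪_
_≪_ : List ℕ → List ℕ → Set
l ≪ m = ∃ λ p → ∃ λ a → ∃ λ m′ → ∃ λ l′ → m ≡ p ++ a ∷ m′ × l ≡ p ++ l′ × All (_< a) l′

≪⇒<ₗₑₓ : ∀ {l m} → l ≪ m → l <ₗₑₓ m
≪⇒<ₗₑₓ ([]    , a , m′ , []     , refl , refl , _)      = halt
≪⇒<ₗₑₓ ([]    , a , m′ , c ∷ l′ , refl , refl , lt ∷ _) = this lt
≪⇒<ₗₑₓ (x ∷ p , a , m′ , l′     , refl , refl , lt)     = next refl (≪⇒<ₗₑₓ (p , a , m′ , l′ , refl , refl , lt))

All-take-tabulate : ∀ {A : Set} {P : A → Set} {m} {f : Fin m → A} k →
  (∀ j → toℕ j < k → P (f j)) → All P (take k (tabulate f))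
All-take-tabulate             zero    _ = []
All-take-tabulate {m = zero}  (suc k) _ = []
All-take-tabulate {m = suc m} (suc k) p = p zero (s≤s z≤n) ∷ All-take-tabulate k λ j lt → p (suc j) (s≤s lt)

∈-take-tabulate : ∀ {A : Set} {m} {f : Fin m → A} {k} j → toℕ j < k → f j ∈ₗ take k (tabulate f)
∈-take-tabulate zero    (s≤s _)  = here refl
∈-take-tabulate (suc j) (s≤s lt) = there (∈-take-tabulate j lt)

recent : ∀ n → ℕ → List (Fin n)
recent n i = reverse (take i (allFin n))

∈-recent⁻ : ∀ {n i} {j : Fin n} → j ∈ₗ recent n i → toℕ j < i
∈-recent⁻ {i = i} j∈ = All.lookup (All-take-tabulate i λ _ lt → lt) (Any.reverse⁻ j∈)

∈-recent⁺ : ∀ {n i} {j : Fin n} → toℕ j < i → j ∈ₗ recent n i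
∈-recent⁺ {j = j} lt = Any.reverse⁺ (∈-take-tabulate j lt)

recent-sorted : ∀ n i → AllPairs (λ p q → q Fin.< p) (recent n i)
recent-sorted n i = AllPairs-reverse (AllPairs.take⁺ i (AllPairs.tabulate⁺-< id))

nb : ∀ {n} → Graph n → Fin n → Fin n → Bool
nb G v = bits (N G v)

∈-bits : ∀ {n} {S : Subset n} {x y} → bits S x ≡ bits S y → x ∈ S → y ∈ S
∈-bits {S = S} {x} {y} e x∈ = bits⁻ {S = S} {y} (trans (sym e) (bits⁺ x∈))

Upd : Set
Upd = ℕ → List ℕ → List ℕ

module Label {n : ℕ} (G : Graph n) (σ : Order n) where

  nbAt : Fin n → Fin n → Bool
  nbAt j = nb G (at σ j)

  label : Upd → List ℕ → Fin n → List (Fin n) → List ℕ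
  label upd e w = List.foldr (λ j l → if nbAt j w then upd (suc (toℕ j)) l else l) e

  foldl-at : ∀ {upd : Upd} {w} {f : Labels n → Fin n → Labels n} →
    (∀ {j} → j Fin.< pos σ w → ∀ lab → f lab j w ≡ (if nbAt j w then upd (suc (toℕ j)) (lab w) else lab w)) →
    ∀ {js} → All (Fin._< pos σ w) js → ∀ lab →
    foldl f lab js w ≡ foldl (λ l j → if nbAt j w then upd (suc (toℕ j)) l else l) (lab w) js
  foldl-at eq []         lab = refl
  foldl-at {upd} {f = f} eq {j ∷ js} (lt ∷ lts) lab =
    trans (foldl-at {upd} eq lts (f lab j)) (cong (λ l → foldl _ l js) (eq lt lab))

  -- For an unvisited `w` the test in the numbering step always passes, and its label evolves
  -- independently of all others. The most recent update is outermost, hence `recent`.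
  labels-label : ∀ upd init i w → Unvisited σ i w →
    labels G upd init σ i w ≡ label upd (init w) w (recent n (toℕ i))
  labels-label upd init i w i≤w = trans
    (foldl-at {upd} (λ {j} lt lab → cong (λ b → if b ∧ nbAt j w then upd (suc (toℕ j)) (lab w) else lab w)
                                (dec-true (j Fin.<? pos σ w) lt))
      (All-take-tabulate (toℕ i) (λ j lt → ℕ.<-≤-trans lt i≤w)) init)
    (sym (List.reverse-foldr _ (init w) (take (toℕ i) (allFin n))))

  label-≡ : ∀ upd e x y js → (∀ {j} → j ∈ₗ js → nbAt j x ≡ nbAt j y) → label upd e x js ≡ label upd e y js
  label-≡ upd e x y []       _ = refl
  label-≡ upd e x y (j ∷ js) f = cong₂ (λ b l → if b then upd (suc (toℕ j)) l else l)
    (f (here refl)) (label-≡ upd e x y js (f ∘ there))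

  bfsUpd dfsUpd : Upd
  bfsUpd k l = l ++ (n ∸ k) ∷ []
  dfsUpd k l = k ∷ l

  label-entry : ∀ {w} js → All (λ c → ∃ λ j → j ∈ₗ js × c ≡ n ∸ suc (toℕ j)) (label bfsUpd [] w js)
  label-entry     []       = []
  label-entry {w} (j ∷ js) with nbAt j w | All.map (λ (i , i∈ , e) → i , there {x = j} i∈ , e) (label-entry {w} js)
  ... | false | es = es
  ... | true  | es = All.++⁺ es ((j , here refl , refl) ∷ [])

  -- LexBFS appends smaller and smaller numbers. The oldest vertex that separates `x` from `y`
  -- extends only the label of `x`, and whatever `y` receives afterwards is too small to make up for
  -- it.
  label-≪ : ∀ x y js → AllPairs (λ p q → q Fin.< p) js → Gt (map nbAt js) x y →
    label bfsUpd [] y js ≪ label bfsUpd [] x js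
  label-≪ x y (j ∷ js) (_ ∷ _) (inj₂ (p , fx , fy))
    rewrite fx | fy = label bfsUpd [] x js , _ , [] , [] , refl ,
      trans (sym (label-≡ bfsUpd [] x y js (Eq-∈ p))) (sym (List.++-identityʳ _)) , []
  label-≪ x y (j ∷ js) (j> ∷ ps) (inj₁ g) with label-≪ x y js ps g | label-entry {x} js
  ... | p , a , m′ , l′ , ex , ey , lt | es
    with All.lookup es (subst (a ∈ₗ_) (sym ex) (∈ₗ.∈-++⁺ʳ p (here refl)))
  ...   | i , i∈ , refl = p , a , mx , ly , xeq , yeq , lts
    where
    b<a : n ∸ suc (toℕ j) < a
    b<a = ℕ.∸-monoʳ-< (s≤s (All.lookup j> i∈)) (Fin.toℕ<n j)
    mx = if nbAt j x then m′ ++ (n ∸ suc (toℕ j)) ∷ [] else m′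
    ly = if nbAt j y then l′ ++ (n ∸ suc (toℕ j)) ∷ [] else l′
    xeq : label bfsUpd [] x (j ∷ js) ≡ p ++ a ∷ mx
    xeq with nbAt j x
    ... | false = ex
    ... | true  = trans (cong (_++ _) ex) (List.++-assoc p (a ∷ m′) _)
    yeq : label bfsUpd [] y (j ∷ js) ≡ p ++ ly
    yeq with nbAt j y
    ... | false = ey
    ... | true  = trans (cong (_++ _) ey) (List.++-assoc p l′ _)
    lts : All (_< a) ly
    lts with nbAt j y
    ... | false = lt
    ... | true  = All.++⁺ lt (b<a ∷ [])

  dfs-bound : ∀ {w} (i : Fin n) js → All (Fin._< i) js → All (_< suc (toℕ i)) (label dfsUpd [] w js)
  dfs-bound     i []       []         = []
  dfs-bound {w} i (j ∷ js) (lt ∷ lts) with nbAt j w | dfs-bound {w} i js lts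
  ... | false | r = r
  ... | true  | r = s≤s lt ∷ r

  -- LexDFS prepends larger and larger numbers. Above the most recent separating vertex `j` both
  -- labels get the same entries; below it `y` has only entries smaller than that of `j`.
  label-< : ∀ x y js → AllPairs (λ p q → q Fin.< p) js → ∀ {j} → j ∈ₗ js → nbAt j x ≡ true → nbAt j y ≡ false →
    (∀ {k} → k ∈ₗ js → j Fin.< k → nbAt k x ≡ nbAt k y) → label dfsUpd [] y js <ₗₑₓ label dfsUpd [] x js
  label-< x y (j ∷ js) (j> ∷ ps) (here refl) fx fy _ rewrite fx | fy
    with label dfsUpd [] y js | dfs-bound {y} j js j>
  ... | []    | _      = halt
  ... | _ ∷ _ | lt ∷ _ = this lt
  label-< x y (k ∷ js) (k> ∷ ps) (there j∈) fx fy agree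
    with nbAt k x | nbAt k y | agree (here refl) (All.lookup k> j∈) | label-< x y js ps j∈ fx fy (agree ∘ there)
  ... | true  | _ | refl | r = next refl r
  ... | false | _ | refl | r = r

module _ {n : ℕ} {ρ σ : Order n} (lab : Order n → Fin n → Labels n) where

  isLexSearch⁺-intro : (∀ i w → Unvisited σ i w → w ≢ at σ i →
    (lab σ i w <ₗₑₓ lab σ i (at σ i)) ⊎ (lab σ i w ≡ lab σ i (at σ i) × w ≼[ ρ ] at σ i)) →
    IsLexSearch⁺ lab ρ σ
  isLexSearch⁺-intro h i = (ℕ.≤-reflexive (cong toℕ (sym (pos-at σ i))) , largest) , rightmost
    where
    largest : ∀ w → Unvisited σ i w → lab σ i w ≤ₗₑₓ lab σ i (at σ i)
    largest w i≤w with w Fin.≟ at σ i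
    ... | yes refl = ≤ₗₑₓ-refl
    ... | no w≢ with h i w i≤w w≢
    ...   | inj₁ lt      = <ₗₑₓ⇒≤ₗₑₓ lt
    ...   | inj₂ (e , _) = subst (_≤ₗₑₓ lab σ i (at σ i)) (sym e) ≤ₗₑₓ-refl
    rightmost : ∀ w → Largest (lab σ) σ i w → w ≼[ ρ ] at σ i
    rightmost w (i≤w , max) with w Fin.≟ at σ i
    ... | yes refl = ℕ.≤-refl
    ... | no w≢ with h i w i≤w w≢
    ...   | inj₁ lt       = ⊥-elim (<ₗₑₓ⇒≱ₗₑₓ lt (max _ (ℕ.≤-reflexive (cong toℕ (sym (pos-at σ i))))))
    ...   | inj₂ (_ , le) = le

Ends-≼ : ∀ {n} (ρ : Order n) {s} → Ends ρ s → ∀ w → w ≼[ ρ ] s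
Ends-≼ ρ end w = ℕ.s≤s⁻¹ (subst (toℕ (pos ρ w) <_) (sym end) (Fin.toℕ<n (pos ρ w)))

initial-≢ : ∀ {n} {s w : Fin n} l → w ≢ s → initial s l w ≡ []
initial-≢ {s = s} {w} l w≢s = cong (λ b → if b then l else []) (dec-false (w Fin.≟ s) w≢s)

initial-≡ : ∀ {n} (s : Fin n) l → initial s l s ≡ l
initial-≡ s l = cong (λ b → if b then l else []) (dec-true (s Fin.≟ s) refl)

module LexLabels {n : ℕ} (G : Graph n) {s : Fin n} {ρ σ : Order n} (start : Starts σ s) (end : Ends ρ s) where
  open Label G σ

  at-0 : ∀ i → toℕ i ≡ 0 → at σ i ≡ s
  at-0 i e = trans (cong (at σ) (Fin.toℕ-injective (trans e (sym start)))) (at-pos σ s)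

  unvisited-≢s : ∀ {i w} → 0 < toℕ i → Unvisited σ i w → w ≢ s
  unvisited-≢s 0<i i≤w refl = ℕ.<-irrefl (sym start) (ℕ.<-≤-trans 0<i i≤w)

  at-unvisited : ∀ i → Unvisited σ i (at σ i)
  at-unvisited i = ℕ.≤-reflexive (cong toℕ (sym (pos-at σ i)))

  labels-later : ∀ upd l i w → 0 < toℕ i → Unvisited σ i w →
    labels G upd (initial s l) σ i w ≡ label upd [] w (recent n (toℕ i))
  labels-later upd l i w 0<i i≤w = trans (labels-label upd (initial s l) i w i≤w)
    (cong (λ e → label upd e w (recent n (toℕ i))) (initial-≢ l (unvisited-≢s 0<i i≤w)))

  labels-0 : ∀ upd l i w → toℕ i ≡ 0 → labels G upd (initial s l) σ i w ≡ initial s l w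
  labels-0 upd l zero w _ = refl

  search-intro : ∀ upd c → (∀ i w → 0 < toℕ i → Unvisited σ i w → w ≢ at σ i →
      (label upd [] w (recent n (toℕ i)) <ₗₑₓ label upd [] (at σ i) (recent n (toℕ i))) ⊎
      (label upd [] w (recent n (toℕ i)) ≡ label upd [] (at σ i) (recent n (toℕ i)) × w ≼[ ρ ] at σ i)) →
    IsLexSearch⁺ (labels G upd (initial s (c ∷ []))) ρ σ
  search-intro upd c h = isLexSearch⁺-intro {ρ = ρ} {σ} (labels G upd (initial s (c ∷ []))) step
    where
    step : ∀ i w → Unvisited σ i w → w ≢ at σ i → _
    step i w i≤w w≢ with ℕ.m≤n⇒m<n∨m≡n {0} {toℕ i} z≤n
    ... | inj₁ 0<i = Sum.map
      (subst₂ _<ₗₑₓ_ (sym (labels-later upd _ i w 0<i i≤w)) (sym (labels-later upd _ i _ 0<i (at-unvisited i))))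
      (λ (e , le) → trans (labels-later upd _ i w 0<i i≤w)
        (trans e (sym (labels-later upd _ i _ 0<i (at-unvisited i)))) , le)
      (h i w 0<i i≤w w≢)
    ... | inj₂ 0≡i = inj₁ (subst₂ _<ₗₑₓ_
      (sym (trans (labels-0 upd _ i w (sym 0≡i)) (initial-≢ _ (w≢ ∘ λ e → trans e (sym (at-0 i (sym 0≡i)))))))
      (sym (trans (labels-0 upd _ i _ (sym 0≡i)) (trans (cong (initial s _) (at-0 i (sym 0≡i))) (initial-≡ s _))))
      halt)

  history : Fin n → List (Fin n → Bool)
  history i = map nbAt (recent n (toℕ i))

  isLexBFS⁺-intro : (∀ i w → 0 < toℕ i → Unvisited σ i w → w ≢ at σ i → Ahead ρ (history i) (at σ i) w) →
    IsLexBFS⁺ G s ρ σ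
  isLexBFS⁺-intro h = search-intro bfsUpd n λ i w 0<i i≤w w≢ → Sum.map
    (λ g → ≪⇒<ₗₑₓ (label-≪ (at σ i) w (recent n (toℕ i)) (recent-sorted n (toℕ i)) g))
    (λ (p , lt) → sym (label-≡ bfsUpd [] (at σ i) w (recent n (toℕ i)) (Eq-∈ p)) , ℕ.<⇒≤ lt)
    (h i w 0<i i≤w w≢)

  isLexBFS⁺-elim : IsLexBFS⁺ G s ρ σ → ∀ i w → Unvisited σ i w →
    ¬ Gt (history i) w (at σ i) × (Eq (history i) (at σ i) w → w ≼[ ρ ] at σ i)
  isLexBFS⁺-elim lex i w i≤w with ℕ.m≤n⇒m<n∨m≡n {0} {toℕ i} z≤n
  -- At position 0 no neighbourhood compares anything; the initial label singles out `s`, and this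
  -- agrees with the tie rule because `s` ends `ρ`.
  isLexBFS⁺-elim lex zero w i≤w | inj₂ _ = (λ ()) , λ _ → subst (λ v → w ≼[ ρ ] v) (sym (at-0 zero refl)) (Ends-≼ ρ end w)
  isLexBFS⁺-elim lex i w i≤w | inj₁ 0<i =
    (λ g → <ₗₑₓ⇒≱ₗₑₓ (≪⇒<ₗₑₓ (label-≪ w (at σ i) (recent n (toℕ i)) (recent-sorted n (toℕ i)) g))
       (subst₂ _≤ₗₑₓ_ ew ea (proj₂ (proj₁ (lex i)) w i≤w))) ,
    λ p → proj₂ (lex i) w (i≤w , λ v i≤v → subst (_ ≤ₗₑₓ_)
      (trans ea (trans (label-≡ bfsUpd [] (at σ i) w (recent n (toℕ i)) (Eq-∈ p)) (sym ew))) (proj₂ (proj₁ (lex i)) v i≤v))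
    where
    ew = labels-later bfsUpd (n ∷ []) i w 0<i i≤w
    ea = labels-later bfsUpd (n ∷ []) i (at σ i) 0<i (at-unvisited i)

  -- The reverse of `history`: here the most recently visited vertex is the most significant.
  past : Fin n → List (Fin n → Bool)
  past i = map nbAt (take (toℕ i) (allFin n))

  past-sorted : ∀ (i : Fin n) → AllPairs Fin._<_ (take (toℕ i) (allFin n))
  past-sorted i = AllPairs.take⁺ (toℕ i) (AllPairs.tabulate⁺-< id)

  past-Eq⁻ : ∀ {i x y} → Eq (past i) x y → ∀ {a} → Visited σ i a → x ∈ N G a → y ∈ N G a
  past-Eq⁻ {i} {x} {y} p {a} a<i x∈ = ∈-bits (trans (cong (λ v → nb G v x) (sym (at-pos σ a)))
    (trans (Eq-∈ p (∈-take-tabulate (pos σ a) a<i)) (cong (λ v → nb G v y) (at-pos σ a)))) x∈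

  past-Gt⁻ : ∀ {i x y} → Gt (past i) x y → ∃ λ a → Visited σ i a × x ∈ N G a × y ∉ N G a ×
    (∀ {b} → Visited σ i b → a ≺[ σ ] b → (x ∈ N G b → y ∈ N G b) × (y ∈ N G b → x ∈ N G b))
  past-Gt⁻ {i} {x} {y} g with Gt-witness {F = nbAt} {Fin._>_} (λ p q → ℕ.<-asym p q) (past-sorted i) g
  ... | j , j∈ , fx , fy , agree = at σ j ,
    subst (Fin._< i) (sym (pos-at σ j)) (All.lookup (All-take-tabulate (toℕ i) λ _ lt → lt) j∈) ,
    bits⁻ fx , bits⁻′ fy , λ {b} b<i j<b →
      let e = trans (cong (λ v → nb G v x) (sym (at-pos σ b)))
               (trans (agree (∈-take-tabulate (pos σ b) b<i) (subst (Fin._< pos σ b) (pos-at σ j) j<b))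
               (cong (λ v → nb G v y) (at-pos σ b)))
      in ∈-bits e , ∈-bits (sym e)

  isLexDFS⁺-intro : (∀ i w → 0 < toℕ i → Unvisited σ i w → w ≢ at σ i →
      Gt (past i) (at σ i) w ⊎ (Eq (past i) (at σ i) w × w ≼[ ρ ] at σ i)) →
    IsLexDFS⁺ G s ρ σ
  isLexDFS⁺-intro h = search-intro dfsUpd 0 λ i w 0<i i≤w w≢ → Sum.map
    (λ g → case Gt-witness {F = nbAt} {Fin._>_} (λ p q → ℕ.<-asym p q) (past-sorted i) g of λ
       (j , j∈ , fx , fy , agree) → label-< (at σ i) w (recent n (toℕ i)) (recent-sorted n (toℕ i))
         (Any.reverse⁺ j∈) fx fy (λ k∈ j<k → agree (Any.reverse⁻ k∈) j<k))
    (λ (p , le) → sym (label-≡ dfsUpd [] (at σ i) w (recent n (toℕ i)) (λ k∈ → Eq-∈ p (Any.reverse⁻ k∈))) , le)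
    (h i w 0<i i≤w w≢)

  -- If `y` has all visited neighbours of `x`, the label of `x` cannot be the larger one; if `x` is
  -- chosen, that of `y` cannot be either. So the labels agree, and `ρ` decides.
  isLexBFS⁺⇒MNS⁺ : IsLexBFS⁺ G s ρ σ → MNS⁺ G ρ σ
  isLexBFS⁺⇒MNS⁺ lex = record
    { maximal = λ {x} {y} x≼y sup {a} a≺x a∈y → Graph.sym G (∈-bits (trans
        (cong (λ v → nb G v y) (sym (at-pos σ a)))
        (trans (sym (Eq-∈ (equal x≼y sup) (∈-recent⁺ {j = pos σ a} a≺x)))
               (cong (λ v → nb G v x) (at-pos σ a)))) (Graph.sym G a∈y))
    ; tie     = λ {x} {y} x≼y sup → subst (λ v → y ≼[ ρ ] v) (at-pos σ x)
        (proj₂ (isLexBFS⁺-elim lex (pos σ x) y x≼y) (subst (λ v → Eq (history (pos σ x)) v y) (sym (at-pos σ x)) (equal x≼y sup)))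
    }
    where
    equal : ∀ {x y} → x ≼[ σ ] y → (∀ {a} → a ≺[ σ ] x → a ∈ N G x → a ∈ N G y) → Eq (history (pos σ x)) x y
    equal {x} {y} x≼y sup with compare (history (pos σ x)) x y
    ... | inj₁ p        = p
    ... | inj₂ (inj₂ g) = ⊥-elim (proj₁ (isLexBFS⁺-elim lex (pos σ x) y x≼y)
                            (subst (Gt (history (pos σ x)) y) (sym (at-pos σ x)) g))
    ... | inj₂ (inj₁ g) with Gt-witness {F = nbAt} ℕ.<-asym (recent-sorted n (toℕ (pos σ x))) g
    ...   | j , j∈ , fx , fy , _ = ⊥-elim (bits⁻′ fy (Graph.sym G (sup
            (subst (Fin._< pos σ x) (sym (pos-at σ j)) (∈-recent⁻ {i = toℕ (pos σ x)} j∈))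
            (Graph.sym G (bits⁻ {S = N G (at σ j)} {x} fx)))))

-- Correctness of the procedure

module Ranked {n : ℕ} {G T : Graph n} {s : Fin n} {ρ π bfs : Order n} (chordal : Chordal G)
  (mns : MNS⁺ G ρ π) (is𝓛 : Is𝓛Tree G π T s) (isBFS : IsBFS T s bfs) where
  open MNSChordal chordal mns public
  open Ancestry G π public
  open Tree is𝓛 public

  β : Order n
  β = bfs ⁻

  bfs-search : Search bfs
  bfs-search = IsBFS.start isBFS , λ i 0<i → case IsBFS.step isBFS i 0<i of λ
    (u , ((visited , _) , _) , u~i) → u , visited , u~i

  bfs-parent : ∀ {v p} → Parent G π v p → v ≺[ β ] p
  bfs-parent par = ≺-⁻ bfs (parent-first bfs bfs-search par)

  bfs-Anc : ∀ {a b} → Anc G π a b → a ≢ b → b ≺[ β ] a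
  bfs-Anc anc a≢b with ≼⇒≡⊎≺ bfs (Anc-≼-search bfs bfs-search anc)
  ... | inj₁ e  = ⊥-elim (a≢b e)
  ... | inj₂ lt = ≺-⁻ bfs lt

  β-sorted : AllPairs (λ p q → q ≺[ β ] p) (reverse (toList β))
  β-sorted = AllPairs-reverse (AllPairs-toList⁺ β id)

  ∈-β : ∀ v → v ∈ₗ reverse (toList β)
  ∈-β v = Any.reverse⁺ (∈-toList β v)

  -- As the last vertex of `β`, `s` belongs to no refining set, whereas every other vertex belongs
  -- to that of its parent.
  s-last : ∀ x → x ≢ s → Gt (ranking G β) x s
  s-last x x≢s with parent x x≢s
  ... | p , par@((p∈ , _) , _) with compare (ranking G β) x s
  ...   | inj₂ (inj₁ g) = g
  ...   | inj₁ e = ⊥-elim (no-family (trans (sym (Eq-∈ {F = family G β} e (∈-β p))) (family⁺ G β (Graph.sym G p∈) (bfs-parent par))))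
    where
    no-family : ∀ {v} → family G β v s ≢ true
    no-family {v} f with () ← subst (toℕ (pos bfs v) <_) (IsBFS.start isBFS) (⁻-≺ bfs (proj₂ (family⁻ G β f)))
  ...   | inj₂ (inj₂ g) with Gt-witness {F = family G β} {λ p q → p ≺[ β ] q} ℕ.<-asym β-sorted g
  ...     | a , _ , fs , _ with () ← subst (toℕ (pos bfs a) <_) (IsBFS.start isBFS) (⁻-≺ bfs (proj₂ (family⁻ G β fs)))

  open Arrangement G s ρ β s-last public using (arranged; module Arranged)
  open Arranged arranged public

  Beneath : Fin n → Fin n → Set
  Beneath u v = u ≢ s × (v ≡ s ⊎ Ahead ρ (ranking G β) v u)

  Beneath-sorted : AllPairs (flip Beneath) (arrangement G s ρ β)
  Beneath-sorted = subst (AllPairs (flip Beneath)) (sym shape)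
    (All.tabulate (λ u∈ → (λ { refl → s∉rest u∈ }) , inj₁ refl) ∷
     AllPairs-map∈ (λ x∈ y∈ a → (λ { refl → s∉rest y∈ }) , inj₂ a) sorted)

  module DFSOrder {τ σ : Order n} (isτ : toList τ ≡ reverse (arrangement G s ρ β)) (isDFS⁺ : IsDFS⁺ τ T σ) where
    open IsDFS⁺ isDFS⁺

    beneath : ∀ {u v} → u ≺[ τ ] v → Beneath u v
    beneath = AllPairs-toList⁻ τ (subst (AllPairs Beneath) (sym isτ) (AllPairs-reverse Beneath-sorted))

    starts : Starts σ s
    starts with index-0 s
    ... | i , i≡0 with s Fin.≟ at σ i
    ...   | yes e = trans (cong (toℕ ∘ pos σ) e) (trans (cong toℕ (pos-at σ i)) i≡0)
    ...   | no s≢ with ≼⇒≡⊎≺ τ (Ends-≼ τ (start (at σ i) (trans (cong toℕ (pos-at σ i)) i≡0)) s)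
    ...     | inj₁ e  = ⊥-elim (s≢ e)
    ...     | inj₂ lt = ⊥-elim (proj₁ (beneath lt) refl)

    search : Search σ
    search = starts , λ i 0<i → case step i 0<i of λ (u , ((visited , _) , _) , u~i , _) → u , visited , u~i

    s-visited : ∀ {i} → 0 < toℕ i → Visited σ i s
    s-visited 0<i = subst (_< _) (sym starts) 0<i

    -- The tree edge by which the path from `s` to the unvisited vertex `y` leaves the visited part.
    record Branching (i y : Fin n) : Set where
      field
        z x   : Fin n
        par   : Parent G π x z
        z<i   : Visited σ i z
        i≤x   : Unvisited σ i x
        below : Anc G π x y

    branching : ∀ {i y} → 0 < toℕ i → Unvisited σ i y → Branching i y
    branching {i} {y} 0<i i≤y = go (Anc-root y) i≤y
      where
      go : ∀ {y} → Anc G π s y → Unvisited σ i y → Branching i y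
      go here i≤s = ⊥-elim (ℕ.<⇒≱ (s-visited 0<i) i≤s)
      go {y} (up {p = p} par anc) i≤y with pos σ p Fin.<? i
      ... | yes p<i = record { z = p ; x = y ; par = par ; z<i = p<i ; i≤x = i≤y ; below = here }
      ... | no p≮i  = record { z = B.z ; x = B.x ; par = B.par ; z<i = B.z<i ; i≤x = B.i≤x ; below = up par B.below }
        where module B = Branching (go anc (ℕ.≮⇒≥ p≮i))

    -- By `trémaux`, `b` is comparable with `y`. It cannot lie at or below the unvisited vertex
    -- where the path branches off, since ancestors are visited first.
    visited-Anc : ∀ {i y} (B : Branching i y) → Unvisited σ i y → ∀ {b} → Visited σ i b → y ∈ N G b →
      Anc G π b (Branching.z B)
    visited-Anc {i} {y} B i≤y {b} b<i y∈b with ℕ.<-cmp (toℕ (pos π b)) (toℕ (pos π y))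
    ... | tri≈ _ e _ = ⊥-elim (Graph.irrefl G b (subst (_∈ N G b) (pos-injective π (Fin.toℕ-injective (sym e))) y∈b))
    ... | tri> _ _ y≺b = ⊥-elim (ℕ.<⇒≱ b<i (ℕ.≤-trans i≤y (Anc-≼-search σ search (trémaux y∈b y≺b))))
    ... | tri< b≺y _ _ with Anc-chain (trémaux (Graph.sym G y∈b) b≺y) (Branching.below B)
    ...   | inj₂ x-b = ⊥-elim (ℕ.<⇒≱ b<i (ℕ.≤-trans (Branching.i≤x B) (Anc-≼-search σ search x-b)))
    ...   | inj₁ b-x = Anc-parent (Branching.par B) (λ { refl → ℕ.<⇒≱ b<i (Branching.i≤x B) }) b-x

    Anc-visited : ∀ {i a u} → Anc G π a u → Visited σ i u → Visited σ i a
    Anc-visited anc u<i = ℕ.≤-<-trans (Anc-≼-search σ search anc) u<i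

    child : ∀ {i u v} → Visited σ i u → Unvisited σ i v → v ∈ N T u → Parent G π v u
    child u<i i≤v v~u with T⇒Parent v~u
    ... | inj₂ par = par
    ... | inj₁ par = ⊥-elim (ℕ.<⇒≱ u<i (ℕ.≤-trans i≤v (ℕ.<⇒≤ (parent-first σ search par))))

    visited-above : ∀ {i u v} → Visited σ i u → Parent G π v u → Unvisited σ i v →
      ∀ {b} → Visited σ i b → v ∈ N G b → Anc G π b u
    visited-above u<i par i≤v = visited-Anc
      (record { z = _ ; x = _ ; par = par ; z<i = u<i ; i≤x = i≤v ; below = here }) i≤v

    child-family : ∀ {a u x} → Parent G π x u → Anc G π a u → x ∈ N G a → family G β a x ≡ true
    child-family par anc x∈ = family⁺ G β x∈
      (bfs-Anc (up par anc) λ { refl → Graph.irrefl G _ x∈ })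

    -- `a` is a neighbour of `x` and so comparable with it, and `β` lists descendants first; as `x`
    -- precedes `a` in `β`, `a` is a proper ancestor of `x`.
    family-Anc : ∀ {a x u} → Parent G π x u → family G β a x ≡ true → Anc G π a u
    family-Anc {a} {x} par fx with family⁻ G β fx
    ... | x∈a , x≺a with ℕ.<-cmp (toℕ (pos π a)) (toℕ (pos π x))
    ...   | tri≈ _ e _ = ⊥-elim (ℕ.<-irrefl (cong (toℕ ∘ pos β) (pos-injective π (Fin.toℕ-injective (sym e)))) x≺a)
    ...   | tri> _ _ x≺πa = ⊥-elim (ℕ.<-asym x≺a (bfs-Anc (trémaux x∈a x≺πa) λ { refl → ℕ.<-irrefl refl x≺a }))
    ...   | tri< a≺πx _ _ = Anc-parent par (λ { refl → ℕ.<-irrefl refl x≺a }) (trémaux (Graph.sym G x∈a) a≺πx)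

    -- The ancestors of `u` form a path, which `σ` lists downwards and `β` upwards. So the ancestor
    -- that LexDFS weighs most is also the one whose set refines first.
    Anc-later : ∀ {a b u} → Anc G π a u → Anc G π b u → a ≺[ σ ] b → b ≺[ β ] a
    Anc-later a-u b-u a≺b with Anc-chain a-u b-u
    ... | inj₁ a-b = bfs-Anc a-b λ { refl → ℕ.<-irrefl refl a≺b }
    ... | inj₂ b-a = ⊥-elim (ℕ.<⇒≱ a≺b (Anc-≼-search σ search b-a))

    -- If a visited `x` has an unvisited neighbour `y` in `G`, then the path to `y` leaves the
    -- visited part at a vertex below or equal to `x`. That vertex is active in the tree, so the
    -- most recent active vertex of `T` is also the most recent one of `G`.
    isDFS : IsDFS G σ
    isDFS i 0<i with step i 0<i
    ... | u , ((u<i , w , w~u , i≤w) , recent) , v~u , _ = u ,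
      ((u<i , w , Graph.sym G (proj₁ (proj₁ (child u<i i≤w w~u))) , i≤w) , λ x (x<i , y , y∈x , i≤y) →
        let B = branching 0<i i≤y in ℕ.≤-trans (Anc-≼-search σ search (visited-Anc B i≤y x<i y∈x))
          (recent (Branching.z B) (Branching.z<i B , Branching.x B , Parent⇒T (Branching.par B) , Branching.i≤x B))) ,
      Graph.sym G (proj₁ (proj₁ (child u<i (ℕ.≤-reflexive (cong toℕ (sym (pos-at σ i)))) v~u)))

    -- By `trémaux`, the neighbours of `v` that precede it in `σ` are ancestors, and the parent is
    -- the lowest proper ancestor in either order.
    Parent-σ : ∀ {v p} → Parent G π v p → Parent G σ v p
    Parent-σ {v} {p} par = (proj₁ (proj₁ par) , parent-first σ search par) , λ w w∈v w≺v →
      case ℕ.<-cmp (toℕ (pos π w)) (toℕ (pos π v)) of λ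
        { (tri< w≺πv _ _) → Anc-≼-search σ search (Anc-parent par (λ { refl → Graph.irrefl G _ w∈v }) (trémaux w∈v w≺πv))
        ; (tri≈ _ e _) → ⊥-elim (Graph.irrefl G v (subst (_∈ N G v) (pos-injective π (Fin.toℕ-injective e)) w∈v))
        ; (tri> _ _ v≺πw) → ⊥-elim (ℕ.<⇒≱ w≺v (Anc-≼-search σ search (trémaux (Graph.sym G w∈v) v≺πw))) }

    σ-Parent : ∀ {v p} → Parent G σ v p → Parent G π v p
    σ-Parent {v} {p} par with parent v (λ { refl → case subst (toℕ (pos σ p) <_) starts (proj₂ (proj₁ par)) of λ () })
    ... | q , par′ with refl ← Ancestry.parent-unique G σ par (Parent-σ par′) = par′

    -- Together with `isDFS` this makes `σ` the witness for the requirement on the input of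
    -- `Ordering`.
    is𝓛Tree-σ : Is𝓛Tree G σ T s
    is𝓛Tree-σ = record
      { root = starts
      ; left = λ v v≢s → case parent v v≢s of λ (p , par) → p , proj₁ (proj₁ par) , parent-first σ search par
      ; edge = λ u v → mk⇔ (Sum.map Parent-σ Parent-σ ∘ T⇒Parent)
                           (Equivalence.from (edge u v) ∘ Sum.map σ-Parent σ-Parent) }

    module _ (end : Ends ρ s) where
      open LexLabels G {s} {ρ} {σ} starts end

      -- Let `a` decide the ranking in favour of `x`. If a vertex `b` decided the labels in favour
      -- of `y`, it would be more recent than `a`, hence earlier in `β` by `Anc-later`; but there
      -- the ranking says that `x` and `y` agree.
      siblings-Gt : ∀ {i u x y} → Visited σ i u → Parent G π x u → Parent G π y u → Unvisited σ i x → Unvisited σ i y →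
        Gt (ranking G β) x y → Gt (past i) x y
      siblings-Gt {i} {u} {x} {y} u<i px py i≤x i≤y g
        with Gt-witness {F = family G β} {λ p q → p ≺[ β ] q} ℕ.<-asym β-sorted g
      ... | a , _ , fx , fy , agree = conclude (compare (past i) x y)
        where
        x∈a : x ∈ N G a
        x∈a = proj₁ (family⁻ G β fx)
        anc : Anc G π a u
        anc = family-Anc px fx
        y∉a : y ∉ N G a
        y∉a y∈ with () ← trans (sym fy) (child-family py anc y∈)
        conclude : Eq (past i) x y ⊎ Gt (past i) x y ⊎ Gt (past i) y x → Gt (past i) x y
        conclude (inj₂ (inj₁ h)) = h
        conclude (inj₁ p)        = ⊥-elim (y∉a (past-Eq⁻ p (Anc-visited anc u<i) x∈a))
        conclude (inj₂ (inj₂ h)) with past-Gt⁻ h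
        ... | b , b<i , y∈b , x∉b , agree′ with ℕ.<-cmp (toℕ (pos σ a)) (toℕ (pos σ b))
        ...   | tri≈ _ e _ = ⊥-elim (x∉b (subst (λ v → x ∈ N G v) (pos-injective σ (Fin.toℕ-injective e)) x∈a))
        ...   | tri> _ _ b≺a = ⊥-elim (y∉a (proj₂ (agree′ (Anc-visited anc u<i) b≺a) x∈a))
        ...   | tri< a≺b _ _ = ⊥-elim (x∉b (proj₁ (family⁻ G β
          (trans (agree (∈-β b) (Anc-later anc b-u a≺b)) (child-family py b-u y∈b)))))
          where
          b-u = visited-above u<i py i≤y b<i y∈b

      siblings-Eq : ∀ {i u x y} → Visited σ i u → Parent G π x u → Parent G π y u → Unvisited σ i x → Unvisited σ i y →
        Eq (ranking G β) x y → Eq (past i) x y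
      siblings-Eq {i} {u} {x} {y} u<i px py i≤x i≤y p = conclude (compare (past i) x y)
        where
        conclude : Eq (past i) x y ⊎ Gt (past i) x y ⊎ Gt (past i) y x → Eq (past i) x y
        conclude (inj₁ q) = q
        conclude (inj₂ (inj₁ h)) with past-Gt⁻ h
        ... | b , b<i , x∈b , y∉b , _ = ⊥-elim (y∉b (proj₁ (family⁻ G β (trans (sym (Eq-∈ {F = family G β} p (∈-β b)))
          (child-family px (visited-above u<i px i≤x b<i x∈b) x∈b)))))
        conclude (inj₂ (inj₂ h)) with past-Gt⁻ h
        ... | b , b<i , y∈b , x∉b , _ = ⊥-elim (x∉b (proj₁ (family⁻ G β (trans (Eq-∈ {F = family G β} p (∈-β b))
          (child-family py (visited-above u<i py i≤y b<i y∈b) y∈b)))))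

      Leads : Fin n → Fin n → Fin n → Set
      Leads i x y = Gt (past i) x y ⊎ (Eq (past i) x y × y ≼[ ρ ] x)

      Leads-trans : ∀ {i x y z} → Leads i x y → Leads i y z → Leads i x z
      Leads-trans {i} (inj₁ g)       (inj₁ h)       = inj₁ (Gt-trans (past i) g h)
      Leads-trans {i} (inj₁ g)       (inj₂ (q , _)) = inj₁ (Gt-Eq (past i) g q)
      Leads-trans {i} (inj₂ (p , _)) (inj₁ h)       = inj₁ (Eq-Gt (past i) p h)
      Leads-trans {i} (inj₂ (p , l)) (inj₂ (q , k)) = inj₂ (Eq-trans (past i) p q , ℕ.≤-trans k l)

      root-leads : ∀ {i u x y} → Visited σ i u → Parent G π x u → Unvisited σ i x → Unvisited σ i y → Anc G π x y → Leads i x y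
      root-leads {i} {u} {x} {y} u<i px i≤x i≤y x-y = conclude (compare (past i) x y)
        where
        above : ∀ {b} → Visited σ i b → y ∈ N G b → Anc G π b u
        above = visited-Anc (record { z = u ; x = x ; par = px ; z<i = u<i ; i≤x = i≤x ; below = x-y }) i≤y
        conclude : Eq (past i) x y ⊎ Gt (past i) x y ⊎ Gt (past i) y x → Leads i x y
        conclude (inj₂ (inj₁ h)) = inj₁ h
        -- With equal labels, `y` has all neighbours of `x` that precede `x` in `π`. So `π` faced
        -- the same tie when it chose `x`, and resolved it by `ρ`.
        conclude (inj₁ p) = inj₂ (p , Anc-tie x-y λ {a} a≺x a∈x → Graph.sym G (past-Eq⁻ p
          (Anc-visited (Anc-parent px (λ { refl → Graph.irrefl G _ a∈x }) (trémaux a∈x a≺x)) u<i) (Graph.sym G a∈x)))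
        conclude (inj₂ (inj₂ h)) with past-Gt⁻ h
        ... | b , b<i , y∈b , x∉b , _ = ⊥-elim (x∉b (Graph.sym G (absorb x-y (Graph.sym G y∈b)
          (ℕ.≤-<-trans (Anc-≼ (above b<i y∈b)) (proj₂ (proj₁ px))))))

      next-leads : ∀ i y → 0 < toℕ i → Unvisited σ i y → y ≢ at σ i → Leads i (at σ i) y
      next-leads i y 0<i i≤y y≢ with step i 0<i
      ... | u , ((u<i , _) , recent) , v~u , rightmost = go (u Fin.≟ B.z)
        where
        module B = Branching (branching 0<i i≤y)
        i≤v : Unvisited σ i (at σ i)
        i≤v = at-unvisited i
        pv : Parent G π (at σ i) u
        pv = child u<i i≤v v~u
        z≼u : B.z ≼[ σ ] u
        z≼u = recent B.z (B.z<i , B.x , Parent⇒T B.par , B.i≤x)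
        strictly : u ≢ B.z → B.z ≺[ σ ] u
        strictly u≢z with ≼⇒≡⊎≺ σ z≼u
        ... | inj₁ e  = ⊥-elim (u≢z (sym e))
        ... | inj₂ lt = lt
        y-above : ∀ {b} → Visited σ i b → y ∈ N G b → b ≼[ σ ] B.z
        y-above b<i y∈b = Anc-≼-search σ search (visited-Anc (branching 0<i i≤y) i≤y b<i y∈b)
        -- The path to `y` branches off above `u`, so `y` has no visited neighbour as recent as `u`,
        -- whereas the chosen child of `u` has one.
        deeper : B.z ≺[ σ ] u → Eq (past i) (at σ i) y ⊎ Gt (past i) (at σ i) y ⊎ Gt (past i) y (at σ i) → Leads i (at σ i) y
        deeper z≺u (inj₂ (inj₁ h)) = inj₁ h
        deeper z≺u (inj₁ p) = ⊥-elim (ℕ.<⇒≱ z≺u (y-above u<i (past-Eq⁻ p u<i (Graph.sym G (proj₁ (proj₁ pv))))))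
        deeper z≺u (inj₂ (inj₂ h)) with past-Gt⁻ h
        ... | b , b<i , y∈b , v∉b , agree = ⊥-elim (ℕ.<⇒≱ z≺u (y-above u<i
          (proj₂ (agree u<i (ℕ.≤-<-trans (y-above b<i y∈b) z≺u)) (Graph.sym G (proj₁ (proj₁ pv))))))
        go : Dec (u ≡ B.z) → Leads i (at σ i) y
        go (no u≢z) = deeper (strictly u≢z) (compare (past i) (at σ i) y)
        go (yes u≡z) = Leads-trans {i} v-x (root-leads u<i px B.i≤x i≤y B.below)
          where
          px : Parent G π B.x u
          px = subst (Parent G π B.x) (sym u≡z) B.par
          v-x : Leads i (at σ i) B.x
          v-x with ≼⇒≡⊎≺ τ (rightmost B.x (Parent⇒T px) B.i≤x)
          ... | inj₁ e = inj₂ (subst (λ w → Eq (past i) w B.x) e (Eq-refl (past i)) , ℕ.≤-reflexive (cong (toℕ ∘ pos ρ) e))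
          ... | inj₂ x≺v with proj₂ (beneath x≺v)
          ...   | inj₁ v≡s = ⊥-elim (unvisited-≢s 0<i i≤v v≡s)
          ...   | inj₂ (inj₁ g)        = inj₁ (siblings-Gt u<i pv px i≤v B.i≤x g)
          ...   | inj₂ (inj₂ (p , lt)) = inj₂ (siblings-Eq u<i pv px i≤v B.i≤x p , ℕ.<⇒≤ lt)

      isLexDFS⁺ : IsLexDFS⁺ G s ρ σ
      isLexDFS⁺ = isLexDFS⁺-intro next-leads

lexDFS⁺-chordal-correct : ∀ {n} (G : Graph n) (s : Fin n) (ρ : Order n) → Chordal G → Ends ρ s →
  ∀ σ → LexDFS⁺-Chordal G s ρ σ → IsLexDFS⁺ G s ρ σ × Starts σ s
lexDFS⁺-chordal-correct G s ρ chordal end σ run = isLexDFS⁺ end , starts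
  where
  open LexDFS⁺-Chordal run
  open Ordering ordering using (isBFS; isτ; output)
  mns : MNS⁺ G ρ π
  mns = LexLabels.isLexBFS⁺⇒MNS⁺ G {s} {ρ} {π} (Is𝓛Tree.root is𝓛Tree) end isLexBFS⁺
  open Ranked chordal mns is𝓛Tree isBFS using (module DFSOrder)
  open DFSOrder isτ output

-- Total correctness with running times, and data structures

wp : Program → ℕ → (Store → Set) → Store → Set
wp P k Q M = ∃[ t ] ∃[ M′ ] (⟨ P , M ⟩⇓[ t ] M′) × t ≤ k × Q M′

wp-mono : ∀ {P a b} {Q R : Store → Set} {M} → a ≤ b → (∀ {M′} → Q M′ → R M′) → wp P a Q M → wp P b R M
wp-mono a≤b f (t , M′ , r , t≤a , q) = t , M′ , r , ℕ.≤-trans t≤a a≤b , f q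

wp-seq : ∀ {P P′ a b} {R : Store → Set} {M} → wp P a (wp P′ b R) M → wp (P ⨾ P′) (a + b) R M
wp-seq (t , M′ , r , t≤a , t′ , M″ , r′ , t′≤b , q) = t + t′ , M″ , seq r r′ , ℕ.+-mono-≤ t≤a t′≤b , q

Assignment : Set
Assignment = ℕ × Expr × Expr

block : List Assignment → Program
block []                 = skip
block ((a , e , f) ∷ as) = (a ⟦ e ⟧≔ f) ⨾ block as

run : List Assignment → Store → Store
run []                 M = M
run ((a , e , f) ∷ as) M = run as (M [ a , eval M e ]≔ eval M f)

block⇓ : ∀ as M → ⟨ block as , M ⟩⇓[ suc (length as) ] run as M
block⇓ []                 M = skip
block⇓ ((a , e , f) ∷ as) M = seq assign (block⇓ as _)

wp-block : ∀ as {Q : Store → Set} {M} → Q (run as M) → wp (block as) (suc (length as)) Q M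
wp-block as {M = M} q = _ , _ , block⇓ as M , ℕ.≤-refl , q

wp-branch : ∀ {b P P′ k} {Q : Store → Set} {M} →
  (test M b ≡ true → wp P k Q M) → (test M b ≡ false → wp P′ k Q M) → wp (branch b P P′) (suc k) Q M
wp-branch {b} {M = M} f g with test M b in e
... | true  = let (t , M′ , r , le , q) = f refl in suc t , M′ , if-true e r , s≤s le , q
... | false = let (t , M′ , r , le , q) = g refl in suc t , M′ , if-false e r , s≤s le , q

-- The list holds the work still to be done. Each entry pays for one round and its test, so rounds
-- of unequal cost add up to a sum over the list; the remaining unit is for the failing test.
wp-while : ∀ {A : Set} {b P} (Inv : List A → Store → Set) (cost : A → ℕ) →
  (∀ {x xs M} → Inv (x ∷ xs) M → test M b ≡ true × wp P (cost x) (Inv xs) M) →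
  (∀ {M} → Inv [] M → test M b ≡ false) →
  ∀ xs {M} → Inv xs M → wp (while b P) (suc (sum (map (suc ∘ cost) xs))) (Inv []) M
wp-while Inv cost step stop [] {M} inv = 1 , M , while-false (stop inv) , ℕ.≤-refl , inv
wp-while Inv cost step stop (x ∷ xs) {M} inv with step inv
... | go , t , M′ , r , t≤ , inv′ with wp-while Inv cost step stop xs inv′
...   | t′ , M″ , r′ , t′≤ , q = suc (t + t′) , M″ , while-true go r r′ ,
  s≤s (subst (t + t′ ≤_) (ℕ.+-suc (cost x) _) (ℕ.+-mono-≤ t≤ t′≤)) , q

-- Arrays left unchanged by a program.

writes : Program → List ℕ
writes skip           = []
writes (a ⟦ _ ⟧≔ _)   = a ∷ []
writes (P ⨾ Q)        = writes P ++ writes Q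
writes (branch _ P Q) = writes P ++ writes Q
writes (while _ P)    = writes P

infix 4 _∉ᵇ_
-- Boolean, so that the side conditions of `frame` for concrete programs are closed by `refl`.
_∉ᵇ_ : ℕ → List ℕ → Bool
a ∉ᵇ []       = true
a ∉ᵇ (b ∷ bs) = if a ≡ᵇ b then false else (a ∉ᵇ bs)

∉ᵇ-++ : ∀ {a} bs {cs} → (a ∉ᵇ bs ++ cs) ≡ true → (a ∉ᵇ bs) ≡ true × (a ∉ᵇ cs) ≡ true
∉ᵇ-++         []       e = refl , e
∉ᵇ-++ {a} (b ∷ bs) e with a ≡ᵇ b
... | false = ∉ᵇ-++ bs e

infix 4 _≐⟨_⟩_
_≐⟨_⟩_ : Store → Program → Store → Set
M′ ≐⟨ P ⟩ M = ∀ a → (a ∉ᵇ writes P) ≡ true → ∀ j → M′ a j ≡ M a j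

frame : ∀ {P M t M′} → ⟨ P , M ⟩⇓[ t ] M′ → M′ ≐⟨ P ⟩ M
frame skip a _ j = refl
frame (assign {a = b}) a a∉ j with a ≡ᵇ b
... | false = refl
frame (seq {P} r r′) a a∉ j with ∉ᵇ-++ (writes P) a∉
... | p , q = trans (frame r′ a q j) (frame r a p j)
frame (if-true {P = P} _ r) a a∉ j  = frame r a (proj₁ (∉ᵇ-++ (writes P) a∉)) j
frame (if-false {P = P} _ r) a a∉ j = frame r a (proj₂ (∉ᵇ-++ (writes P) a∉)) j
frame (while-true _ r r′) a a∉ j    = trans (frame r′ a a∉ j) (frame r a a∉ j)
frame (while-false _) a _ j         = refl

wp-after : ∀ {P k} {Q R : Store → Set} {M} → wp P k Q M → (∀ {M′} → M′ ≐⟨ P ⟩ M → Q M′ → R M′) → wp P k R M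
wp-after (t , M′ , r , le , q) f = t , M′ , r , le , f (frame r) q

wp-framed : ∀ P {k} {Q : Store → Set} {M} → wp P k (λ M′ → M′ ≐⟨ P ⟩ M → Q M′) M → wp P k Q M
wp-framed P p = wp-after p λ f q → q f

T⇒≡true : ∀ {b} → T b → b ≡ true
T⇒≡true {true} _ = refl

<ᵇ-true : ∀ {a b} → a < b → (a <ᵇ b) ≡ true
<ᵇ-true lt = T⇒≡true (ℕ.<⇒<ᵇ lt)

<ᵇ-false : ∀ {a b} → b ≤ a → (a <ᵇ b) ≡ false
<ᵇ-false {a} {b} le with a <ᵇ b in e
... | false = refl
... | true  = ⊥-elim (ℕ.<⇒≱ (ℕ.<ᵇ⇒< a b (subst T (sym e) tt)) le)

<ᵇ-true⁻ : ∀ {a b} → (a <ᵇ b) ≡ true → a < b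
<ᵇ-true⁻ {a} {b} e = ℕ.<ᵇ⇒< a b (subst T (sym e) tt)

<ᵇ-false⁻ : ∀ {a b} → (a <ᵇ b) ≡ false → b ≤ a
<ᵇ-false⁻ e = ℕ.≮⇒≥ λ lt → case trans (sym e) (<ᵇ-true lt) of λ ()

≡ᵇ-true : ∀ {a b} → a ≡ b → (a ≡ᵇ b) ≡ true
≡ᵇ-true {a} {b} e = T⇒≡true (ℕ.≡⇒≡ᵇ a b e)

≡ᵇ-true⁻ : ∀ {a b} → (a ≡ᵇ b) ≡ true → a ≡ b
≡ᵇ-true⁻ {a} {b} e = ℕ.≡ᵇ⇒≡ a b (subst T (sym e) tt)

≡ᵇ-false : ∀ {a b} → a ≢ b → (a ≡ᵇ b) ≡ false
≡ᵇ-false {a} {b} a≢b with a ≡ᵇ b in e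
... | false = refl
... | true  = ⊥-elim (a≢b (≡ᵇ-true⁻ e))

≡ᵇ-false⁻ : ∀ {a b} → (a ≡ᵇ b) ≡ false → a ≢ b
≡ᵇ-false⁻ e a≡b with () ← trans (sym e) (≡ᵇ-true a≡b)

-- What a write does to the array written, by definitional unfolding once array names are literals.
-- The stores computed by `run` can therefore be described without rewriting.
upd : (ℕ → ℕ) → ℕ → ℕ → ℕ → ℕ
upd f k x j = if j ≡ᵇ k then x else f j

upd-same : ∀ {f k x j} → j ≡ k → upd f k x j ≡ x
upd-same {f} {x = x} {j} e = cong (λ b → if b then x else f j) (≡ᵇ-true e)

upd-other : ∀ {f k x j} → j ≢ k → upd f k x j ≡ f j
upd-other {f} {x = x} {j} ne = cong (λ b → if b then x else f j) (≡ᵇ-false ne)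

upd-cong : ∀ {f f′ k k′ v v′ j} → f j ≡ f′ j → k ≡ k′ → v ≡ v′ → upd f k v j ≡ upd f′ k′ v′ j
upd-cong {k = k} {v = v} {j = j} e refl refl = cong (λ z → if j ≡ᵇ k then v else z) e

-- Array segments and singly linked lists.

module _ {n : ℕ} where

  Seg : (ℕ → ℕ) → ℕ → List (Fin n) → Set
  Seg f k []       = 𝟙
  Seg f k (x ∷ xs) = f k ≡ toℕ x × Seg f (suc k) xs

  Seg-cong : ∀ {f g} xs {k} → (∀ j → k ≤ j → j < k + length xs → f j ≡ g j) → Seg g k xs → Seg f k xs
  Seg-cong []       e _       = tt
  Seg-cong (x ∷ xs) {k} e (p , q) = trans (e k ℕ.≤-refl (ℕ.m<m+n k (s≤s z≤n))) p ,
    Seg-cong xs (λ j k<j j< → e j (ℕ.<⇒≤ k<j) (subst (j <_) (sym (ℕ.+-suc k (length xs))) j<)) q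

  Seg-≗ : ∀ {f g} xs {k} → (∀ j → f j ≡ g j) → Seg g k xs → Seg f k xs
  Seg-≗ xs e = Seg-cong xs λ j _ _ → e j

  Seg-++⁺ : ∀ {f} xs {ys k} → Seg f k xs → Seg f (k + length xs) ys → Seg f k (xs ++ ys)
  Seg-++⁺ {f} []       {ys} {k} _ q = subst (λ m → Seg f m ys) (ℕ.+-identityʳ k) q
  Seg-++⁺ {f} (x ∷ xs) {ys} {k} (p , ps) q = p , Seg-++⁺ xs ps (subst (λ m → Seg f m ys) (ℕ.+-suc k (length xs)) q)

  Seg-++⁻ : ∀ {f} xs {ys k} → Seg f k (xs ++ ys) → Seg f k xs × Seg f (k + length xs) ys
  Seg-++⁻ {f} []       {ys} {k} q = tt , subst (λ m → Seg f m ys) (sym (ℕ.+-identityʳ k)) q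
  Seg-++⁻ {f} (x ∷ xs) {ys} {k} (p , q) with Seg-++⁻ xs q
  ... | a , b = (p , a) , subst (λ m → Seg f m ys) (sym (ℕ.+-suc k (length xs))) b

  Seg-upd : ∀ {f} xs {k m x} → m < k ⊎ k + length xs ≤ m → Seg f k xs → Seg (upd f m x) k xs
  Seg-upd {f} xs {k} {m} out = Seg-cong xs λ j k≤j j< → upd-other {f} λ { refl → case out of λ
    { (inj₁ m<k) → ℕ.<⇒≱ m<k k≤j ; (inj₂ le) → ℕ.<⇒≱ j< le } }

  Seg-snoc : ∀ {f} xs {k m x} → m ≡ k + length xs → Seg f k xs → Seg (upd f m (toℕ x)) k (xs ∷ʳ x)
  Seg-snoc {f} xs {x = x} refl p = Seg-++⁺ xs (Seg-upd xs (inj₂ ℕ.≤-refl) p) (upd-same {f} {j = _ + length xs} refl , tt)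

  Seg-tabulate : ∀ {f k m} (g : Fin m → Fin n) → Seg f k (tabulate g) → ∀ i → f (k + toℕ i) ≡ toℕ (g i)
  Seg-tabulate {f} {k} g (p , q) zero    = trans (cong f (ℕ.+-identityʳ k)) p
  Seg-tabulate {f} {k} g (p , q) (suc i) = trans (cong f (ℕ.+-suc k (toℕ i))) (Seg-tabulate (g ∘ suc) q i)

  -- A linked list with the nodes below k; the link to node e is suc e, and 0
  -- ends the list.
  Linked : ℕ → (ℕ → ℕ) → (ℕ → ℕ) → ℕ → List (Fin n) → Set
  Linked k nxt src h []       = h ≡ 0
  Linked k nxt src h (x ∷ xs) = ∃ λ e → h ≡ suc e × e < k × src e ≡ toℕ x × Linked k nxt src (nxt e) xs

  Linked-cong : ∀ {k k′ nxt nxt′ src src′} xs {h} → k ≤ k′ → (∀ {e} → e < k → nxt′ e ≡ nxt e) →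
    (∀ {e} → e < k → src′ e ≡ src e) → Linked k nxt src h xs → Linked k′ nxt′ src′ h xs
  Linked-cong []       k≤ en es p = p
  Linked-cong (x ∷ xs) {h} k≤ en es (e , h≡ , e<k , sx , p) = e , h≡ , ℕ.<-≤-trans e<k k≤ , trans (es e<k) sx ,
    subst (λ z → Linked _ _ _ z xs) (sym (en e<k)) (Linked-cong xs k≤ en es p)

Holds⁺ : ∀ {n} {M : Store} {a} (σ : Order n) → Seg (M a) 0 (toList σ) → Holds M a σ
Holds⁺ σ p i = Seg-tabulate (at σ) p i

sum-const : ∀ {A : Set} c (xs : List A) → sum (map (λ _ → c) xs) ≡ length xs * c
sum-const c []       = refl
sum-const c (x ∷ xs) = cong (c +_) (sum-const c xs)

wp-loop : ∀ {A : Set} {b P} c (Inv : List A → Store → Set) →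
  (∀ {x xs M} → Inv (x ∷ xs) M → test M b ≡ true × wp P c (Inv xs) M) →
  (∀ {M} → Inv [] M → test M b ≡ false) →
  ∀ xs {M} → Inv xs M → wp (while b P) (suc (length xs * suc c)) (Inv []) M
wp-loop c Inv step stop xs inv =
  wp-mono (s≤s (ℕ.≤-reflexive (sum-const (suc c) xs))) id (wp-while Inv (λ _ → c) step stop xs inv)

-- Scalars: 21 is the index of the outer loop, 22 a position in an adjacency
-- list and 23 its end, 24 the number of nodes of linked lists, 25 the current
-- vertex and 26 a neighbour of it, 27 the number of classes so far, 28 this
-- number at the start of the round, 29 the class of vertex 26, 34 the end of
-- the work list in array 20, and 35 an index that runs down.
var : ℕ → Expr
var k = k ⟦ lit 0 ⟧

infix 6 _:=_
_:=_ : ℕ → Expr → Assignment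
k := e = k , lit 0 , e

infix 6 _⟨_⟩:=_
_⟨_⟩:=_ : ℕ → Expr → Expr → Assignment
a ⟨ e ⟩:= f = a , e , f

-- Arrays 10, 11 and 12 hold the heads, links and sources of the linked
-- adjacency lists.
pushArc : Program
pushArc = block
  ( 26 := 2 ⟦ var 22 ⟧
  ∷ 12 ⟨ var 24 ⟩:= var 25
  ∷ 11 ⟨ var 24 ⟩:= 10 ⟦ var 26 ⟧
  ∷ 10 ⟨ var 26 ⟩:= inc (var 24)
  ∷ 24 := inc (var 24)
  ∷ 22 := inc (var 22)
  ∷ [])

pushArcs : Program
pushArcs = while (var 22 ⋖ var 23) pushArc

loadVertex : ℕ → Program
loadVertex a = block
  ( 25 := a ⟦ var 21 ⟧
  ∷ 22 := 1 ⟦ var 25 ⟧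
  ∷ 23 := 1 ⟦ inc (var 25) ⟧
  ∷ [])

next-i : Program
next-i = block (21 := inc (var 21) ∷ [])

sortBody : ℕ → Program
sortBody a = loadVertex a ⨾ pushArcs ⨾ next-i

-- Transposing the adjacency lists leaves the graph as it is but sorts all lists at once: the
-- vertices are taken in the order of array `a`, and each is pushed onto the lists of its
-- neighbours. Pushing to the front reverses this order.
sortAdjacency : ℕ → Program
sortAdjacency a = block (21 := lit 0 ∷ []) ⨾ while (var 21 ⋖ var 0) (sortBody a)

nbrs : ∀ {n} → Graph n → List (Fin n) → Fin n → List (Fin n)
nbrs G us w = filter (λ u → w ∈? N G u) us

LinkedAt : ∀ {n} → Store → Fin n → List (Fin n) → Set
LinkedAt M w = Linked (M 24 0) (M 11) (M 12) (M 10 (toℕ w))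

LinkedAt-frame : ∀ {n P M M′} {w : Fin n} {xs} → M′ ≐⟨ P ⟩ M → (10 ∉ᵇ writes P) ≡ true → (11 ∉ᵇ writes P) ≡ true →
  (12 ∉ᵇ writes P) ≡ true → (24 ∉ᵇ writes P) ≡ true → LinkedAt M w xs → LinkedAt M′ w xs
LinkedAt-frame {M′ = M′} {w} {xs} f e₁₀ e₁₁ e₁₂ e₂₄ l =
  subst (λ h → Linked _ (M′ 11) (M′ 12) h xs) (sym (f 10 e₁₀ (toℕ w)))
    (Linked-cong xs (ℕ.≤-reflexive (sym (f 24 e₂₄ 0))) (λ {e} _ → f 11 e₁₁ e) (λ {e} _ → f 12 e₁₂ e) l)

module Accounting {n : ℕ} {G : Graph n} (L : AdjacencyLists G) where
  open AdjacencyLists L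

  deg : Fin n → ℕ
  deg v = length (list v)

  weight : Fin n → ℕ
  weight v = suc (deg v)

  -- For a vertex of degree `d`, the constant part of the cost of its round is charged to the
  -- summand one of `weight`.
  affine-≤ : ∀ a b d → a + d * b ≤ (a + b) * suc d
  affine-≤ a b d = ℕ.≤-trans (ℕ.+-mono-≤ (ℕ.m≤m+n a b) (ℕ.≤-trans (ℕ.*-monoʳ-≤ d (ℕ.m≤n+m b a))
    (ℕ.≤-reflexive (ℕ.*-comm d (a + b))))) (ℕ.≤-reflexive (sym (ℕ.*-suc (a + b) d)))

  total : ℕ
  total = sum (map weight (allFin n))

  sum-weights : ∀ {vs} → Unique vs → (∀ v → v ∈ₗ vs) → sum (map weight vs) ≡ total
  sum-weights u all = ListAction.sum-↭ (↭.map⁺ weight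
    (unique-↭ u (Unique.allFin⁺ n) (λ {v} _ → ∈ₗ.∈-allFin v) (λ {v} _ → all v)))

  sum-weights-≤ : ∀ c {vs} → Unique vs → (∀ v → v ∈ₗ vs) → sum (map (λ v → suc (c * weight v)) vs) ≤ suc c * total
  sum-weights-≤ c {vs} u all = ℕ.≤-trans (go vs) (ℕ.≤-reflexive (cong (suc c *_) (sum-weights u all)))
    where
    go : ∀ vs → sum (map (λ v → suc (c * weight v)) vs) ≤ suc c * sum (map weight vs)
    go []       = z≤n
    go (v ∷ vs) = ℕ.≤-trans (ℕ.+-mono-≤ (s≤s (ℕ.m≤n+m (c * weight v) (deg v))) (go vs))
      (ℕ.≤-reflexive (sym (ℕ.*-distribˡ-+ (suc c) (weight v) _)))

  wp-vertices : ∀ {b P} c (Inv : List (Fin n) → Store → Set) →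
    (∀ {v vs M} → Inv (v ∷ vs) M → test M b ≡ true × wp P (c * weight v) (Inv vs) M) →
    (∀ {M} → Inv [] M → test M b ≡ false) →
    ∀ {vs} → Unique vs → (∀ v → v ∈ₗ vs) → ∀ {M} → Inv vs M → wp (while b P) (suc (suc c * total)) (Inv []) M
  wp-vertices c Inv step stop {vs} u all inv =
    wp-mono (s≤s (sum-weights-≤ c u all)) id (wp-while Inv (λ v → c * weight v) step stop vs inv)

record Input {n} {G : Graph n} (L : AdjacencyLists G) (s : Fin n) (ρ : Order n) (M : Store) : Set where
  open AdjacencyLists L
  field
    size  : M 0 0 ≡ n
    root  : M 0 1 ≡ toℕ s
    arcs  : ∀ v → M 1 (suc (toℕ v)) ≡ M 1 (toℕ v) + length (list v) × Seg (M 2) (M 1 (toℕ v)) (list v)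
    order : Seg (M 3) 0 (toList ρ)

module _ {n : ℕ} {G : Graph n} {L : AdjacencyLists G} {s : Fin n} {ρ : Order n} where
  open AdjacencyLists L
  open Accounting L

  Input-≗ : ∀ {M M′} → (∀ j → M′ 0 j ≡ M 0 j) → (∀ j → M′ 1 j ≡ M 1 j) → (∀ j → M′ 2 j ≡ M 2 j) →
    (∀ j → M′ 3 j ≡ M 3 j) → Input L s ρ M → Input L s ρ M′
  Input-≗ {M} {M′} e₀ e₁ e₂ e₃ I = record
    { size  = trans (e₀ 0) I.size
    ; root  = trans (e₀ 1) I.root
    ; arcs  = λ v → trans (e₁ _) (trans (proj₁ (I.arcs v)) (cong (_+ length (list v)) (sym (e₁ _)))) ,
        Seg-≗ (list v) e₂ (subst (λ k → Seg (M 2) k (list v)) (sym (e₁ (toℕ v))) (proj₂ (I.arcs v)))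
    ; order = Seg-≗ (toList ρ) e₃ I.order
    }
    where module I = Input I

  Input-frame : ∀ {P M M′} → M′ ≐⟨ P ⟩ M → (0 ∉ᵇ writes P) ≡ true → (1 ∉ᵇ writes P) ≡ true →
    (2 ∉ᵇ writes P) ≡ true → (3 ∉ᵇ writes P) ≡ true → Input L s ρ M → Input L s ρ M′
  Input-frame f e₀ e₁ e₂ e₃ = Input-≗ (f 0 e₀) (f 1 e₁) (f 2 e₂) (f 3 e₃)

  record PushInv (ps : List (Fin n)) (x : Fin n) (ws : List (Fin n)) (M : Store) : Set where
    field
      at-x   : M 25 0 ≡ toℕ x
      stop   : M 22 0 + length ws ≡ M 23 0
      seg    : Seg (M 2) (M 22 0) ws
      unique : Unique ws
      sound  : ∀ {w} → w ∈ₗ ws → w ∈ N G x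
      before : ∀ w → w ∈ₗ ws → LinkedAt M w (nbrs G ps w)
      -- Non-neighbours of `x` fall under this case from the start, because adding `x` does not
      -- change their filtered list.
      after  : ∀ w → w ∉ₗ ws → LinkedAt M w (nbrs G (x ∷ ps) w)

  pushArc-wp : ∀ {ps x w ws M} → PushInv ps x (w ∷ ws) M → wp pushArc 7 (PushInv ps x ws) M
  pushArc-wp {ps} {x} {w} {ws} {M} I = wp-block _ record
    { at-x   = I.at-x
    ; stop   = trans (sym (ℕ.+-suc _ (length ws))) I.stop
    ; seg    = proj₂ I.seg
    ; unique = AllPairs.tail I.unique
    ; sound  = I.sound ∘ there
    ; before = λ v v∈ → old v (λ { refl → All.lookup (AllPairs.head I.unique) v∈ refl }) (I.before v (there v∈))
    ; after  = λ v v∉ → case v Fin.≟ w of λ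
        { (yes refl) → new
        ; (no v≢w)   → old v v≢w (I.after v λ { (here e) → v≢w e ; (there v∈) → v∉ v∈ }) }
    }
    where
    module I = PushInv I
    k = M 24 0
    w′ = M 2 (M 22 0)
    old : ∀ v {xs} → v ≢ w → LinkedAt M v xs →
      Linked (suc k) (upd (M 11) k (M 10 w′)) (upd (M 12) k (M 25 0)) (upd (M 10) w′ (suc k) (toℕ v)) xs
    old v {xs} v≢w l = subst (λ h → Linked _ (upd (M 11) k (M 10 w′)) (upd (M 12) k (M 25 0)) h xs)
      (sym (upd-other {M 10} λ e → v≢w (Fin.toℕ-injective (trans e (proj₁ I.seg)))))
      (Linked-cong xs (ℕ.n≤1+n k) (λ e<k → upd-other {M 11} (ℕ.<⇒≢ e<k)) (λ e<k → upd-other {M 12} (ℕ.<⇒≢ e<k)) l)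
    new : Linked (suc k) (upd (M 11) k (M 10 w′)) (upd (M 12) k (M 25 0)) (upd (M 10) w′ (suc k) (toℕ w)) (nbrs G (x ∷ ps) w)
    new rewrite List.filter-accept (λ u → w ∈? N G u) {x} {ps} (I.sound (here refl)) =
      k , upd-same {M 10} (sym (proj₁ I.seg)) , ℕ.≤-refl , trans (upd-same {M 12} {k} refl) I.at-x ,
      Linked-cong (nbrs G ps w) (ℕ.n≤1+n k) (λ e<k → upd-other {M 11} (ℕ.<⇒≢ e<k)) (λ e<k → upd-other {M 12} (ℕ.<⇒≢ e<k))
        (subst (λ h → Linked k (M 11) (M 12) h (nbrs G ps w))
          (trans (cong (M 10) (sym (proj₁ I.seg))) (sym (upd-same {M 11} {k} refl))) (I.before w (here refl)))

  pushArcs-wp : ∀ {ps x} ws {M} → PushInv ps x ws M → wp pushArcs (suc (length ws * 8)) (PushInv ps x []) M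
  pushArcs-wp {ps} {x} = wp-loop 7 (PushInv ps x)
    (λ {w} {ws} {M} I → <ᵇ-true (subst (M 22 0 <_) (PushInv.stop I) (ℕ.m<m+n (M 22 0) (s≤s z≤n))) , pushArc-wp I)
    (λ {M} I → <ᵇ-false (ℕ.≤-reflexive (trans (sym (PushInv.stop I)) (ℕ.+-identityʳ (M 22 0)))))

  record SortInv (a : ℕ) (vs ps us : List (Fin n)) (M : Store) : Set where
    field
      input  : Input L s ρ M
      shape  : reverse ps ++ us ≡ vs
      index  : M 21 0 + length us ≡ n
      seg    : Seg (M a) (M 21 0) us
      linked : ∀ w → LinkedAt M w (nbrs G ps w)

  sortBody-wp : ∀ {a vs ps u us M} → (a ∉ᵇ writes (sortBody a)) ≡ true → SortInv a vs ps (u ∷ us) M →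
    wp (sortBody a) (7 + deg u * 8) (SortInv a vs (u ∷ ps) us) M
  sortBody-wp {a} {vs} {ps} {u} {us} {M} a∉ I = wp-framed (sortBody a) (wp-mono (ℕ.≤-reflexive cost) id
    (wp-seq (wp-block _ (wp-seq (wp-after (pushArcs-wp (list u) start) λ {M₂} f J → wp-block _ λ f′ → record
        { input  = Input-frame {sortBody a} f′ refl refl refl refl I.input
        ; shape  = trans (cong (_++ us) (List.unfold-reverse u ps)) (trans (List.++-assoc (reverse ps) (u ∷ []) us) I.shape)
        ; index  = trans (cong (λ m → suc m + length us) (f 21 refl 0)) (trans (sym (ℕ.+-suc _ (length us))) I.index)
        ; seg    = Seg-≗ us (f′ a a∉) (subst (λ m → Seg (M a) m us) (cong suc (sym (f 21 refl 0))) (proj₂ I.seg))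
        ; linked = λ w → PushInv.after J w λ ()
        })))))
    where
    module I where
      open SortInv I public
      open Input input public using (arcs)
    start : PushInv ps u (list u) _
    start = record
      { at-x   = proj₁ I.seg
      ; stop   = trans (cong (λ v → M 1 v + deg u) (proj₁ I.seg))
                   (trans (sym (proj₁ (I.arcs u))) (cong (M 1 ∘ suc) (sym (proj₁ I.seg))))
      ; seg    = subst (λ v → Seg (M 2) (M 1 v) (list u)) (sym (proj₁ I.seg)) (proj₂ (I.arcs u))
      ; unique = unique u
      ; sound  = Equivalence.to (complete _ u)
      ; before = λ w _ → I.linked w
      ; after  = λ w w∉ → subst (LinkedAt M w)
          (sym (List.filter-reject (λ v → w ∈? N G v) {u} {ps} (w∉ ∘ Equivalence.from (complete w u)))) (I.linked w)
      }
    -- Four steps for `loadVertex`, eight per arc with its test, one for the failing test, two for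
    -- `next-i`. A block costs one step more than it has assignments, for the final `skip`.
    cost : 4 + (suc (deg u * 8) + 2) ≡ 7 + deg u * 8
    cost = cong (5 +_) (ℕ.+-comm (deg u * 8) 2)

  sortAdjacency-wp : ∀ {a vs M} → (a ∉ᵇ writes (sortAdjacency a)) ≡ true → Unique vs → (∀ v → v ∈ₗ vs) →
    Input L s ρ M → Seg (M a) 0 vs → (∀ w → M 10 (toℕ w) ≡ 0) →
    wp (sortAdjacency a) (2 + suc (16 * total)) (λ M′ → Input L s ρ M′ × (∀ w → LinkedAt M′ w (nbrs G (reverse vs) w))) M
  sortAdjacency-wp {a} {vs} {M} a∉ u all I seg heads =
    wp-seq (wp-block _ (wp-mono ℕ.≤-refl (λ {M′} (ps , J) → SortInv.input J , λ w →
        subst (LinkedAt M′ w) (cong (λ us → nbrs G us w) (reversed J)) (SortInv.linked J w))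
      (wp-vertices 15 (λ us M′ → ∃ λ ps → SortInv a vs ps us M′)
        (λ {v} {us} {M′} (ps , J) →
          (trans (cong (M′ 21 0 <ᵇ_) (Input.size (SortInv.input J)))
                 (<ᵇ-true (subst (M′ 21 0 <_) (SortInv.index J) (ℕ.m<m+n _ (s≤s z≤n))))) ,
          wp-mono (affine-≤ 7 8 (deg v)) (λ J′ → v ∷ ps , J′) (sortBody-wp (proj₂ (∉ᵇ-++ {a} (21 ∷ []) {writes (sortBody a)} a∉)) J))
        (λ {M′} (ps , J) → trans (cong (M′ 21 0 <ᵇ_) (Input.size (SortInv.input J)))
           (<ᵇ-false (ℕ.≤-reflexive (trans (sym (SortInv.index J)) (ℕ.+-identityʳ (M′ 21 0))))))
        u all ([] , record
          { input  = Input-≗ (λ _ → refl) (λ _ → refl) (λ _ → refl) (λ _ → refl) I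
          ; shape  = refl
          ; index  = sym (unique-length u all)
          ; seg    = Seg-≗ vs (frame (block⇓ (21 := lit 0 ∷ []) M) a (proj₁ (∉ᵇ-++ {a} (21 ∷ []) {writes (sortBody a)} a∉))) seg
          ; linked = heads
          }))))
    where
    reversed : ∀ {ps M′} → SortInv a vs ps [] M′ → ps ≡ reverse vs
    reversed {ps} J = trans (sym (List.reverse-involutive ps))
      (cong reverse (trans (sym (List.++-identityʳ (reverse ps))) (SortInv.shape J)))

-- A doubly linked list from a to z with successors f and predecessors g.
Chain : (ℕ → ℕ) → (ℕ → ℕ) → ℕ → List ℕ → ℕ → Set
Chain f g a []       z = f a ≡ z × g z ≡ a
Chain f g a (x ∷ xs) z = (f a ≡ x × g x ≡ a) × Chain f g x xs z

lastOf : ℕ → List ℕ → ℕ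
lastOf a []       = a
lastOf a (x ∷ xs) = lastOf x xs

headOr : ℕ → List ℕ → ℕ
headOr a []      = a
headOr a (x ∷ _) = x

lastOf-∈ : ∀ a xs → lastOf a xs ∈ₗ a ∷ xs
lastOf-∈ a []       = here refl
lastOf-∈ a (x ∷ xs) = there (lastOf-∈ x xs)

module _ {f g : ℕ → ℕ} where

  Chain-cong : ∀ {f′ g′} {a} xs {z} → (∀ {u} → u ∈ₗ a ∷ xs → f′ u ≡ f u) → (∀ {u} → u ∈ₗ xs → g′ u ≡ g u) →
    g′ z ≡ g z → Chain f g a xs z → Chain f′ g′ a xs z
  Chain-cong []       ef eg ez (p , q)       = trans (ef (here refl)) p , trans ez q
  Chain-cong (x ∷ xs) ef eg ez ((p , q) , c) =
    (trans (ef (here refl)) p , trans (eg (here refl)) q) , Chain-cong xs (ef ∘ there) (eg ∘ there) ez c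

  Chain-++⁻ : ∀ {a} as {y bs z} → Chain f g a (as ++ y ∷ bs) z → Chain f g a as y × Chain f g y bs z
  Chain-++⁻ []       (p , c) = p , c
  Chain-++⁻ (x ∷ as) (p , c) with Chain-++⁻ as c
  ... | c₁ , c₂ = (p , c₁) , c₂

  Chain-++⁺ : ∀ {a} as {y bs z} → Chain f g a as y → Chain f g y bs z → Chain f g a (as ++ y ∷ bs) z
  Chain-++⁺ []       p       c = p , c
  Chain-++⁺ (x ∷ as) (p , c) d = p , Chain-++⁺ as c d

  Chain-last : ∀ {a} as {y} → Chain f g a as y → g y ≡ lastOf a as
  Chain-last []       (_ , q) = q
  Chain-last (x ∷ as) (_ , c) = Chain-last as c

  -- Removal and insertion both alter the part in front of the affected node only in its last link.
  Chain-retarget : ∀ {f′ g′ a} as {y y′} → Unique (a ∷ as) →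
    (∀ {u} → u ∈ₗ a ∷ as → u ≢ lastOf a as → f′ u ≡ f u) → f′ (lastOf a as) ≡ y′ →
    (∀ {u} → u ∈ₗ as → g′ u ≡ g u) → g′ y′ ≡ lastOf a as → Chain f g a as y → Chain f′ g′ a as y′
  Chain-retarget []       _ ef el eg ey _ = el , ey
  Chain-retarget (x ∷ as) (a∉ ∷ u) ef el eg ey ((p , q) , c) =
    (trans (ef (here refl) (λ e → All.lookup a∉ (lastOf-∈ x as) e)) p , trans (eg (here refl)) q) ,
    Chain-retarget as u (ef ∘ there) el (eg ∘ there) ey c

unique-separate : ∀ {A : Set} (as : List A) {bs u v} → Unique (as ++ bs) → u ∈ₗ as → v ∈ₗ bs → u ≢ v
unique-separate as u u∈ v∈ = proj₂ (proj₂ (AllPairs-++⁻ as u)) u∈ v∈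

module _ {f g : ℕ → ℕ} where

  unlink-chain : ∀ {a} as {x} bs → Unique (a ∷ as ++ x ∷ bs) → Chain f g a (as ++ x ∷ bs) a →
    Chain (upd f (g x) (f x)) (upd g (f x) (g x)) a (as ++ bs) a
  unlink-chain {a} as {x} [] u c with Chain-++⁻ as c
  ... | c₁ , (fx , gx) = subst (λ l → Chain f′ g′ a l a) (sym (List.++-identityʳ as))
    (Chain-retarget as (proj₁ (AllPairs-++⁻ (a ∷ as) u))
      (λ u∈ u≢ → upd-other {f} λ e → u≢ (trans e (Chain-last as c₁)))
      (trans (upd-same {f} (sym (Chain-last as c₁))) fx)
      (λ v∈ → upd-other {g} λ e → All.lookup (AllPairs.head u) (∈ₗ.∈-++⁺ˡ v∈) (sym (trans e fx)))
      (trans (upd-same {g} (sym fx)) (Chain-last as c₁)) c₁)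
    where
    f′ = upd f (g x) (f x)
    g′ = upd g (f x) (g x)
  unlink-chain {a} as {x} (y ∷ bs) u c with Chain-++⁻ as c
  ... | c₁ , ((fx , gy) , c₂) = Chain-++⁺ as
    (Chain-retarget as (proj₁ (AllPairs-++⁻ (a ∷ as) u))
      (λ u∈ u≢ → upd-other {f} λ e → u≢ (trans e (Chain-last as c₁)))
      (trans (upd-same {f} (sym (Chain-last as c₁))) fx)
      (λ v∈ → upd-other {g} λ e → unique-separate (a ∷ as) u (there v∈) (there (here refl)) (trans e fx))
      (trans (upd-same {g} (sym fx)) (Chain-last as c₁)) c₁)
    (Chain-cong bs
      (λ v∈ → upd-other {f} λ e → unique-separate (a ∷ as) u (lastOf-∈ a as) (there v∈) (sym (trans e (Chain-last as c₁))))
      (λ v∈ → upd-other {g} λ e → All.lookup (AllPairs.head (AllPairs.tail (proj₁ (proj₂ (AllPairs-++⁻ (a ∷ as) u))))) v∈ (sym (trans e fx)))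
      (upd-other {g} λ e → unique-separate (a ∷ as) u (here refl) (there (here refl)) (trans e fx)) c₂)

  insert-chain : ∀ {a} as {x} bs {y} → Unique (a ∷ as ++ x ∷ bs) → y ≡ headOr a bs → Chain f g a (as ++ bs) a →
    Chain (upd (upd f (g y) x) x y) (upd (upd g x (g y)) y x) a (as ++ x ∷ bs) a
  insert-chain {a} as {x} bs {y} u refl c = Chain-++⁺ as
    (Chain-retarget as u₁
      (λ v∈ v≢ → trans (upd-other {upd f (g y) x} (≢x v∈)) (upd-other {f} λ e → v≢ (trans e (Chain-last as (proj₁ (cut bs c))))))
      (trans (upd-other {upd f (g y) x} (≢x (lastOf-∈ a as))) (upd-same {f} (sym (Chain-last as (proj₁ (cut bs c))))))
      (λ v∈ → trans (upd-other {upd g x (g y)} (y∉as bs u v∈)) (upd-other {g} (≢x (there v∈))))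
      (trans (upd-other {upd g x (g y)} (x≢y bs u)) (trans (upd-same {g} {x} refl) (Chain-last as (proj₁ (cut bs c)))))
      (proj₁ (cut bs c)))
    (rest bs u refl c)
    where
    u₁ = proj₁ (AllPairs-++⁻ (a ∷ as) u)
    ≢x : ∀ {v} → v ∈ₗ a ∷ as → v ≢ x
    ≢x v∈ = unique-separate (a ∷ as) u v∈ (here refl)
    cut : ∀ bs → Chain f g a (as ++ bs) a → Chain f g a as (headOr a bs) × 𝟙
    cut []      c = subst (λ l → Chain f g a l a) (List.++-identityʳ as) c , tt
    cut (y ∷ _) c = proj₁ (Chain-++⁻ as c) , tt
    y∉as : ∀ bs → Unique (a ∷ as ++ x ∷ bs) → ∀ {v} → v ∈ₗ as → v ≢ headOr a bs
    y∉as []      u v∈ e = All.lookup (AllPairs.head u₁) v∈ (sym e)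
    y∉as (_ ∷ _) u v∈   = unique-separate (a ∷ as) u (there v∈) (there (here refl))
    x≢y : ∀ bs → Unique (a ∷ as ++ x ∷ bs) → x ≢ headOr a bs
    x≢y []      u e = unique-separate (a ∷ as) u (here refl) (here refl) (sym e)
    x≢y (_ ∷ _) u   = All.lookup (AllPairs.head (proj₁ (proj₂ (AllPairs-++⁻ (a ∷ as) u)))) (here refl)
    rest : ∀ bs → Unique (a ∷ as ++ x ∷ bs) → ∀ {y} → y ≡ headOr a bs → Chain f g a (as ++ bs) a →
      Chain (upd (upd f (g y) x) x y) (upd (upd g x (g y)) y x) x bs a
    rest []       u refl c = upd-same {upd f (g a) x} {x} refl , upd-same {upd g x (g a)} {a} refl
    rest (y ∷ bs) u refl c = (upd-same {upd f (g y) x} {x} refl , upd-same {upd g x (g y)} {y} refl) ,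
      Chain-cong bs
        (λ v∈ → trans (upd-other {upd f (g y) x} (x∉ v∈ ∘ sym)) (upd-other {f} λ e →
          unique-separate (a ∷ as) u (lastOf-∈ a as) (there v∈) (sym (trans e (Chain-last as (proj₁ (Chain-++⁻ as c)))))))
        (λ v∈ → trans (upd-other {upd g x (g y)} (y∉ v∈ ∘ sym)) (upd-other {g} (x∉ (there v∈) ∘ sym)))
        (trans (upd-other {upd g x (g y)} (unique-separate (a ∷ as) u (here refl) (there (here refl))))
               (upd-other {g} (≢x (here refl))))
        (proj₂ (Chain-++⁻ as c))
      where
      u₂ = proj₁ (proj₂ (AllPairs-++⁻ (a ∷ as) u))
      x∉ : ∀ {v} → v ∈ₗ y ∷ bs → x ≢ v
      x∉ v∈ = All.lookup (AllPairs.head u₂) v∈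
      y∉ : ∀ {v} → v ∈ₗ bs → y ≢ v
      y∉ v∈ = All.lookup (AllPairs.head (AllPairs.tail u₂)) v∈

code : ∀ {n} → Fin n → ℕ
code v = suc (toℕ v)

code-injective : ∀ {n} {u v : Fin n} → code u ≡ code v → u ≡ v
code-injective e = Fin.toℕ-injective (ℕ.suc-injective e)

headCode : ∀ {n} → List (Fin n) → ℕ
headCode []      = 0
headCode (v ∷ _) = code v

-- The list is closed up by the extra node 0.
Doubly : ∀ {n} → (ℕ → ℕ) → (ℕ → ℕ) → List (Fin n) → Set
Doubly f g l = Chain f g 0 (map code l) 0

module _ {n : ℕ} {f g : ℕ → ℕ} where

  codes-unique : ∀ {l : List (Fin n)} → Unique l → Unique (0 ∷ map code l)
  codes-unique u = All.map⁺ (All.tabulate λ _ ()) ∷ Unique.map⁺ code-injective u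

  Doubly-≗ : ∀ {f′ g′} (l : List (Fin n)) → (∀ j → f′ j ≡ f j) → (∀ j → g′ j ≡ g j) → Doubly f g l → Doubly f′ g′ l
  Doubly-≗ l ef eg = Chain-cong (map code l) (λ {u} _ → ef u) (λ {u} _ → eg u) (eg 0)

  Chain-head : ∀ {a} (l : List (Fin n)) → Chain f g a (map code l) 0 → f a ≡ headCode l
  Chain-head []      (p , _)       = p
  Chain-head (_ ∷ _) ((p , _) , _) = p

  Doubly-head : ∀ (l : List (Fin n)) → Doubly f g l → f 0 ≡ headCode l
  Doubly-head = Chain-head

  Doubly-next : ∀ as {x : Fin n} {bs} → Doubly f g (as ++ x ∷ bs) → f (code x) ≡ headCode bs
  Doubly-next as {x} {bs} d = Chain-head bs
    (proj₂ (Chain-++⁻ (map code as) (subst (λ l → Chain f g 0 l 0) (List.map-++ code as (x ∷ bs)) d)))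

  unlink : ∀ as {x : Fin n} bs {c} → c ≡ code x → Unique (as ++ x ∷ bs) → Doubly f g (as ++ x ∷ bs) →
    Doubly (upd f (g c) (f c)) (upd g (f c) (g c)) (as ++ bs)
  unlink as {x} bs {c} refl u d = subst (λ l → Chain _ _ 0 l 0) (sym (List.map-++ code as bs))
    (unlink-chain (map code as) (map code bs)
      (subst (λ l → Unique (0 ∷ l)) (List.map-++ code as (x ∷ bs)) (codes-unique u))
      (subst (λ l → Chain f g 0 l 0) (List.map-++ code as (x ∷ bs)) d))

  insert : ∀ as {x : Fin n} bs {c y} → c ≡ code x → y ≡ headCode bs → Unique (as ++ x ∷ bs) → Doubly f g (as ++ bs) →
    Doubly (upd (upd f (g y) c) c y) (upd (upd g c (g y)) y c) (as ++ x ∷ bs)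
  insert as {x} bs {c} {y} refl e u d = subst (λ l → Chain _ _ 0 l 0) (sym (List.map-++ code as (x ∷ bs)))
    (insert-chain (map code as) (map code bs)
      (subst (λ l → Unique (0 ∷ l)) (List.map-++ code as (x ∷ bs)) (codes-unique u)) (trans e (head bs))
      (subst (λ l → Chain f g 0 l 0) (List.map-++ code as bs) d))
    where
    head : ∀ (bs : List (Fin n)) → headCode bs ≡ headOr 0 (map code bs)
    head []      = refl
    head (_ ∷ _) = refl

-- Refinement of a partition in place.

module _ {n : ℕ} (ρ : Order n) where

  Ahead-Eq : ∀ 𝒮 {x y} → Eq 𝒮 x y → Ahead ρ 𝒮 x y → y ≺[ ρ ] x
  Ahead-Eq 𝒮 p (inj₁ g)        = ⊥-elim (Eq⇒¬Gt 𝒮 p g)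
  Ahead-Eq 𝒮 p (inj₂ (_ , lt)) = lt

  Ahead-squeeze : ∀ 𝒮 {x y z} → Eq 𝒮 x z → Ahead ρ 𝒮 x y → Ahead ρ 𝒮 y z → Eq 𝒮 x y
  Ahead-squeeze 𝒮 p (inj₂ (q , _)) _              = q
  Ahead-squeeze 𝒮 p (inj₁ g)       (inj₁ h)       = ⊥-elim (Eq⇒¬Gt 𝒮 p (Gt-trans 𝒮 g h))
  Ahead-squeeze 𝒮 p (inj₁ g)       (inj₂ (q , _)) = ⊥-elim (Eq⇒¬Gt 𝒮 p (Gt-Eq 𝒮 g q))

  Ahead-cong : ∀ {S S′ 𝒮 x y} → S x ≡ S′ x → S y ≡ S′ y → Ahead ρ (S ∷ 𝒮) x y → Ahead ρ (S′ ∷ 𝒮) x y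
  Ahead-cong ex ey (inj₁ (inj₁ g))           = inj₁ (inj₁ g)
  Ahead-cong ex ey (inj₁ (inj₂ (p , a , b))) = inj₁ (inj₂ (p , trans (sym ex) a , trans (sym ey) b))
  Ahead-cong ex ey (inj₂ ((p , e) , lt))     = inj₂ ((p , trans (sym ex) (trans e ey)) , lt)

  -- The vertices of l in the order of 𝒮: a doubly linked list in arrays 13 and 14,
  -- the numbers of their classes in array 15, the first vertex of each class in
  -- array 16.  Numbers of classes are taken from the counter 27.  Array 17 maps
  -- a class to the class that was most recently split off.
  record PartitionArrays (𝒮 : List (Fin n → Bool)) (l : List (Fin n)) (nxt prv cls fst spl : ℕ → ℕ) (fr : ℕ) : Set where
    field
      unique : Unique l
      doubly : Doubly (nxt) (prv) l
      sorted : AllPairs (Ahead ρ 𝒮) l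
      cls⇒   : ∀ {a b} → a ∈ₗ l → b ∈ₗ l → cls (toℕ a) ≡ cls (toℕ b) → Eq 𝒮 a b
      cls⇐   : ∀ {a b} → a ∈ₗ l → b ∈ₗ l → Eq 𝒮 a b → cls (toℕ a) ≡ cls (toℕ b)
      bound  : ∀ {a} → a ∈ₗ l → cls (toℕ a) < fr
      -- In a sorted list the first vertex of a class is its last one in `ρ`. This description
      -- mentions no positions in the list and nothing about numbers whose class is empty.
      first  : ∀ {z} → z ∈ₗ l → (∀ {y} → y ∈ₗ l → cls (toℕ y) ≡ cls (toℕ z) → y ≼[ ρ ] z) →
               fst (cls (toℕ z)) ≡ code z
      -- Stated for every `c`, so that stale entries and entries never written are alike recognised
      -- as older than a round that starts with counter `fr`.
      fresh  : ∀ c → spl c < fr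

  Partition : List (Fin n → Bool) → List (Fin n) → Store → Set
  Partition 𝒮 l M = PartitionArrays 𝒮 l (M 13) (M 14) (M 15) (M 16) (M 17) (M 27 0)

  Partition-cong : ∀ {S S′ 𝒮 l} M → (∀ {a} → a ∈ₗ l → S a ≡ S′ a) → Partition (S ∷ 𝒮) l M → Partition (S′ ∷ 𝒮) l M
  Partition-cong M e P = record
    { unique = unique ; doubly = doubly
    ; sorted = AllPairs-map∈ (λ x∈ y∈ → Ahead-cong (e x∈) (e y∈)) sorted
    ; cls⇒ = λ a∈ b∈ eq → proj₁ (cls⇒ a∈ b∈ eq) , trans (sym (e a∈)) (trans (proj₂ (cls⇒ a∈ b∈ eq)) (e b∈))
    ; cls⇐ = λ a∈ b∈ (p , q) → cls⇐ a∈ b∈ (p , trans (e a∈) (trans q (sym (e b∈))))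
    ; bound = bound ; first = first ; fresh = fresh }
    where open PartitionArrays P

popFirst : List Assignment
popFirst =
    30 := 13 ⟦ lit 0 ⟧
  ∷ 25 := dec (var 30)
  ∷ 31 := 14 ⟦ var 30 ⟧
  ∷ 32 := 13 ⟦ var 30 ⟧
  ∷ 13 ⟨ var 31 ⟩:= var 32
  ∷ 14 ⟨ var 32 ⟩:= var 31
  -- If the removed vertex was the last of its class, this entry becomes meaningless; the invariant
  -- only speaks of classes with members.
  ∷ 16 ⟨ 15 ⟦ var 25 ⟧ ⟩:= 13 ⟦ lit 0 ⟧
  ∷ []

module _ {n : ℕ} {ρ : Order n} where

  -- Within a sorted list, the classes are contiguous.
  head-of-class : ∀ {𝒮 x l z} (cls : Fin n → ℕ) → AllPairs (Ahead ρ 𝒮) (x ∷ l) → z ∈ₗ l → Eq 𝒮 x z →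
    (∀ {y} → y ∈ₗ l → Eq 𝒮 x y → cls y ≡ cls z) →
    (∀ {y} → y ∈ₗ l → cls y ≡ cls z → y ≼[ ρ ] z) → headCode l ≡ code z
  head-of-class cls _ (here refl) p same max = refl
  head-of-class {𝒮} {x} {h ∷ l} {z} cls ((x<h ∷ _) ∷ h< ∷ _) (there z∈) p same max =
    ⊥-elim (ℕ.<⇒≱ (Ahead-Eq ρ 𝒮 (Eq-trans 𝒮 (Eq-sym 𝒮 x~h) p) (All.lookup h< z∈)) (max (here refl) (same (here refl) x~h)))
    where x~h = Ahead-squeeze ρ 𝒮 p x<h (All.lookup h< z∈)

  popFirst-run : ∀ {𝒮 x l} M → Partition ρ 𝒮 (x ∷ l) M →
    Partition ρ 𝒮 l (run popFirst M) × run popFirst M 25 0 ≡ toℕ x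
  popFirst-run {𝒮} {x} {l} M P = record
    { unique = AllPairs.tail unique
    ; doubly = doubly′
    ; sorted = AllPairs.tail sorted
    ; cls⇒ = λ a∈ b∈ → cls⇒ (there a∈) (there b∈)
    ; cls⇐ = λ a∈ b∈ → cls⇐ (there a∈) (there b∈)
    ; bound = bound ∘ there
    ; first = first′
    ; fresh = fresh } , at-x
    where
    open PartitionArrays P
    c = M 13 0
    at-head : c ≡ code x
    at-head = Doubly-head {g = M 14} (x ∷ l) doubly
    at-x : pred c ≡ toℕ x
    at-x = cong pred at-head
    doubly′ : Doubly (upd (M 13) (M 14 c) (M 13 c)) (upd (M 14) (M 13 c) (M 14 c)) l
    doubly′ = unlink [] l at-head unique doubly
    first′ : ∀ {z} → z ∈ₗ l → (∀ {y} → y ∈ₗ l → M 15 (toℕ y) ≡ M 15 (toℕ z) → y ≼[ ρ ] z) →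
      upd (M 16) (M 15 (pred c)) (upd (M 13) (M 14 c) (M 13 c) 0) (M 15 (toℕ z)) ≡ code z
    first′ {z} z∈ max with M 15 (toℕ z) ℕ.≟ M 15 (toℕ x)
    ... | yes e = trans (upd-same {M 16} (trans e (cong (M 15) (sym at-x))))
      (trans (Doubly-head {g = upd (M 14) (M 13 c) (M 14 c)} l doubly′)
      (head-of-class (M 15 ∘ toℕ) sorted z∈ (cls⇒ (here refl) (there z∈) (sym e))
        (λ y∈ p → trans (sym (cls⇐ (here refl) (there y∈) p)) (sym e)) max))
    ... | no ne = trans (upd-other {M 16} (λ e → ne (trans e (cong (M 15) at-x))))
      (first (there z∈) λ { (here refl) e → ⊥-elim (ne (sym e)) ; (there y∈) e → max y∈ e })

  -- The state while the classes are being refined by S, where κ v is the class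
  -- of v before, and all classes from rs on are new.
  record RoundArrays (𝒮 : List (Fin n → Bool)) (κ : Fin n → ℕ) (rs : ℕ) (S : Fin n → Bool) (l : List (Fin n))
    (nxt prv cls fst spl : ℕ → ℕ) (fr start : ℕ) : Set where
    field
      unique   : Unique l
      doubly   : Doubly (nxt) (prv) l
      sorted   : AllPairs (Ahead ρ (S ∷ 𝒮)) l
      κ⇒       : ∀ {a b} → a ∈ₗ l → b ∈ₗ l → κ a ≡ κ b → Eq 𝒮 a b
      κ⇐       : ∀ {a b} → a ∈ₗ l → b ∈ₗ l → Eq 𝒮 a b → κ a ≡ κ b
      κ<       : ∀ {a} → a ∈ₗ l → κ a < rs
      round    : start ≡ rs
      rs≤      : rs ≤ fr
      outside  : ∀ {a} → a ∈ₗ l → S a ≡ false → cls (toℕ a) ≡ κ a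
      inside   : ∀ {a} → a ∈ₗ l → S a ≡ true → cls (toℕ a) ≡ spl (κ a) × rs ≤ spl (κ a)
      occupied : ∀ {c} → rs ≤ spl c → ∃ λ b → b ∈ₗ l × κ b ≡ c × S b ≡ true
      injects  : ∀ {c d} → rs ≤ spl c → spl c ≡ spl d → c ≡ d
      first    : ∀ {z} → z ∈ₗ l → (∀ {y} → y ∈ₗ l → cls (toℕ y) ≡ cls (toℕ z) → y ≼[ ρ ] z) →
                 fst (cls (toℕ z)) ≡ code z
      fresh    : ∀ c → spl c < fr

  Round : List (Fin n → Bool) → (Fin n → ℕ) → ℕ → (Fin n → Bool) → List (Fin n) → Store → Set
  Round 𝒮 κ rs S l M = RoundArrays 𝒮 κ rs S l (M 13) (M 14) (M 15) (M 16) (M 17) (M 27 0) (M 28 0)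

  Round-start : ∀ {𝒮 l} M → Partition ρ 𝒮 l M → M 28 0 ≡ M 27 0 →
    Round 𝒮 (M 15 ∘ toℕ) (M 27 0) (λ _ → false) l M
  Round-start M P e = record
    { unique = unique ; doubly = doubly
    ; sorted = AllPairs.map (Sum.map inj₁ (λ (p , lt) → (p , refl) , lt)) sorted
    ; κ⇒ = cls⇒ ; κ⇐ = cls⇐ ; κ< = bound ; round = e ; rs≤ = ℕ.≤-refl
    ; outside = λ _ _ → refl ; inside = λ _ ()
    ; occupied = λ {c} le → ⊥-elim (ℕ.<⇒≱ (fresh c) le)
    ; injects = λ {c} le _ → ⊥-elim (ℕ.<⇒≱ (fresh c) le)
    ; first = first ; fresh = fresh }
    where open PartitionArrays P

  -- Members of `S` carry numbers from `rs` on and the others numbers below `rs`, so equal numbers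
  -- imply equal membership. A class contained in `S` is merely renumbered.
  Round-end : ∀ {𝒮 κ rs S l} M → Round 𝒮 κ rs S l M → Partition ρ (S ∷ 𝒮) l M
  Round-end {S = S} {l} M R = record
    { unique = unique ; doubly = doubly ; sorted = sorted
    ; cls⇒ = λ a∈ b∈ → to a∈ b∈ ; cls⇐ = λ a∈ b∈ → from a∈ b∈
    ; bound = λ a∈ → bnd a∈ ; first = first ; fresh = fresh }
    where
    open RoundArrays R
    bnd : ∀ {a} → a ∈ₗ l → M 15 (toℕ a) < M 27 0
    bnd {a} a∈ with S a in e
    ... | true  = subst (_< M 27 0) (sym (proj₁ (inside a∈ e))) (fresh _)
    ... | false = subst (_< M 27 0) (sym (outside a∈ e)) (ℕ.<-≤-trans (κ< a∈) rs≤)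
    to : ∀ {a b} → a ∈ₗ l → b ∈ₗ l → M 15 (toℕ a) ≡ M 15 (toℕ b) → Eq (S ∷ _) a b
    to {a} {b} a∈ b∈ e with S a in ea | S b in eb
    ... | true  | true  = κ⇒ a∈ b∈ (injects (proj₂ (inside a∈ ea))
                            (trans (sym (proj₁ (inside a∈ ea))) (trans e (proj₁ (inside b∈ eb))))) , refl
    ... | false | false = κ⇒ a∈ b∈ (trans (sym (outside a∈ ea)) (trans e (outside b∈ eb))) , refl
    ... | true  | false = ⊥-elim (ℕ.<⇒≱ (κ< b∈) (subst (_ ≤_)
                            (trans (sym (proj₁ (inside a∈ ea))) (trans e (outside b∈ eb))) (proj₂ (inside a∈ ea))))
    ... | false | true  = ⊥-elim (ℕ.<⇒≱ (κ< a∈) (subst (_ ≤_)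
                            (trans (sym (proj₁ (inside b∈ eb))) (trans (sym e) (outside a∈ ea))) (proj₂ (inside b∈ eb))))
    from : ∀ {a b} → a ∈ₗ l → b ∈ₗ l → Eq (S ∷ _) a b → M 15 (toℕ a) ≡ M 15 (toℕ b)
    from {a} {b} a∈ b∈ (p , e) with S a in ea | S b in eb
    ... | true  | true  = trans (proj₁ (inside a∈ ea)) (trans (cong (M 17) (κ⇐ a∈ b∈ p)) (sym (proj₁ (inside b∈ eb))))
    ... | false | false = trans (outside a∈ ea) (trans (κ⇐ a∈ b∈ p) (sym (outside b∈ eb)))
    ... | true  | false with () ← e
    ... | false | true  with () ← e

loadClass : List Assignment
loadClass = 29 := 15 ⟦ var 26 ⟧ ∷ []

-- The vertex that opens a class remains its first one: adjacency lists run downwards in `ρ`, so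
-- those that follow in this round come earlier in `ρ`.
newClass : List Assignment
newClass =
    17 ⟨ var 29 ⟩:= var 27
  ∷ 16 ⟨ var 27 ⟩:= inc (var 26)
  ∷ 27 := inc (var 27)
  ∷ []

openClass : Program
openClass = block loadClass ⨾ branch ((17 ⟦ var 29 ⟧) ⋖ var 28) (block newClass) skip

enterClass : List Assignment
enterClass =
    30 := inc (var 26)
  ∷ 33 := 16 ⟦ var 29 ⟧
  ∷ 15 ⟨ var 26 ⟩:= 17 ⟦ var 29 ⟧
  ∷ 19 ⟨ var 26 ⟩:= var 25
  ∷ []

advanceFirst : List Assignment
advanceFirst = 16 ⟨ var 29 ⟩:= 13 ⟦ var 30 ⟧ ∷ []

-- Unlinks node 30 and inserts it before node 33.
moveNode : List Assignment
moveNode =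
    31 := 14 ⟦ var 30 ⟧
  ∷ 32 := 13 ⟦ var 30 ⟧
  ∷ 13 ⟨ var 31 ⟩:= var 32
  ∷ 14 ⟨ var 32 ⟩:= var 31
  ∷ 31 := 14 ⟦ var 33 ⟧
  ∷ 13 ⟨ var 31 ⟩:= var 30
  ∷ 14 ⟨ var 30 ⟩:= var 31
  ∷ 13 ⟨ var 30 ⟩:= var 33
  ∷ 14 ⟨ var 33 ⟩:= var 30
  ∷ []

-- When the vertex already heads what is left of its class, the list stays as it is and only the
-- boundary between the two parts moves.
relocate : Program
relocate = branch (var 33 ≐ var 30) (block advanceFirst) (block moveNode)

move : Program
move = openClass ⨾ block enterClass ⨾ relocate

add : ∀ {n} → Fin n → (Fin n → Bool) → Fin n → Bool
add x S a = if does (a Fin.≟ x) then true else S a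

add-same : ∀ {n} (x : Fin n) {S} → add x S x ≡ true
add-same x {S} = cong (λ b → if b then true else S x) (dec-true (x Fin.≟ x) refl)

add-other : ∀ {n} {x : Fin n} {S a} → a ≢ x → add x S a ≡ S a
add-other {x = x} {S} {a} ne = cong (λ b → if b then true else S a) (dec-false (a Fin.≟ x) ne)

split-first : ∀ {A : Set} {P : A → Set} → (∀ a → Dec (P a)) → ∀ {x l} → x ∈ₗ l → P x →
  ∃ λ as → ∃ λ y → ∃ λ bs → l ≡ as ++ y ∷ bs × P y × (∀ {a} → a ∈ₗ as → ¬ P a)
split-first P? {l = y ∷ l} x∈ Px with P? y
... | yes Py = [] , y , l , refl , Py , λ ()
split-first P? (here refl) Px | no ¬Py = ⊥-elim (¬Py Px)
split-first P? (there x∈)  Px | no ¬Py with split-first P? x∈ Px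
... | as , y , bs , refl , Py , none = _ ∷ as , y , bs , refl , Py , λ { (here refl) → ¬Py ; (there a∈) → none a∈ }

module Move {n : ℕ} {ρ : Order n} {𝒮 : List (Fin n → Bool)} {κ : Fin n → ℕ} {rs : ℕ} {S : Fin n → Bool} {l : List (Fin n)}
  (M : Store) (R : Round {ρ = ρ} 𝒮 κ rs S l M) {x : Fin n} (x∈ : x ∈ₗ l) (Sx : S x ≡ false)
  (largest : ∀ {b} → b ∈ₗ l → S b ≡ true → x ≺[ ρ ] b) (at-x : M 26 0 ≡ toℕ x) where
  open RoundArrays R

  c : ℕ
  c = κ x

  class-x : M 15 (M 26 0) ≡ c
  class-x = trans (cong (M 15) at-x) (outside x∈ Sx)

  record Opened (M₁ : Store) : Set where
    field
      framed : M₁ ≐⟨ openClass ⟩ M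
      at-c   : M₁ 29 0 ≡ c
      new≥   : rs ≤ M₁ 17 c
      other  : ∀ {d} → d ≢ c → M₁ 17 d ≡ M 17 d
      fresh₁ : ∀ d → M₁ 17 d < M₁ 27 0
      grow   : M 27 0 ≤ M₁ 27 0
      inj₀   : ∀ {d e} → rs ≤ M₁ 17 d → M₁ 17 d ≡ M₁ 17 e → d ≡ e
      kept   : ∀ {e} → e ≢ M₁ 17 c → M₁ 16 e ≡ M 16 e
      origin : (M 17 c < rs × M₁ 16 (M₁ 17 c) ≡ code x × M 27 0 ≤ M₁ 17 c) ⊎
               (rs ≤ M 17 c × M₁ 17 c ≡ M 17 c × M₁ 16 (M₁ 17 c) ≡ M 16 (M₁ 17 c))

  openClass-wp : wp openClass 7 Opened M
  openClass-wp = wp-framed openClass (wp-seq (wp-block loadClass (wp-branch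
      (λ e → wp-block newClass λ f → record
        { framed = f
        ; at-c   = class-x
        ; new≥   = subst (rs ≤_) (sym same) rs≤
        ; other  = λ d≢ → upd-other {M 17} λ e → d≢ (trans e class-x)
        ; fresh₁ = fresh₁
        ; grow   = ℕ.n≤1+n _
        ; inj₀   = inj₀ (new< e)
        ; kept   = λ ne → upd-other {M 16} λ e → ne (trans e (sym same))
        ; origin = inj₁ (new< e , trans (upd-same {M 16} same) (cong suc at-x) , ℕ.≤-reflexive (sym same))
        })
      (λ e → _ , _ , skip , s≤s z≤n , λ f → record
        { framed = f
        ; at-c   = class-x
        ; new≥   = old≥ e
        ; other  = λ _ → refl
        ; fresh₁ = fresh
        ; grow   = ℕ.≤-refl
        ; inj₀   = injects
        ; kept   = λ _ → refl
        ; origin = inj₂ (old≥ e , refl , refl)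
        }))))
    where
    spl = upd (M 17) (M 15 (M 26 0)) (M 27 0)
    same : spl c ≡ M 27 0
    same = upd-same {M 17} (sym class-x)
    new< : (M 17 (M 15 (M 26 0)) <ᵇ M 28 0) ≡ true → M 17 c < rs
    new< e = subst₂ _<_ (cong (M 17) class-x) round (<ᵇ-true⁻ {M 17 (M 15 (M 26 0))} e)
    old≥ : (M 17 (M 15 (M 26 0)) <ᵇ M 28 0) ≡ false → rs ≤ M 17 c
    old≥ e = subst₂ _≤_ round (cong (M 17) class-x) (<ᵇ-false⁻ {M 17 (M 15 (M 26 0))} e)
    other′ : ∀ {d} → d ≢ c → spl d ≡ M 17 d
    other′ d≢ = upd-other {M 17} λ e → d≢ (trans e class-x)
    fresh₁ : ∀ d → spl d < suc (M 27 0)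
    fresh₁ d with d ℕ.≟ c
    ... | yes refl = s≤s (ℕ.≤-reflexive same)
    ... | no d≢    = subst (_< suc (M 27 0)) (sym (other′ d≢)) (ℕ.m≤n⇒m≤1+n (fresh d))
    inj₀ : M 17 c < rs → ∀ {d e} → rs ≤ spl d → spl d ≡ spl e → d ≡ e
    inj₀ c<rs {d} {e} le eq with d ℕ.≟ c | e ℕ.≟ c
    ... | yes p | yes q = trans p (sym q)
    ... | yes refl | no e≢ = ⊥-elim (ℕ.<⇒≢ (fresh e) (trans (sym (other′ e≢)) (trans (sym eq) same)))
    ... | no d≢ | yes refl = ⊥-elim (ℕ.<⇒≢ (fresh d) (trans (sym (other′ d≢)) (trans eq same)))
    ... | no d≢ | no e≢ = injects (subst (rs ≤_) (other′ d≢) le) (trans (sym (other′ d≢)) (trans eq (other′ e≢)))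

  Open : Fin n → Set
  Open a = κ a ≡ c × S a ≡ false

  class-open : ∀ {a} → a ∈ₗ l → M 15 (toℕ a) ≡ c → Open a
  class-open {a} a∈ e with S a in eq
  ... | false = trans (sym (outside a∈ eq)) e , refl
  ... | true  = ⊥-elim (ℕ.<⇒≱ (κ< x∈) (subst (rs ≤_) (trans (sym (proj₁ (inside a∈ eq))) e) (proj₂ (inside a∈ eq))))

  open-class : ∀ {a} → a ∈ₗ l → Open a → M 15 (toℕ a) ≡ c
  open-class a∈ (e , Sa) = trans (outside a∈ Sa) e

  open-Eq : ∀ {a b} → a ∈ₗ l → b ∈ₗ l → Open a → Open b → Eq (S ∷ 𝒮) a b
  open-Eq a∈ b∈ (p , Sa) (q , Sb) = κ⇒ a∈ b∈ (trans p (sym q)) , trans Sa (sym Sb)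

  Eq-open : ∀ {a b} → a ∈ₗ l → b ∈ₗ l → Open a → Eq (S ∷ 𝒮) a b → Open b
  Eq-open a∈ b∈ (p , Sa) (e , f) = trans (sym (κ⇐ a∈ b∈ e)) p , trans (sym f) Sa

  -- x moves from behind ms to the front of the vertices of its class that
  -- are not in S.
  record Place : Set where
    field
      as ms bs : List (Fin n)
      shape    : l ≡ as ++ ms ++ x ∷ bs
      closed   : ∀ {a} → a ∈ₗ as → ¬ Open a
      opened   : ∀ {a} → a ∈ₗ ms → Open a
      first-y  : M 16 c ≡ headCode (ms ++ x ∷ [])

  -- The first vertex `y` of the list that is still in the old class is the last such vertex in `ρ`,
  -- so array 16 names it. Whatever stands between `y` and `x` is squeezed between equivalent
  -- vertices and belongs to the same class.
  place : Place
  place with split-first (λ a → (κ a ℕ.≟ c) ×-dec (S a Bool.≟ false)) x∈ (refl , Sx)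
  ... | as , y , bs₀ , shape₀ , Py , closed
    with ∈ₗ.∈-++⁻ as (subst (x ∈ₗ_) shape₀ x∈) | AllPairs-++⁻ as (subst (AllPairs _) shape₀ sorted)
  ...   | inj₁ x∈as | _ = ⊥-elim (closed x∈as (refl , Sx))
  ...   | inj₂ x∈y∷ | _ , y< ∷ bs< , _ = go x∈y∷ (trans (cong (M 16) (sym (open-class y∈ Py))) (first y∈ y-max))
    where
    y∈ : y ∈ₗ l
    y∈ = subst (y ∈ₗ_) (sym shape₀) (∈ₗ.∈-++⁺ʳ as (here refl))
    ∈l : ∀ {b} → b ∈ₗ y ∷ bs₀ → b ∈ₗ l
    ∈l b∈ = subst (_ ∈ₗ_) (sym shape₀) (∈ₗ.∈-++⁺ʳ as b∈)
    y-max : ∀ {b} → b ∈ₗ l → M 15 (toℕ b) ≡ M 15 (toℕ y) → b ≼[ ρ ] y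
    y-max {b} b∈ e with ∈ₗ.∈-++⁻ as (subst (b ∈ₗ_) shape₀ b∈) | class-open b∈ (trans e (open-class y∈ Py))
    ... | inj₁ b∈as | Pb = ⊥-elim (closed b∈as Pb)
    ... | inj₂ (here refl) | _ = ℕ.≤-refl
    ... | inj₂ (there b∈bs) | Pb = ℕ.<⇒≤ (Ahead-Eq ρ (S ∷ 𝒮) (open-Eq y∈ b∈ Py Pb) (All.lookup y< b∈bs))
    go : x ∈ₗ y ∷ bs₀ → M 16 c ≡ code y → Place
    go (here refl) e = record
      { as = as ; ms = [] ; bs = bs₀ ; shape = shape₀ ; closed = closed ; opened = λ () ; first-y = e }
    go (there x∈bs) e with ∈ₗ.∈-∃++ x∈bs
    ... | ms , bs , refl = record
      { as = as ; ms = y ∷ ms ; bs = bs ; shape = shape₀ ; closed = closed ; first-y = e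
      ; opened = λ { (here refl) → Py
                   ; (there a∈) → Eq-open y∈ (∈l (there (∈ₗ.∈-++⁺ˡ a∈))) Py (Ahead-squeeze ρ (S ∷ 𝒮)
                       (open-Eq y∈ x∈ Py (refl , Sx)) (All.lookup y< (∈ₗ.∈-++⁺ˡ a∈))
                       (proj₂ (proj₂ (AllPairs-++⁻ ms bs<)) a∈ (here refl))) } }

  module Placed (pl : Place) where
    open Place pl

    l′ : List (Fin n)
    l′ = as ++ x ∷ ms ++ bs

    l′↭l : l′ ↭ l
    l′↭l = ↭-trans (↭.++⁺ˡ as (↭-sym (↭.shift x ms bs))) (↭-reflexive (sym shape))

    ∈⁺ : ∀ {a} → a ∈ₗ l → a ∈ₗ l′
    ∈⁺ = ↭.∈-resp-↭ (↭-sym l′↭l)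

    ∈⁻ : ∀ {a} → a ∈ₗ l′ → a ∈ₗ l
    ∈⁻ = ↭.∈-resp-↭ l′↭l

    S′ : Fin n → Bool
    S′ = add x S

    unique-shape : Unique (as ++ ms ++ x ∷ bs)
    unique-shape = subst Unique shape unique

    sorted-shape : AllPairs (Ahead ρ (S ∷ 𝒮)) (as ++ ms ++ x ∷ bs)
    sorted-shape = subst (AllPairs (Ahead ρ (S ∷ 𝒮))) shape sorted

    x∉as : ∀ {a} → a ∈ₗ as → a ≢ x
    x∉as a∈ refl = closed a∈ (refl , Sx)

    x∉ms : ∀ {a} → a ∈ₗ ms → a ≢ x
    x∉ms a∈ = proj₂ (proj₂ (AllPairs-++⁻ ms (proj₁ (proj₂ (AllPairs-++⁻ as unique-shape))))) a∈ (here refl)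

    x∉bs : ∀ {a} → a ∈ₗ bs → a ≢ x
    x∉bs a∈ refl with proj₁ (proj₂ (AllPairs-++⁻ ms (proj₁ (proj₂ (AllPairs-++⁻ as unique-shape)))))
    ... | x∉ ∷ _ = All.lookup x∉ a∈ refl

    unique-as : Unique (as ++ x ∷ ms ++ bs)
    unique-as with AllPairs-++⁻ as unique-shape
    ... | u₁ , u₂ , d with AllPairs-++⁻ ms u₂
    ...   | u₃ , _ ∷ u₄ , e = AllPairs-++⁺ u₁
      (All.tabulate (λ {a} a∈ eq → case ∈ₗ.∈-++⁻ ms a∈ of λ
         { (inj₁ a∈ms) → x∉ms a∈ms (sym eq) ; (inj₂ a∈bs) → x∉bs a∈bs (sym eq) })
       ∷ AllPairs-++⁺ u₃ u₄ (λ a∈ b∈ → e a∈ (there b∈)))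
      (λ { a∈ (here refl) → x∉as a∈
         ; a∈ (there b∈) → d a∈ (case ∈ₗ.∈-++⁻ ms b∈ of λ
            { (inj₁ b∈ms) → ∈ₗ.∈-++⁺ˡ b∈ms ; (inj₂ b∈bs) → ∈ₗ.∈-++⁺ʳ ms (there b∈bs) }) })

    moved : ∀ {a b} → a ≢ x → b ≢ x → Ahead ρ (S ∷ 𝒮) a b → Ahead ρ (S′ ∷ 𝒮) a b
    moved {a} {b} a≢ b≢ = Ahead-cong ρ {S} {S′} (sym (add-other {x = x} {S} a≢)) (sym (add-other {x = x} {S} b≢))

    sorted′ : AllPairs (Ahead ρ (S′ ∷ 𝒮)) l′
    sorted′ with AllPairs-++⁻ as sorted-shape
    ... | s₁ , s₂ , d with AllPairs-++⁻ ms s₂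
    ...   | s₃ , x< ∷ s₄ , e = AllPairs-++⁺ (AllPairs-map∈ (λ a∈ b∈ → moved (x∉as a∈) (x∉as b∈)) s₁)
      (All.tabulate behind ∷ AllPairs-++⁺ (AllPairs-map∈ (λ a∈ b∈ → moved (x∉ms a∈) (x∉ms b∈)) s₃)
                                          (AllPairs-map∈ (λ a∈ b∈ → moved (x∉bs a∈) (x∉bs b∈)) s₄)
                                          (λ a∈ b∈ → moved (x∉ms a∈) (x∉bs b∈) (e a∈ (there b∈))))
      (λ { a∈ (here refl) → in-front a∈ (d a∈ (∈ₗ.∈-++⁺ʳ ms (here refl)))
         ; a∈ (there b∈) → case ∈ₗ.∈-++⁻ ms b∈ of λ
           { (inj₁ b∈ms) → moved (x∉as a∈) (x∉ms b∈ms) (d a∈ (∈ₗ.∈-++⁺ˡ b∈ms))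
           ; (inj₂ b∈bs) → moved (x∉as a∈) (x∉bs b∈bs) (d a∈ (∈ₗ.∈-++⁺ʳ ms (there b∈bs))) } })
      where
      as∈ : ∀ {a} → a ∈ₗ as → a ∈ₗ l
      as∈ a∈ = subst (_ ∈ₗ_) (sym shape) (∈ₗ.∈-++⁺ˡ a∈)
      in-front : ∀ {a} → a ∈ₗ as → Ahead ρ (S ∷ 𝒮) a x → Ahead ρ (S′ ∷ 𝒮) a x
      in-front a∈ (inj₁ (inj₁ g)) = inj₁ (inj₁ g)
      -- `a` left the class of `x` earlier in this round. Now that `x` follows, the two tie, and
      -- `largest` decides.
      in-front a∈ (inj₁ (inj₂ (p , Sa , _))) =
        inj₂ ((p , trans (add-other {x = x} {S} (x∉as a∈)) (trans Sa (sym (add-same x {S})))) , largest (as∈ a∈) Sa)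
      in-front a∈ (inj₂ ((p , e) , _)) = ⊥-elim (closed a∈ (κ⇐ (as∈ a∈) x∈ p , trans e Sx))
      behind : ∀ {b} → b ∈ₗ ms ++ bs → Ahead ρ (S′ ∷ 𝒮) x b
      behind {b} b∈ with ∈ₗ.∈-++⁻ ms b∈
      ... | inj₁ b∈ms = inj₁ (inj₂ (κ⇒ x∈ (subst (b ∈ₗ_) (sym shape) (∈ₗ.∈-++⁺ʳ as (∈ₗ.∈-++⁺ˡ b∈ms))) (sym (proj₁ (opened b∈ms))) ,
        add-same x {S} , trans (add-other {x = x} {S} (x∉ms b∈ms)) (proj₂ (opened b∈ms))))
      ... | inj₂ b∈bs = after (All.lookup x< b∈bs)
        where
        after : Ahead ρ (S ∷ 𝒮) x b → Ahead ρ (S′ ∷ 𝒮) x b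
        after (inj₁ (inj₁ g)) = inj₁ (inj₁ g)
        after (inj₁ (inj₂ (_ , Sx′ , _))) with () ← trans (sym Sx) Sx′
        after (inj₂ ((p , e) , _)) = inj₁ (inj₂ (p , add-same x {S} , trans (add-other {x = x} {S} (x∉bs b∈bs)) (trans (sym e) Sx)))

    record Moved (M₁ M₃ : Store) : Set where
      field
        doubly₃ : Doubly (M₃ 13) (M₃ 14) l′
        at-15   : ∀ j → M₃ 15 j ≡ upd (M 15) (toℕ x) (M₁ 17 c) j
        at-16   : (ms ≡ [] × (∀ j → M₃ 16 j ≡ upd (M₁ 16) c (headCode bs) j)) ⊎ (ms ≢ [] × (∀ j → M₃ 16 j ≡ M₁ 16 j))
        at-17   : ∀ j → M₃ 17 j ≡ M₁ 17 j
        at-27   : M₃ 27 0 ≡ M₁ 27 0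
        at-28   : M₃ 28 0 ≡ rs

    Moved⇒Round : ∀ {M₁ M₃} → Opened M₁ → Moved M₁ M₃ → Round {ρ = ρ} 𝒮 κ rs S′ l′ M₃
    Moved⇒Round {M₁} {M₃} O V = record
      { unique = unique-as
      ; doubly = doubly₃
      ; sorted = sorted′
      ; κ⇒ = λ a∈ b∈ → κ⇒ (∈⁻ a∈) (∈⁻ b∈)
      ; κ⇐ = λ a∈ b∈ → κ⇐ (∈⁻ a∈) (∈⁻ b∈)
      ; κ< = κ< ∘ ∈⁻
      ; round = at-28
      ; rs≤ = ℕ.≤-trans rs≤ (ℕ.≤-trans grow (ℕ.≤-reflexive (sym at-27)))
      ; outside = λ {a} a∈ S′a → case a Fin.≟ x of λ
          { (yes refl) → case trans (sym (add-same x {S})) S′a of λ ()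
          ; (no a≢) → trans (cls-other a≢) (outside (∈⁻ a∈) (trans (sym (add-other {x = x} {S} a≢)) S′a)) }
      ; inside = inside′
      ; occupied = occupied′
      ; injects = λ {d} {e} le eq → inj₀ (subst (rs ≤_) (at-17 d) le) (trans (sym (at-17 d)) (trans eq (at-17 e)))
      ; first = first′
      ; fresh = λ d → subst₂ _<_ (sym (at-17 d)) (sym at-27) (fresh₁ d)
      }
      where
      open Opened O
      open Moved V
      c′ : ℕ
      c′ = M₁ 17 c
      c≢c′ : c ≢ c′
      c≢c′ = ℕ.<⇒≢ (ℕ.<-≤-trans (κ< x∈) new≥)
      cls-x : M₃ 15 (toℕ x) ≡ c′
      cls-x = trans (at-15 (toℕ x)) (upd-same {M 15} {toℕ x} refl)
      cls-other : ∀ {a} → a ≢ x → M₃ 15 (toℕ a) ≡ M 15 (toℕ a)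
      cls-other a≢ = trans (at-15 _) (upd-other {M 15} (a≢ ∘ Fin.toℕ-injective))
      inside′ : ∀ {a} → a ∈ₗ l′ → S′ a ≡ true → M₃ 15 (toℕ a) ≡ M₃ 17 (κ a) × rs ≤ M₃ 17 (κ a)
      inside′ {a} a∈ S′a with a Fin.≟ x
      ... | yes refl = trans cls-x (sym (at-17 c)) , subst (rs ≤_) (sym (at-17 c)) new≥
      ... | no a≢ with inside (∈⁻ a∈) S′a
      ...   | e , le = trans (cls-other a≢) (trans e (sym spl)) , subst (rs ≤_) (sym spl) le
        where
        spl : M₃ 17 (κ a) ≡ M 17 (κ a)
        spl with κ a ℕ.≟ c | origin
        ... | no ne | _ = trans (at-17 _) (other ne)
        ... | yes p | inj₂ (_ , q , _) = trans (at-17 _) (trans (cong (M₁ 17) p) (trans q (cong (M 17) (sym p))))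
        ... | yes p | inj₁ (lt , _) = ⊥-elim (ℕ.<⇒≱ lt (subst (λ d → rs ≤ M 17 d) p le))
      occupied′ : ∀ {d} → rs ≤ M₃ 17 d → ∃ λ b → b ∈ₗ l′ × κ b ≡ d × S′ b ≡ true
      occupied′ {d} le with d ℕ.≟ c
      ... | yes refl = x , ∈⁺ x∈ , refl , add-same x {S}
      ... | no d≢ with occupied (subst (rs ≤_) (trans (at-17 d) (other d≢)) le)
      ...   | b , b∈ , κb , Sb = b , ∈⁺ b∈ , κb , trans (add-other {x = x} {S} λ { refl → case trans (sym Sx) Sb of λ () }) Sb
      bound : ∀ {a} → a ∈ₗ l → M 15 (toℕ a) < M 27 0
      bound = PartitionArrays.bound (Round-end {ρ = ρ} M R)
      at-16-other : ∀ {e} → e ≢ c → M₃ 16 e ≡ M₁ 16 e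
      at-16-other ne with at-16
      ... | inj₁ (_ , f) = trans (f _) (upd-other {M₁ 16} ne)
      ... | inj₂ (_ , f) = f _
      Max : Fin n → Set
      Max z = ∀ {y} → y ∈ₗ l′ → M₃ 15 (toℕ y) ≡ M₃ 15 (toℕ z) → y ≼[ ρ ] z
      first-new : Max x → M₃ 16 c′ ≡ code x
      first-new max with origin
      ... | inj₁ (_ , e , _) = trans (at-16-other (c≢c′ ∘ sym)) e
      -- The class was opened before, so it has a member that comes later in `ρ`, and `x` is not the
      -- vertex to be named.
      ... | inj₂ (le , e , _) with occupied le
      ...   | b , b∈ , κb , Sb = ⊥-elim (ℕ.<⇒≱ (largest b∈ Sb)
        (max (∈⁺ b∈) (trans (cls-other λ { refl → case trans (sym Sx) Sb of λ () })
          (trans (proj₁ (inside b∈ Sb)) (trans (cong (M 17) κb) (trans (sym e) (sym cls-x)))))))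
      first-kept : ∀ {z} → z ∈ₗ l → z ≢ x → Max z → M 15 (toℕ z) ≢ c → M₃ 16 (M 15 (toℕ z)) ≡ code z
      first-kept {z} z∈ z≢ max ne = trans (at-16-other ne) (trans kept′ (first z∈ λ {y} y∈ e →
          max (∈⁺ y∈) (trans (cls-other λ { refl → ne (trans (sym e) (outside x∈ Sx)) }) (trans e (sym (cls-other z≢))))))
        where
        kept′ : M₁ 16 (M 15 (toℕ z)) ≡ M 16 (M 15 (toℕ z))
        kept′ with M 15 (toℕ z) ℕ.≟ c′ | origin
        ... | no ne′ | _ = kept ne′
        ... | yes e | inj₁ (_ , _ , le) = ⊥-elim (ℕ.<⇒≱ (bound z∈) (subst (M 27 0 ≤_) (sym e) le))
        ... | yes e | inj₂ (_ , _ , q) = trans (cong (M₁ 16) e) (trans q (cong (M 16) (sym e)))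
      first-rest : ∀ {z} → z ∈ₗ l → z ≢ x → Max z → M 15 (toℕ z) ≡ c → M₃ 16 c ≡ code z
      first-rest {z} z∈ z≢ max zc with at-16
      ... | inj₂ (ms≢ , f) = trans (f c) (trans (kept c≢c′) (trans (cong (M 16) (sym zc)) (first z∈ max-l)))
        where
        max-l : ∀ {b} → b ∈ₗ l → M 15 (toℕ b) ≡ M 15 (toℕ z) → b ≼[ ρ ] z
        max-l {b} b∈ e with b Fin.≟ x
        ... | no b≢ = max (∈⁺ b∈) (trans (cls-other b≢) (trans e (sym (cls-other z≢))))
        ... | yes refl = behind-first ms≢ (λ a∈ → subst (_ ∈ₗ_) (sym shape) (∈ₗ.∈-++⁺ʳ as (∈ₗ.∈-++⁺ˡ a∈)))
            opened (λ a∈ → x∉ms a∈) (λ a∈ → proj₂ (proj₂ (AllPairs-++⁻ ms (proj₁ (proj₂ (AllPairs-++⁻ as sorted-shape))))) a∈ (here refl))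
          where
          behind-first : ∀ {ys} → ys ≢ [] → (∀ {a} → a ∈ₗ ys → a ∈ₗ l) → (∀ {a} → a ∈ₗ ys → Open a) →
            (∀ {a} → a ∈ₗ ys → a ≢ x) → (∀ {a} → a ∈ₗ ys → Ahead ρ (S ∷ 𝒮) a x) → x ≼[ ρ ] z
          behind-first {[]}    ne _ _ _ _ = ⊥-elim (ne refl)
          behind-first {y ∷ _} _ ∈l op ≢x ah = ℕ.≤-trans
            (ℕ.<⇒≤ (Ahead-Eq ρ (S ∷ 𝒮) (open-Eq (∈l (here refl)) x∈ (op (here refl)) (refl , Sx)) (ah (here refl))))
            (max (∈⁺ (∈l (here refl))) (trans (cls-other (≢x (here refl)))
              (trans (open-class (∈l (here refl)) (op (here refl))) (sym (trans (cls-other z≢) zc)))))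
      ... | inj₁ (ms≡ , f) = trans (f c) (trans (upd-same {M₁ 16} {c} refl)
          (head-of-class {ρ = ρ} {S ∷ 𝒮} (M 15 ∘ toℕ) sorted-x∷ z∈bs (open-Eq x∈ z∈ (refl , Sx) (class-open z∈ zc))
            (λ y∈ p → trans (open-class (∈l y∈) (Eq-open x∈ (∈l y∈) (refl , Sx) p)) (sym zc))
            (λ y∈ e → max (∈⁺ (∈l y∈)) (trans (cls-other (x∉bs y∈)) (trans e (sym (cls-other z≢)))))))
        where
        sorted-x∷ : AllPairs (Ahead ρ (S ∷ 𝒮)) (x ∷ bs)
        sorted-x∷ = proj₁ (proj₂ (AllPairs-++⁻ ms (proj₁ (proj₂ (AllPairs-++⁻ as sorted-shape)))))
        ∈l : ∀ {b} → b ∈ₗ bs → b ∈ₗ l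
        ∈l b∈ = subst (_ ∈ₗ_) (sym shape) (∈ₗ.∈-++⁺ʳ as (∈ₗ.∈-++⁺ʳ ms (there b∈)))
        z∈bs : z ∈ₗ bs
        z∈bs with ∈ₗ.∈-++⁻ as (subst (z ∈ₗ_) shape z∈)
        ... | inj₁ z∈as = ⊥-elim (closed z∈as (class-open z∈ zc))
        ... | inj₂ z∈′ with subst (λ ys → z ∈ₗ ys ++ x ∷ bs) ms≡ z∈′
        ...   | here z≡x = ⊥-elim (z≢ z≡x)
        ...   | there z∈bs = z∈bs
      first′ : ∀ {z} → z ∈ₗ l′ → Max z → M₃ 16 (M₃ 15 (toℕ z)) ≡ code z
      first′ {z} z∈ max with z Fin.≟ x
      ... | yes refl = trans (cong (M₃ 16) cls-x) (first-new max)
      ... | no z≢ with M 15 (toℕ z) ℕ.≟ c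
      ...   | yes e = trans (cong (M₃ 16) (trans (cls-other z≢) e)) (first-rest (∈⁻ z∈) z≢ max e)
      ...   | no ne = trans (cong (M₃ 16) (cls-other z≢)) (first-kept (∈⁻ z∈) z≢ max ne)

    relocate-wp : wp move 23 (λ M′ → Round {ρ = ρ} 𝒮 κ rs S′ l′ M′ × (∀ j → M′ 19 j ≡ upd (M 19) (toℕ x) (M 25 0) j)) M
    relocate-wp = wp-seq (wp-after openClass-wp λ {M₁} _ O → wp-seq (wp-block enterClass (wp-branch {k = 10}
        (λ e → wp-mono (s≤s (s≤s z≤n)) id (wp-block advanceFirst (Moved⇒Round {M₃ = run advanceFirst (run enterClass M₁)} O (record
          { doubly₃ = subst (λ ys → Doubly (M₁ 13) (M₁ 14) (as ++ ys)) (unmoved (ms-empty O e)) (doubly₁ O)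
          ; at-15 = at-15 O
          ; at-16 = inj₁ (ms-empty O e , λ j → cong₂ (λ a b → upd (M₁ 16) a b j) (Opened.at-c O) (next-x O (ms-empty O e)))
          ; at-17 = λ _ → refl ; at-27 = refl ; at-28 = at-28 O }) , at-19 O)))
        (λ e → wp-block moveNode (Moved⇒Round {M₃ = run moveNode (run enterClass M₁)} O (record
          { doubly₃ = insert as (ms ++ bs) (node O) (trans (at-y O) (ms-head (ms-nonempty O e))) unique-as
              (subst (Doubly _ _) (List.++-assoc as ms bs)
                (unlink (as ++ ms) bs (node O) (subst Unique (sym (List.++-assoc as ms (x ∷ bs))) unique-shape)
                  (subst (Doubly (M₁ 13) (M₁ 14)) (sym (List.++-assoc as ms (x ∷ bs))) (doubly₁ O))))
          ; at-15 = at-15 O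
          ; at-16 = inj₂ (ms-nonempty O e , λ _ → refl)
          ; at-17 = λ _ → refl ; at-27 = refl ; at-28 = at-28 O }) , at-19 O)))))
      where
      module _ {M₁ : Store} (O : Opened M₁) where
        open Opened O
        node : suc (M₁ 26 0) ≡ code x
        node = cong suc (trans (framed 26 refl 0) at-x)
        at-y : M₁ 16 (M₁ 29 0) ≡ headCode (ms ++ x ∷ [])
        at-y = trans (cong (M₁ 16) at-c) (trans (kept (ℕ.<⇒≢ (ℕ.<-≤-trans (κ< x∈) new≥))) first-y)
        doubly₁ : Doubly (M₁ 13) (M₁ 14) (as ++ ms ++ x ∷ bs)
        doubly₁ = Doubly-≗ (as ++ ms ++ x ∷ bs) (framed 13 refl) (framed 14 refl) (subst (Doubly (M 13) (M 14)) shape doubly)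
        at-15 : ∀ j → upd (M₁ 15) (M₁ 26 0) (M₁ 17 (M₁ 29 0)) j ≡ upd (M 15) (toℕ x) (M₁ 17 c) j
        at-15 j = upd-cong {M₁ 15} {M 15} (framed 15 refl j) (trans (framed 26 refl 0) at-x) (cong (M₁ 17) at-c)
        at-19 : ∀ j → upd (M₁ 19) (M₁ 26 0) (M₁ 25 0) j ≡ upd (M 19) (toℕ x) (M 25 0) j
        at-19 j = upd-cong {M₁ 19} {M 19} (framed 19 refl j) (trans (framed 26 refl 0) at-x) (framed 25 refl 0)
        at-28 : M₁ 28 0 ≡ rs
        at-28 = trans (framed 28 refl 0) round
        next-x : ms ≡ [] → M₁ 13 (suc (M₁ 26 0)) ≡ headCode bs
        next-x e = trans (cong (M₁ 13) node)
          (Doubly-next {g = M₁ 14} as (subst (λ ys → Doubly (M₁ 13) (M₁ 14) (as ++ ys ++ x ∷ bs)) e doubly₁))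
        ms-empty : (M₁ 16 (M₁ 29 0) ≡ᵇ suc (M₁ 26 0)) ≡ true → ms ≡ []
        ms-empty e = go ms (λ a∈ → x∉ms a∈) (trans (sym at-y) (trans (≡ᵇ-true⁻ {M₁ 16 (M₁ 29 0)} e) node))
          where
          go : ∀ ys → (∀ {a} → a ∈ₗ ys → a ≢ x) → headCode (ys ++ x ∷ []) ≡ code x → ys ≡ []
          go []      _  _ = refl
          go (_ ∷ _) ne e = ⊥-elim (ne (here refl) (code-injective e))
        ms-nonempty : (M₁ 16 (M₁ 29 0) ≡ᵇ suc (M₁ 26 0)) ≡ false → ms ≢ []
        ms-nonempty e ms≡ = ≡ᵇ-false⁻ e (trans at-y (trans (cong (λ ys → headCode (ys ++ x ∷ [])) ms≡) (sym node)))
      unmoved : ms ≡ [] → ms ++ x ∷ bs ≡ x ∷ ms ++ bs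
      unmoved refl′ = trans (cong (_++ x ∷ bs) refl′) (cong (λ ys → x ∷ ys ++ bs) (sym refl′))
      ms-head : ms ≢ [] → headCode (ms ++ x ∷ []) ≡ headCode (ms ++ bs)
      ms-head ne with ms
      ... | []    = ⊥-elim (ne refl)
      ... | _ ∷ _ = refl

  move-wp : wp move 23 (λ M′ → (∃ λ l′ → l′ ↭ l × Round {ρ = ρ} 𝒮 κ rs (add x S) l′ M′) ×
    (∀ j → M′ 19 j ≡ upd (M 19) (toℕ x) (M 25 0) j)) M
  move-wp = wp-mono ℕ.≤-refl (λ (R′ , e) → (l′ , l′↭l , R′) , e) relocate-wp
    where open Placed place

startRound nextArc : List Assignment
startRound =
    22 := 10 ⟦ var 25 ⟧
  ∷ 28 := var 27
  ∷ []
nextArc =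
    26 := 12 ⟦ dec (var 22) ⟧
  ∷ 22 := 11 ⟦ dec (var 22) ⟧
  ∷ []

refineBody refineBy : Program
refineBody = block nextArc ⨾ branch ((18 ⟦ var 26 ⟧) ≐ lit 0) move skip
refineBy = block startRound ⨾ while (lit 0 ⋖ var 22) refineBody

-- Refinement by the set S of those members of the adjacency list ws of v
-- that are not flagged in array 18; array 19 records v for them.
module RefineBy {n : ℕ} {ρ : Order n} {𝒮 : List (Fin n → Bool)} {l : List (Fin n)} {v : Fin n} {ws : List (Fin n)}
  (flag mark : Fin n → ℕ) (S : Fin n → Bool)
  (S⇒ : ∀ {a} → S a ≡ true → a ∈ₗ ws × flag a ≡ 0 × a ∈ₗ l) (S⇐ : ∀ {a} → a ∈ₗ ws → flag a ≡ 0 → S a ≡ true) where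

  record Inv (κ : Fin n → ℕ) (rs : ℕ) (rem : List (Fin n)) (M : Store) : Set where
    field
      Sᵖ     : Fin n → Bool
      l′     : List (Fin n)
      perm   : l′ ↭ l
      round  : Round {ρ = ρ} 𝒮 κ rs Sᵖ l′ M
      at-v   : M 25 0 ≡ toℕ v
      linked : Linked (M 24 0) (M 11) (M 12) (M 22 0) rem
      flags  : ∀ a → M 18 (toℕ a) ≡ flag a
      unique : Unique rem
      desc   : AllPairs (λ a b → b ≺[ ρ ] a) rem
      ⊆ws    : ∀ {a} → a ∈ₗ rem → a ∈ₗ ws
      done   : ∀ {a} → Sᵖ a ≡ true → S a ≡ true × a ∉ₗ rem
      todo   : ∀ {a} → S a ≡ true → a ∉ₗ rem → Sᵖ a ≡ true
      above  : ∀ {a b} → Sᵖ b ≡ true → a ∈ₗ rem → a ≺[ ρ ] b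
      marks  : ∀ a → M 19 (toℕ a) ≡ (if Sᵖ a then toℕ v else mark a)

  refineBody-wp : ∀ {κ rs w rem M} → Inv κ rs (w ∷ rem) M →
    (0 <ᵇ M 22 0) ≡ true × wp refineBody 27 (Inv κ rs rem) M
  refineBody-wp {κ} {rs} {w} {rem} {M} I with Inv.linked I
  ... | e , at-e , e<k , src-e , rest = cong (0 <ᵇ_) at-e ,
    wp-seq (wp-block nextArc (wp-branch {k = 23} unflagged (λ t → 1 , _ , skip , s≤s z≤n , flagged t)))
    where
    open Inv I
    M₁ : Store
    M₁ = run nextArc M
    at-w : M 12 (pred (M 22 0)) ≡ toℕ w
    at-w = trans (cong (M 12 ∘ pred) at-e) src-e
    linked₁ : Linked (M 24 0) (M 11) (M 12) (M 11 (pred (M 22 0))) rem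
    linked₁ = subst (λ k → Linked (M 24 0) (M 11) (M 12) (M 11 k) rem) (sym (cong pred at-e)) rest
    w∉rem : w ∉ₗ rem
    w∉rem w∈ = All.lookup (AllPairs.head unique) w∈ refl
    flag-w : M 18 (M 12 (pred (M 22 0))) ≡ flag w
    flag-w = trans (cong (M 18) at-w) (flags w)
    Sᵖw : Sᵖ w ≡ false
    Sᵖw with Sᵖ w in eq
    ... | false = refl
    ... | true  = ⊥-elim (proj₂ (done eq) (here refl))
    unflagged : (M 18 (M 12 (pred (M 22 0))) ≡ᵇ 0) ≡ true → wp move 23 (Inv κ rs rem) M₁
    unflagged t = wp-after (Move.move-wp M₁ round w∈l Sᵖw (λ _ Sb → above Sb (here refl)) at-w)
      λ {M₂} f ((l″ , perm′ , R′) , e₁₉) → record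
      { Sᵖ = add w Sᵖ ; l′ = l″ ; perm = ↭-trans perm′ perm ; round = R′
      ; at-v = trans (f 25 refl 0) at-v
      ; linked = subst (λ h → Linked (M₂ 24 0) (M₂ 11) (M₂ 12) h rem) (sym (f 22 refl 0))
          (Linked-cong rem (ℕ.≤-reflexive (sym (f 24 refl 0))) (λ {j} _ → f 11 refl j) (λ {j} _ → f 12 refl j) linked₁)
      ; flags = λ a → trans (f 18 refl _) (flags a)
      ; unique = AllPairs.tail unique
      ; desc = AllPairs.tail desc
      ; ⊆ws = ⊆ws ∘ there
      ; done = done′
      ; todo = todo′
      ; above = above′
      ; marks = λ a → trans (e₁₉ (toℕ a)) (marks′ a)
      }
      where
      Sw : S w ≡ true
      Sw = S⇐ (⊆ws (here refl)) (trans (sym flag-w) (≡ᵇ-true⁻ {M 18 (M 12 (pred (M 22 0)))} t))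
      w∈l : w ∈ₗ l′
      w∈l = ↭.∈-resp-↭ (↭-sym perm) (proj₂ (proj₂ (S⇒ Sw)))
      done′ : ∀ {a} → add w Sᵖ a ≡ true → S a ≡ true × a ∉ₗ rem
      done′ {a} e with a Fin.≟ w
      ... | yes refl = Sw , w∉rem
      ... | no _     = proj₁ (done e) , proj₂ (done e) ∘ there
      todo′ : ∀ {a} → S a ≡ true → a ∉ₗ rem → add w Sᵖ a ≡ true
      todo′ {a} Sa a∉ with a Fin.≟ w
      ... | yes _ = refl
      ... | no a≢ = todo Sa λ { (here e) → a≢ e ; (there a∈) → a∉ a∈ }
      above′ : ∀ {a b} → add w Sᵖ b ≡ true → a ∈ₗ rem → a ≺[ ρ ] b
      above′ {b = b} e a∈ with b Fin.≟ w
      ... | yes refl = All.lookup (AllPairs.head desc) a∈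
      ... | no _     = above e (there a∈)
      marks′ : ∀ a → upd (M 19) (toℕ w) (M 25 0) (toℕ a) ≡ (if add w Sᵖ a then toℕ v else mark a)
      marks′ a with a Fin.≟ w
      ... | yes refl = trans (upd-same {M 19} {toℕ w} refl) at-v
      ... | no a≢    = trans (upd-other {M 19} (a≢ ∘ Fin.toℕ-injective)) (marks a)
    flagged : (M 18 (M 12 (pred (M 22 0))) ≡ᵇ 0) ≡ false → Inv κ rs rem M₁
    flagged t = record
      { Sᵖ = Sᵖ ; l′ = l′ ; perm = perm ; round = round ; at-v = at-v ; linked = linked₁ ; flags = flags
      ; unique = AllPairs.tail unique ; desc = AllPairs.tail desc ; ⊆ws = ⊆ws ∘ there
      ; done = λ e → proj₁ (done e) , proj₂ (done e) ∘ there
      ; todo = λ Sa a∉ → todo Sa λ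
          { (here refl) → ≡ᵇ-false⁻ t (trans flag-w (proj₁ (proj₂ (S⇒ Sa)))) ; (there a∈) → a∉ a∈ }
      ; above = λ e a∈ → above e (there a∈)
      ; marks = marks
      }

  refineBy-wp : ∀ {M} → Partition ρ 𝒮 l M → M 25 0 ≡ toℕ v → Linked (M 24 0) (M 11) (M 12) (M 10 (toℕ v)) ws →
    AllPairs (λ a b → b ≺[ ρ ] a) ws → (∀ a → M 18 (toℕ a) ≡ flag a) → (∀ a → M 19 (toℕ a) ≡ mark a) →
    wp refineBy (4 + length ws * 28) (λ M′ → (∃ λ l′ → l′ ↭ l × Partition ρ (S ∷ 𝒮) l′ M′) ×
      (∀ a → M′ 19 (toℕ a) ≡ (if S a then toℕ v else mark a))) M
  refineBy-wp {M} P at-v linked desc flags marks =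
    wp-seq (wp-block startRound (wp-mono ℕ.≤-refl (λ {M′} I → let module I = Inv I in
        (I.l′ , I.perm , Partition-cong ρ M′ (λ {a} _ → agree I a) (Round-end M′ I.round)) ,
        λ a → trans (I.marks a) (cong (λ b → if b then toℕ v else mark a) (agree I a)))
      (wp-loop 27 (Inv (M 15 ∘ toℕ) (M 27 0)) refineBody-wp
        (λ I → cong (0 <ᵇ_) (Inv.linked I)) ws (record
          { Sᵖ = λ _ → false ; l′ = l ; perm = ↭-refl ; round = Round-start (run startRound M) P refl
          ; at-v = at-v
          ; linked = subst (λ k → Linked (M 24 0) (M 11) (M 12) (M 10 k) ws) (sym at-v) linked
          ; flags = flags
          ; unique = AllPairs.map (λ lt e → ℕ.<-irrefl (cong (toℕ ∘ pos ρ) (sym e)) lt) desc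
          ; desc = desc ; ⊆ws = id
          ; done = λ () ; todo = λ Sa a∉ → ⊥-elim (a∉ (proj₁ (S⇒ Sa))) ; above = λ ()
          ; marks = marks }))))
    where
    agree : ∀ {κ rs M′} (I : Inv κ rs [] M′) a → Inv.Sᵖ I a ≡ S a
    agree I a with Inv.Sᵖ I a in e | S a in e′
    ... | true  | true  = refl
    ... | false | false = refl
    ... | true  | false = trans (sym (proj₁ (Inv.done I e))) e′
    ... | false | true  = trans (sym e) (Inv.todo I e′ λ ())

-- The counter 27 is never reset. Class numbers of the second partition thus exceed all those of the
-- first, and array 17 can be reused without clearing.
openList pushFront closeList : List Assignment
openList =
    29 := var 27
  ∷ 27 := inc (var 27)
  ∷ 13 ⟨ lit 0 ⟩:= lit 0
  ∷ 14 ⟨ lit 0 ⟩:= lit 0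
  ∷ 21 := lit 0
  ∷ []
pushFront =
    26 := 3 ⟦ var 21 ⟧
  ∷ 15 ⟨ var 26 ⟩:= var 29
  ∷ 30 := inc (var 26)
  ∷ 33 := 13 ⟦ lit 0 ⟧
  ∷ 31 := 14 ⟦ var 33 ⟧
  ∷ 13 ⟨ var 31 ⟩:= var 30
  ∷ 14 ⟨ var 30 ⟩:= var 31
  ∷ 13 ⟨ var 30 ⟩:= var 33
  ∷ 14 ⟨ var 33 ⟩:= var 30
  ∷ 21 := inc (var 21)
  ∷ []
closeList = 16 ⟨ var 29 ⟩:= 13 ⟦ lit 0 ⟧ ∷ []

initList : Program
initList = block openList ⨾ while (var 21 ⋖ var 0) (block pushFront) ⨾ block closeList

module InitList {n : ℕ} (ρ : Order n) where

  record Inv (us : List (Fin n)) (M : Store) : Set where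
    field
      ps     : List (Fin n)
      shape  : reverse ps ++ us ≡ toList ρ
      size   : M 0 0 ≡ n
      index  : M 21 0 + length us ≡ n
      seg    : Seg (M 3) (M 21 0) us
      unique : Unique ps
      doubly : Doubly (M 13) (M 14) ps
      cls    : ∀ {a} → a ∈ₗ ps → M 15 (toℕ a) ≡ M 29 0
      base₀  : M 29 0 < M 27 0
      fresh  : ∀ c → M 17 c < M 27 0

  pushFront-run : ∀ {u us M} → Inv (u ∷ us) M → Inv us (run pushFront M)
  pushFront-run {u} {us} {M} I = record
    { ps = u ∷ ps
    ; shape = trans (cong (_++ us) (List.unfold-reverse u ps)) (trans (List.++-assoc (reverse ps) (u ∷ []) us) shape)
    ; size = size
    ; index = trans (sym (ℕ.+-suc _ (length us))) index
    ; seg = proj₂ seg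
    ; unique = unique′
    ; doubly = insert [] ps (cong suc (proj₁ seg)) (Doubly-head {g = M 14} ps doubly) unique′ doubly
    ; cls = λ { (here refl) → upd-same {M 15} (sym (proj₁ seg))
              ; (there a∈) → trans (upd-other {M 15} λ e → u∉ (subst (_∈ₗ ps) (Fin.toℕ-injective (trans e (proj₁ seg))) a∈)) (cls a∈) }
    ; base₀ = base₀ ; fresh = fresh }
    where
    open Inv I
    u∉ : u ∉ₗ ps
    u∉ u∈ = unique-separate (reverse ps) (subst Unique (sym shape) (toList-unique ρ)) (Any.reverse⁺ u∈) (here refl) refl
    unique′ : Unique (u ∷ ps)
    unique′ = All.tabulate (λ { a∈ refl → u∉ a∈ }) ∷ unique

  initList-wp : ∀ {M} → M 0 0 ≡ n → Seg (M 3) 0 (toList ρ) → (∀ c → M 17 c < suc (M 27 0)) →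
    wp initList (9 + n * 12) (Partition ρ [] (reverse (toList ρ))) M
  initList-wp {M} size₀ seg₀ fresh₀ = wp-mono (ℕ.≤-reflexive cost) id
    (wp-seq (wp-block openList (wp-seq (wp-mono ℕ.≤-refl (λ I → wp-block closeList (finish I))
      (wp-loop 11 Inv
        (λ {u} {us} {M₁} I → trans (cong (M₁ 21 0 <ᵇ_) (Inv.size I)) (<ᵇ-true (subst (M₁ 21 0 <_) (Inv.index I) (ℕ.m<m+n _ (s≤s z≤n)))) ,
          wp-block pushFront (pushFront-run I))
        (λ {M₁} I → trans (cong (M₁ 21 0 <ᵇ_) (Inv.size I))
          (<ᵇ-false (ℕ.≤-reflexive (trans (sym (Inv.index I)) (ℕ.+-identityʳ (M₁ 21 0))))))
        (toList ρ) (record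
          { ps = [] ; shape = refl ; size = size₀ ; index = List.length-tabulate (at ρ) ; seg = seg₀ ; unique = []
          ; doubly = refl , refl ; cls = λ () ; base₀ = ℕ.≤-refl ; fresh = fresh₀ }))))))
    where
    cost : 6 + (suc (length (toList ρ) * 12) + 2) ≡ 9 + n * 12
    cost = trans (cong (λ k → 6 + (suc (k * 12) + 2)) (List.length-tabulate (at ρ))) (cong (7 +_) (ℕ.+-comm (n * 12) 2))
    finish : ∀ {M′} → Inv [] M′ → Partition ρ [] (reverse (toList ρ)) (run closeList M′)
    finish {M′} I = subst (λ l → Partition ρ [] l (run closeList M′)) ps≡ (record
      { unique = unique ; doubly = doubly
      ; sorted = subst (AllPairs (Ahead ρ [])) (sym ps≡)
          (AllPairs-reverse (AllPairs-toList⁺ ρ λ lt → inj₂ (tt , lt)))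
      ; cls⇒ = λ _ _ _ → tt
      ; cls⇐ = λ a∈ b∈ _ → trans (cls a∈) (sym (cls b∈))
      ; bound = λ a∈ → subst (_< M′ 27 0) (sym (cls a∈)) base₀
      ; first = λ {z} z∈ max → trans (upd-same {M′ 16} (cls z∈)) (trans (Doubly-head {g = M′ 14} ps doubly)
          (first-of (subst (AllPairs (λ a b → b ≺[ ρ ] a)) (sym ps≡) (AllPairs-reverse (AllPairs-toList⁺ ρ id)))
            z∈ λ y∈ → max y∈ (trans (cls y∈) (sym (cls z∈)))))
      ; fresh = fresh })
      where
      open Inv I
      ps≡ : ps ≡ reverse (toList ρ)
      ps≡ = trans (sym (List.reverse-involutive ps)) (cong reverse (trans (sym (List.++-identityʳ (reverse ps))) shape))
      first-of : ∀ {l : List (Fin n)} {z} → AllPairs (λ a b → b ≺[ ρ ] a) l → z ∈ₗ l → (∀ {y} → y ∈ₗ l → y ≼[ ρ ] z) →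
        headCode l ≡ code z
      first-of (_ ∷ _)  (here refl) max = refl
      first-of (h> ∷ _) (there z∈)  max = ⊥-elim (ℕ.<⇒≱ (All.lookup h> z∈) (max (here refl)))

-- Lexicographic breadth first search

-- Which vertex a search treats next is known only in the round itself. The list is just an account
-- of the outstanding vertices, so the one that is charged may be taken from any place in it.
wp-while-↭ : ∀ {A : Set} {b P} (Inv : List A → Store → Set) (cost : A → ℕ) →
  (∀ {y ys M} → Inv (y ∷ ys) M → test M b ≡ true × ∃ λ x → wp P (cost x) (λ M′ → ∃ λ xs → x ∷ xs ↭ y ∷ ys × Inv xs M′) M) →
  (∀ {M} → Inv [] M → test M b ≡ false) →
  ∀ xs {M} → Inv xs M → wp (while b P) (suc (sum (map (suc ∘ cost) xs))) (Inv []) M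
wp-while-↭ {A} {b} {P} Inv cost step stop xs = go (length xs) xs refl
  where
  go : ∀ k xs → length xs ≡ k → ∀ {M} → Inv xs M → wp (while b P) (suc (sum (map (suc ∘ cost) xs))) (Inv []) M
  go _ [] _ {M} inv = 1 , M , while-false (stop inv) , ℕ.≤-refl , inv
  go (suc k) (y ∷ ys) e {M} inv with step inv
  ... | ok , x , t , M′ , r , t≤ , xs , perm , inv′ with go k xs (ℕ.suc-injective (trans (↭.↭-length perm) e)) inv′
  ...   | t′ , M″ , r′ , t′≤ , q = suc (t + t′) , M″ , while-true ok r r′ ,
    s≤s (ℕ.≤-trans (ℕ.+-mono-≤ t≤ t′≤) (ℕ.≤-reflexive (trans (ℕ.+-suc (cost x) _)
      (ListAction.sum-↭ (↭.map⁺ (suc ∘ cost) perm))))) , q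

-- Q relates every vertex of a search to the list of the vertices before it,
-- both lists with the most recent vertex first.
Trail : ∀ {n} → (List (Fin n) → Fin n → Set) → List (Fin n) → Set
Trail Q []       = 𝟙
Trail Q (d ∷ ds) = Q ds d × Trail Q ds

History : ∀ {n} → (List (Fin n) → Fin n → Fin n → Set) → List (Fin n) → Set
History R = Trail λ ds d → ∀ {y} → y ∉ₗ d ∷ ds → R ds d y

-- `m` is the default for a vertex without visited neighbours. When a vertex of a connected graph is
-- visited, this is the case for `s` alone.
lastNb : ∀ {n} → Graph n → (Fin n → ℕ) → List (Fin n) → Fin n → ℕ
lastNb G m []       w = m w
lastNb G m (d ∷ ds) w = if nb G d w then toℕ d else lastNb G m ds w

Parents : ∀ {n} → Graph n → (Fin n → ℕ) → List (Fin n) → (ℕ → ℕ) → Set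
Parents G m ds f = Trail (λ ds d → f (toℕ d) ≡ lastNb G m ds d) ds

Parents-cong : ∀ {n} {G : Graph n} {m} ds {f g : ℕ → ℕ} → (∀ {d} → d ∈ₗ ds → f (toℕ d) ≡ g (toℕ d)) →
  Parents G m ds g → Parents G m ds f
Parents-cong         []       e _       = tt
Parents-cong {G = G} {m} (d ∷ ds) {f} {g} e (p , q) = trans (e (here refl)) p , Parents-cong {G = G} {m} ds {f} {g} (e ∘ there) q

recordVisit startLexBFS : List Assignment
recordVisit =
    5 ⟨ var 21 ⟩:= var 25
  ∷ 6 ⟨ var 25 ⟩:= 19 ⟦ var 25 ⟧
  ∷ 18 ⟨ var 25 ⟩:= lit 1
  ∷ []
-- n is not the number of a vertex: s gets no parent.
startLexBFS =
    19 ⟨ 0 ⟦ lit 1 ⟧ ⟩:= var 0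
  ∷ 21 := lit 0
  ∷ []

-- The list is kept in the order of the LexBFS⁺ labels, so its first vertex is the one to visit, and
-- refining by the neighbourhood of that vertex updates all labels. Array 19 names the latest
-- visited neighbour, which is the parent once a vertex is removed.
lexBody lexBFS : Program
lexBody = block popFirst ⨾ block recordVisit ⨾ refineBy ⨾ next-i
lexBFS = block startLexBFS ⨾ while (var 21 ⋖ var 0) lexBody

module _ {n : ℕ} {G : Graph n} {L : AdjacencyLists G} where
  open AdjacencyLists L

  ∈-nbrs⁺ : ∀ {us v w} → v ∈ₗ us → v ∈ N G w → v ∈ₗ nbrs G us w
  ∈-nbrs⁺ {us} {v} {w} v∈ v∈w = ∈ₗ.∈-filter⁺ (λ u → w ∈? N G u) v∈ (Graph.sym G v∈w)

  ∈-nbrs⁻ : ∀ {us v w} → v ∈ₗ nbrs G us w → v ∈ₗ us × v ∈ N G w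
  ∈-nbrs⁻ {us} {v} {w} v∈ with ∈ₗ.∈-filter⁻ (λ u → w ∈? N G u) {xs = us} v∈
  ... | v∈us , w∈v = v∈us , Graph.sym G w∈v

  nbrs-length : ∀ {us} w → Unique us → length (nbrs G us w) ≤ Accounting.deg L w
  nbrs-length {us} w u = unique-⊆-length (Unique.filter⁺ (λ v → w ∈? N G v) u)
    (λ v∈ → Equivalence.from (complete _ w) (proj₂ (∈-nbrs⁻ {us = us} v∈)))

module LexBFS {n : ℕ} {G : Graph n} (L : AdjacencyLists G) (s : Fin n) (ρ : Order n) (m : Fin n → ℕ) where

  ρ⁻ : List (Fin n)
  ρ⁻ = reverse (toList ρ)

  ranks : List (Fin n) → List (Fin n → Bool)
  ranks = map (nb G)

  Leads⁺ : List (Fin n) → Fin n → Fin n → Set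
  Leads⁺ ds d y = Ahead ρ (ranks ds) d y

  record Inv (l : List (Fin n)) (M : Store) : Set where
    field
      ds       : List (Fin n)
      part     : Partition ρ (ranks ds) l M
      covers   : ∀ v → v ∈ₗ ds ⊎ v ∈ₗ l
      disjoint : ∀ {v} → v ∈ₗ ds → v ∉ₗ l
      uniq     : Unique ds
      count    : M 21 0 + length l ≡ n
      index    : M 21 0 ≡ length ds
      written  : Seg (M 5) 0 (reverse ds)
      history  : History Leads⁺ ds
      visited  : ∀ {v} → v ∈ₗ ds → M 18 (toℕ v) ≡ 1
      waiting  : ∀ {v} → v ∈ₗ l → M 18 (toℕ v) ≡ 0
      marks    : ∀ {v} → v ∈ₗ l → M 19 (toℕ v) ≡ lastNb G m ds v
      parents  : Parents G m ds (M 6)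
      input    : Input L s ρ M
      linked   : ∀ w → LinkedAt M w (nbrs G ρ⁻ w)

noParent : ∀ {n} → Fin n → Fin n → ℕ
noParent {n} s v = if does (v Fin.≟ s) then n else 0

noParent-root : ∀ {n} (s : Fin n) → noParent s s ≡ n
noParent-root {n} s = cong (λ b → if b then n else 0) (dec-true (s Fin.≟ s) refl)

module LexBFSRun {n : ℕ} {G : Graph n} (L : AdjacencyLists G) (s : Fin n) (ρ : Order n) where
  open LexBFS L s ρ (noParent s) public
  open Accounting L

  lexBody-wp : ∀ {x l M} → Inv (x ∷ l) M → (M 21 0 <ᵇ M 0 0) ≡ true ×
    wp lexBody (46 * weight x) (λ M′ → ∃ λ l′ → l′ ↭ l × Inv l′ M′) M
  lexBody-wp {x} {l} {M} I =
    trans (cong (M 21 0 <ᵇ_) (Input.size input)) (<ᵇ-true (subst (M 21 0 <_) count (ℕ.m<m+n _ (s≤s z≤n)))) ,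
    wp-mono cost id (wp-seq (wp-block popFirst (wp-seq (wp-block recordVisit (wp-seq (wp-after
      (RefineBy.refineBy-wp {ρ = ρ} {ranks ds} {l} {x} {nbrs G ρ⁻ x} flag (λ v → M₂ 19 (toℕ v)) S S⇒ S⇐ {M₂} (proj₁ popped) at-x
        (linked x) desc (λ _ → refl) (λ _ → refl))
      λ {M₃} f ((l′ , perm , P₃) , e₁₉) → wp-block (21 := inc (var 21) ∷ []) (l′ , perm , after f perm P₃ e₁₉)))))))
    where
    open Inv I
    M₁ M₂ : Store
    M₁ = run popFirst M
    M₂ = run recordVisit M₁
    popped : Partition ρ (ranks ds) l M₁ × M₁ 25 0 ≡ toℕ x
    popped = popFirst-run {ρ = ρ} M part
    at-x : M₁ 25 0 ≡ toℕ x
    at-x = proj₂ popped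
    desc : AllPairs (λ a b → b ≺[ ρ ] a) (nbrs G ρ⁻ x)
    desc = AllPairs.filter⁺ (λ u → x ∈? N G u) (AllPairs-reverse (AllPairs-toList⁺ ρ id))
    flag : Fin n → ℕ
    flag v = M₂ 18 (toℕ v)
    S : Fin n → Bool
    S a = nb G x a ∧ (flag a ≡ᵇ 0)
    x∉l : x ∉ₗ l
    x∉l x∈ = All.lookup (AllPairs.head (PartitionArrays.unique part)) x∈ refl
    flag-new : ∀ {v} → v ∈ₗ x ∷ ds → flag v ≡ 1
    flag-new {v} v∈ with v Fin.≟ x | v∈
    ... | yes refl | _         = upd-same {M 18} (sym at-x)
    ... | no v≢    | here e    = ⊥-elim (v≢ e)
    ... | no v≢    | there v∈′ = trans (upd-other {M 18} (λ e → v≢ (Fin.toℕ-injective (trans e at-x)))) (visited v∈′)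
    flag-old : ∀ {v} → v ∈ₗ l → flag v ≡ 0
    flag-old v∈ = trans (upd-other {M 18} (λ e → x∉l (subst (_∈ₗ l) (Fin.toℕ-injective (trans e at-x)) v∈))) (waiting (there v∈))
    remaining : ∀ {v} → v ∉ₗ x ∷ ds → v ∈ₗ l
    remaining {v} v∉ with covers v
    ... | inj₁ v∈            = ⊥-elim (v∉ (there v∈))
    ... | inj₂ (here e)      = ⊥-elim (v∉ (here e))
    ... | inj₂ (there v∈)    = v∈
    alive : ∀ {v} → flag v ≡ 0 → v ∈ₗ l
    alive e = remaining λ v∈ → case trans (sym (flag-new v∈)) e of λ ()
    S⇒ : ∀ {a} → S a ≡ true → a ∈ₗ nbrs G ρ⁻ x × flag a ≡ 0 × a ∈ₗ l
    S⇒ {a} e with a ∈? N G x | flag a ≡ᵇ 0 in t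
    ... | yes a∈ | true = ∈-nbrs⁺ {L = L} {us = ρ⁻} (Any.reverse⁺ (∈-toList ρ a)) a∈ , ≡ᵇ-true⁻ t , alive (≡ᵇ-true⁻ t)
    S⇐ : ∀ {a} → a ∈ₗ nbrs G ρ⁻ x → flag a ≡ 0 → S a ≡ true
    S⇐ {a} a∈ e = cong₂ _∧_ (bits⁺ (proj₂ (∈-nbrs⁻ {L = L} {us = ρ⁻} a∈))) (≡ᵇ-true e)
    S-alive : ∀ {a} → a ∈ₗ l → S a ≡ nb G x a
    S-alive {a} a∈ = trans (cong (nb G x a ∧_) (≡ᵇ-true (flag-old a∈))) (Bool.∧-identityʳ _)
    after : ∀ {M₃ l′} → M₃ ≐⟨ refineBy ⟩ M₂ → l′ ↭ l → Partition ρ (S ∷ ranks ds) l′ M₃ →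
      (∀ a → M₃ 19 (toℕ a) ≡ (if S a then toℕ x else M₂ 19 (toℕ a))) → Inv l′ (run (21 := inc (var 21) ∷ []) M₃)
    after {M₃} {l′} f perm P₃ e₁₉ = record
      { ds       = x ∷ ds
      ; part     = Partition-cong ρ M₃ (λ a∈ → S-alive (∈l a∈)) P₃
      ; covers   = λ v → Sum.map id (↭.∈-resp-↭ (↭-sym perm)) (covers′ v)
      ; disjoint = λ { (here refl) v∈ → x∉l (∈l v∈) ; (there v∈ds) v∈ → disjoint v∈ds (there (∈l v∈)) }
      ; uniq     = All.tabulate (λ { v∈ refl → disjoint v∈ (here refl) }) ∷ uniq
      ; count    = trans (cong₂ (λ a b → suc a + b) (f 21 refl 0) (↭.↭-length perm)) (trans (sym (ℕ.+-suc _ (length l))) count)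
      ; index    = cong suc (trans (f 21 refl 0) index)
      ; written  = subst (Seg (M₃ 5) 0) (sym (List.unfold-reverse x ds))
          (Seg-≗ (reverse ds ∷ʳ x) (λ j → trans (f 5 refl j) (upd-cong {M 5} {M 5} refl refl at-x))
            (Seg-snoc (reverse ds) (trans index (sym (List.length-reverse ds))) written))
      ; history  = (λ {y} y∉ → All.lookup (AllPairs.head (PartitionArrays.sorted part)) (remaining y∉)) , history
      ; visited  = λ v∈ → trans (f 18 refl _) (flag-new v∈)
      ; waiting  = λ v∈ → trans (f 18 refl _) (flag-old (∈l v∈))
      ; marks    = λ {v} v∈ → trans (e₁₉ v) (cong₂ (λ b k → if b then toℕ x else k) (S-alive (∈l v∈)) (marks (there (∈l v∈))))
      ; parents  = trans (f 6 refl (toℕ x)) (trans (upd-same {M 6} (sym at-x)) (trans (cong (M 19) at-x) (marks (here refl)))) ,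
          Parents-cong {G = G} {noParent s} ds {M₃ 6} {M 6} (λ {d} d∈ → trans (f 6 refl (toℕ d))
            (upd-other {M 6} λ e → disjoint d∈ (here (Fin.toℕ-injective (trans e at-x))))) parents
      ; input    = Input-≗ (f 0 refl) (f 1 refl) (f 2 refl) (f 3 refl) input
      ; linked   = λ w → LinkedAt-frame {P = refineBy} {M₂} {M₃} {w} {nbrs G ρ⁻ w} f refl refl refl refl (linked w)
      }
      where
      ∈l : ∀ {v} → v ∈ₗ l′ → v ∈ₗ l
      ∈l = ↭.∈-resp-↭ perm
      covers′ : ∀ v → v ∈ₗ x ∷ ds ⊎ v ∈ₗ l
      covers′ v with covers v
      ... | inj₁ v∈         = inj₁ (there v∈)
      ... | inj₂ (here e)   = inj₁ (here e)
      ... | inj₂ (there v∈) = inj₂ v∈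
    len : ℕ
    len = length (nbrs G ρ⁻ x)
    cost : 8 + (4 + ((4 + len * 28) + 2)) ≤ 46 * weight x
    cost = ℕ.≤-trans (ℕ.≤-reflexive (cong (16 +_) (ℕ.+-comm (len * 28) 2)))
      (ℕ.≤-trans (ℕ.+-monoʳ-≤ 18 (ℕ.*-monoˡ-≤ 28 (nbrs-length {L = L} x
        (unique-reverse (toList-unique ρ)))))
        (affine-≤ 18 28 (deg x)))

  lexBFS-wp : ∀ {M} → Partition ρ [] ρ⁻ M → Input L s ρ M → (∀ w → LinkedAt M w (nbrs G ρ⁻ w)) →
    (∀ j → M 18 j ≡ 0) → (∀ j → M 19 j ≡ 0) → wp lexBFS (4 + 47 * total) (Inv []) M
  lexBFS-wp {M} P I linked zero₁₈ zero₁₉ =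
    wp-seq (wp-block startLexBFS (wp-mono (s≤s (sum-weights-≤ 46 (PartitionArrays.unique P) all-ρ⁻)) id
      (wp-while-↭ Inv (λ v → 46 * weight v)
        (λ {x} I → let (ok , w) = lexBody-wp I in ok , x , wp-mono ℕ.≤-refl (λ (l′ , perm , J) → l′ , prep x perm , J) w)
        (λ {M′} J → trans (cong (M′ 21 0 <ᵇ_) (Input.size (Inv.input J)))
          (<ᵇ-false (ℕ.≤-reflexive (trans (sym (Inv.count J)) (ℕ.+-identityʳ (M′ 21 0))))))
        ρ⁻ (record
          { ds = [] ; part = P ; covers = λ v → inj₂ (all-ρ⁻ v) ; disjoint = λ () ; uniq = []
          ; count = trans (List.length-reverse (toList ρ)) (List.length-tabulate (at ρ)) ; index = refl
          ; written = tt ; history = tt ; visited = λ () ; waiting = λ _ → zero₁₈ _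
          ; marks = λ {v} _ → mark v ; parents = tt
          ; input = Input-≗ (λ _ → refl) (λ _ → refl) (λ _ → refl) (λ _ → refl) I ; linked = linked }))))
    where
    all-ρ⁻ : ∀ v → v ∈ₗ ρ⁻
    all-ρ⁻ v = Any.reverse⁺ (∈-toList ρ v)
    mark : ∀ v → upd (M 19) (M 0 1) (M 0 0) (toℕ v) ≡ noParent s v
    mark v with v Fin.≟ s
    ... | yes refl = trans (upd-same {M 19} (sym (Input.root I))) (Input.size I)
    ... | no v≢s   = trans (upd-other {M 19} λ e → v≢s (Fin.toℕ-injective (trans e (Input.root I)))) (zero₁₉ _)

tabulate-split : ∀ {A : Set} {m} (f : Fin m → A) i →
  tabulate f ≡ take (toℕ i) (tabulate f) ++ f i ∷ drop (suc (toℕ i)) (tabulate f)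
tabulate-split f zero    = refl
tabulate-split f (suc i) = cong (f zero ∷_) (tabulate-split (f ∘ suc) i)

before : ∀ {n} → Order n → Fin n → List (Fin n)
before {n} σ i = map (at σ) (recent n (toℕ i))

module _ {n : ℕ} (σ : Order n) where

  reverse-toList : ∀ i → reverse (toList σ) ≡ reverse (drop (suc (toℕ i)) (toList σ)) ++ at σ i ∷ before σ i
  reverse-toList i = begin
    reverse (toList σ)             ≡⟨ cong reverse (tabulate-split (at σ) i) ⟩
    reverse (xs ++ at σ i ∷ ys)    ≡⟨ List.reverse-++ xs (at σ i ∷ ys) ⟩
    reverse (at σ i ∷ ys) ++ reverse xs
      ≡⟨ cong₂ _++_ (List.unfold-reverse (at σ i) ys)
           (trans (cong (reverse ∘ take (toℕ i)) (sym (List.map-tabulate id (at σ))))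
             (trans (cong reverse (List.take-map (toℕ i) (allFin n))) (sym (List.reverse-map (at σ) (take (toℕ i) (allFin n)))))) ⟩
    (reverse ys ∷ʳ at σ i) ++ before σ i ≡⟨ List.++-assoc (reverse ys) (at σ i ∷ []) (before σ i) ⟩
    reverse ys ++ at σ i ∷ before σ i ∎
    where
    open ≡-Reasoning
    xs ys : List (Fin n)
    xs = take (toℕ i) (toList σ)
    ys = drop (suc (toℕ i)) (toList σ)

  ∈-before⁻ : ∀ i {a} → a ∈ₗ before σ i → Visited σ i a
  ∈-before⁻ i a∈ with ∈ₗ.∈-map⁻ (at σ) a∈
  ... | j , j∈ , refl = subst (_< toℕ i) (cong toℕ (sym (pos-at σ j))) (∈-recent⁻ {i = toℕ i} j∈)

  ∈-before⁺ : ∀ {i a} → Visited σ i a → a ∈ₗ before σ i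
  ∈-before⁺ {i} {a} a<i = subst (_∈ₗ before σ i) (at-pos σ a) (∈ₗ.∈-map⁺ (at σ) (∈-recent⁺ {j = pos σ a} a<i))

  Trail-at : ∀ {Q : List (Fin n) → Fin n → Set} → Trail Q (reverse (toList σ)) → ∀ i → Q (before σ i) (at σ i)
  Trail-at {Q} t i = go (reverse (drop (suc (toℕ i)) (toList σ))) (subst (Trail Q) (reverse-toList i) t)
    where
    go : ∀ as → Trail Q (as ++ at σ i ∷ before σ i) → Q (before σ i) (at σ i)
    go []       (q , _) = q
    go (_ ∷ as) (_ , t) = go as t

  Later-at : ∀ {R : Fin n → Set} {i y} → (∀ {y} → y ∉ₗ at σ i ∷ before σ i → R y) → Unvisited σ i y → y ≢ at σ i → R y
  Later-at {i = i} r i≤y y≢ = r λ { (here e) → y≢ e ; (there y∈) → ℕ.<⇒≱ (∈-before⁻ i y∈) i≤y }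

  Parents-at : ∀ {G m f} → Parents G m (reverse (toList σ)) f → ∀ v → f (toℕ v) ≡ lastNb G m (before σ (pos σ v)) v
  Parents-at {G} {m} {f} h v = subst (λ w → f (toℕ w) ≡ lastNb G m (before σ (pos σ v)) w) (at-pos σ v)
    (Trail-at {λ ds d → f (toℕ d) ≡ lastNb G m ds d} h (pos σ v))

  lastNb-Parent : ∀ {G m v p} → Parent G σ v p → lastNb G m (before σ (pos σ v)) v ≡ toℕ p
  lastNb-Parent {G} {m} {v} {p} ((p∈ , p≺) , max) =
    go (recent n (toℕ (pos σ v))) (recent-sorted n (toℕ (pos σ v))) (∈-recent⁻ {i = toℕ (pos σ v)}) (∈-recent⁺ {j = pos σ p} p≺)
    where
    go : ∀ js → AllPairs (λ a b → b Fin.< a) js → (∀ {j} → j ∈ₗ js → j Fin.< pos σ v) → pos σ p ∈ₗ js →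
      lastNb G m (map (at σ) js) v ≡ toℕ p
    go (j ∷ js) _ _ (here refl) =
      trans (cong (λ b → if b then toℕ (at σ (pos σ p)) else lastNb G m (map (at σ) js) v)
              (bits⁺ (subst (λ w → v ∈ N G w) (sym (at-pos σ p)) (Graph.sym G p∈))))
            (cong toℕ (at-pos σ p))
    go (j ∷ js) (j> ∷ ps) j<v (there p∈js) =
      trans (cong (λ b → if b then toℕ (at σ j) else lastNb G m (map (at σ) js) v) (bits⁺′ not-nb)) (go js ps (j<v ∘ there) p∈js)
      where
      not-nb : v ∉ N G (at σ j)
      not-nb v∈ = ℕ.<⇒≱ (All.lookup j> p∈js) (subst (Fin._≤ pos σ p) (pos-at σ j)
        (max (at σ j) (Graph.sym G v∈) (subst (Fin._< pos σ v) (sym (pos-at σ j)) (j<v (here refl)))))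

  lastNb-first : ∀ {G m s} → Starts σ s → lastNb G m (before σ (pos σ s)) s ≡ m s
  lastNb-first {G} {m} {s} e = cong (λ k → lastNb G m (map (at σ) (recent n k)) s) e

crossing : ∀ {A : Set} {E : A → A → Set} {P : A → Set} → (∀ a → Dec (P a)) → ∀ {x y} → Star E x y → P x → ¬ P y →
  ∃₂ λ u w → E u w × P u × ¬ P w
crossing P? ε Px ¬Py = ⊥-elim (¬Py Px)
crossing P? (_◅_ {j = z} e walk) Px ¬Py with P? z
... | yes Pz = crossing P? walk Pz ¬Py
... | no ¬Pz = _ , z , e , Px , ¬Pz

module _ {n : ℕ} (G : Graph n) (π : Order n) where

  Parent? : ∀ v p → Dec (Parent G π v p)
  Parent? v p = ((p ∈? N G v) ×-dec (pos π p Fin.<? pos π v)) ×-dec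
    Fin.all? (λ w → (w ∈? N G v) Dec.→-dec ((pos π w Fin.<? pos π v) Dec.→-dec (pos π w Fin.≤? pos π p)))

  TreeEdge? : ∀ v u → Dec (Parent G π v u ⊎ Parent G π u v)
  TreeEdge? v u = Parent? v u ⊎-dec Parent? u v

  treeNeighbours : Fin n → Subset n
  treeNeighbours v = Vec.tabulate λ u → does (TreeEdge? v u)

  tree-edge : ∀ u v → u ∈ treeNeighbours v ⇔ (Parent G π v u ⊎ Parent G π u v)
  tree-edge u v = mk⇔
    (λ u∈ → does⇒ (TreeEdge? v u) (trans (sym (Vec.lookup∘tabulate (λ w → does (TreeEdge? v w)) u)) (Vec.[]=⇒lookup u∈)))
    (λ e → Vec.lookup⇒[]= u _ (trans (Vec.lookup∘tabulate (λ w → does (TreeEdge? v w)) u) (dec-true (TreeEdge? v u) e)))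

  tree : Graph n
  tree = record
    { N      = treeNeighbours
    ; sym    = λ {u} {v} u∈ → Equivalence.from (tree-edge v u) (Sum.swap (Equivalence.to (tree-edge u v) u∈))
    ; irrefl = λ v v∈ → case Equivalence.to (tree-edge v v) v∈ of λ
        { (inj₁ ((_ , lt) , _)) → ℕ.<-irrefl refl lt ; (inj₂ ((_ , lt) , _)) → ℕ.<-irrefl refl lt } }

module LexBFSOrder {n : ℕ} {G : Graph n} (s : Fin n) (ρ π : Order n) (connected : Connected G) (end : Ends ρ s)
  (history : History (λ ds → Ahead ρ (map (nb G) ds)) (reverse (toList π))) where

  ahead : ∀ i {y} → Unvisited π i y → y ≢ at π i → Ahead ρ (map (nb G) (before π i)) (at π i) y
  ahead i i≤y y≢ = Later-at π {i = i} (Trail-at π history i) i≤y y≢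

  starts : Starts π s
  starts = go (index-0 s)
    where
    go : (∃ λ (i : Fin n) → toℕ i ≡ 0) → Starts π s
    go (i , i≡0) with s Fin.≟ at π i
    ... | yes e = trans (cong (toℕ ∘ pos π) e) (trans (cong toℕ (pos-at π i)) i≡0)
    ... | no s≢ = case ahead i (subst (_≤ toℕ (pos π s)) (sym i≡0) z≤n) s≢ of λ
      { (inj₁ g) → ⊥-elim (no-Gt i i≡0 g) ; (inj₂ (_ , lt)) → ⊥-elim (ℕ.<⇒≱ lt (Ends-≼ ρ end (at π i))) }
      where
      no-Gt : ∀ i → toℕ i ≡ 0 → ∀ {x y} → ¬ Gt (map (nb G) (before π i)) x y
      no-Gt zero _ ()

  isLexBFS⁺ : IsLexBFS⁺ G s ρ π
  isLexBFS⁺ = LexLabels.isLexBFS⁺-intro G {s} {ρ} {π} starts end λ i w _ i≤w w≢ →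
    subst (λ 𝒮 → Ahead ρ 𝒮 (at π i) w) (sym (List.map-∘ (recent n (toℕ i)))) (ahead i i≤w w≢)

  -- A path from `s` to `v` leaves the set of vertices before `v` at some unvisited `y` with a
  -- visited neighbour. Without such a neighbour `v` could not have been preferred to `y`.
  earlier : ∀ v → v ≢ s → ∃ λ u → u ∈ N G v × u ≺[ π ] v
  earlier v v≢s with Fin.any? (λ u → (u ∈? N G v) ×-dec (pos π u Fin.<? pos π v))
  ... | yes found = found
  ... | no none with crossing (λ u → pos π u Fin.<? pos π v) (connected s v) s≺v (ℕ.<-irrefl refl)
    where
    s≺v : s ≺[ π ] v
    s≺v = ℕ.≤∧≢⇒< (subst (_≤ toℕ (pos π v)) (sym starts) z≤n) λ e → v≢s (pos-injective π (Fin.toℕ-injective (sym e)))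
  ...   | a , y , y∈a , a≺v , y⊀v = ⊥-elim (contra (subst (λ x → Ahead ρ (map (nb G) (before π (pos π v))) x y) (at-pos π v)
            (ahead (pos π v) (ℕ.≮⇒≥ y⊀v) λ e → none (a , subst (λ x → a ∈ N G x) (trans e (at-pos π v)) (Graph.sym G y∈a) , a≺v))))
    where
    contra : ¬ Ahead ρ (map (nb G) (before π (pos π v))) v y
    contra (inj₂ (p , _)) = none (a , Graph.sym G (∈-bits (sym (Eq-∈ {F = nb G} p (∈-before⁺ π {pos π v} a≺v))) y∈a) , a≺v)
    contra (inj₁ g) = witness (before π (pos π v)) (∈-before⁻ π (pos π v)) g
      where
      witness : ∀ bs → (∀ {b} → b ∈ₗ bs → b ≺[ π ] v) → ¬ Gt (map (nb G) bs) v y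
      witness (b ∷ bs) ≺v (inj₁ g)           = witness bs (≺v ∘ there) g
      witness (b ∷ bs) ≺v (inj₂ (_ , t , _)) = none (b , Graph.sym G (bits⁻ {S = N G b} {v} t) , ≺v (here refl))

  is𝓛Tree : Is𝓛Tree G π (tree G π) s
  is𝓛Tree = record { root = starts ; left = earlier ; edge = tree-edge G π }

-- Breadth first and depth first search of the tree

-- a occurs in ds no more recently than b does.
Older : ∀ {n} → List (Fin n) → Fin n → Fin n → Set
Older []       a b = ⊥
Older (d ∷ ds) a b = (b ≡ d × a ∈ₗ d ∷ ds) ⊎ Older ds a b

module TreeSearch {n : ℕ} {G : Graph n} {π : Order n} {T : Graph n} {s : Fin n} (is𝓛 : Is𝓛Tree G π T s)
  (Tie : Fin n → Fin n → Set) where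
  open Tree is𝓛
  open Ancestry G π

  -- A list sorted in this way serves both searches: as a queue for BFS, which takes its first
  -- vertex, and as a stack for DFS, which takes its last.
  Junior : List (Fin n) → Fin n → Fin n → Set
  Junior ds y z = ∀ {p r} → Parent G π y p → Parent G π z r → Older ds p r × (p ≡ r → Tie y z)

  -- q holds the unvisited vertices whose parent was visited, those with older
  -- parents first.
  record Frontier (ds q : List (Fin n)) : Set where
    field
      uniq   : Unique ds
      unique : Unique q
      fresh  : ∀ {v} → v ∈ₗ q → v ∉ₗ ds
      front⇒ : ∀ {v} → v ∈ₗ q → v ≡ s ⊎ ∃ λ p → Parent G π v p × p ∈ₗ ds
      front⇐ : ∀ {v p} → v ∉ₗ ds → Parent G π v p → p ∈ₗ ds → v ∈ₗ q
      root⇐  : s ∉ₗ ds → s ∈ₗ q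
      closed : ∀ {v p} → v ∈ₗ ds → Parent G π v p → p ∈ₗ ds
      sorted : AllPairs (Junior ds) q

  initial-frontier : Frontier [] (s ∷ [])
  initial-frontier = record
    { uniq = [] ; unique = [] ∷ [] ; fresh = λ _ () ; front⇒ = λ { (here e) → inj₁ e } ; front⇐ = λ _ _ ()
    ; root⇐ = λ _ → here refl ; closed = λ () ; sorted = [] ∷ [] }

  parent-visited : ∀ {ds q v p} → Frontier ds q → v ∈ₗ q → Parent G π v p → p ∈ₗ ds
  parent-visited F v∈ par with Frontier.front⇒ F v∈
  ... | inj₁ refl              = ⊥-elim (no-parent par)
  ... | inj₂ (p′ , par′ , p′∈) = subst (_∈ₗ _) (parent-unique par′ par) p′∈

  nonempty-frontier : ∀ {ds q v} → Frontier ds q → v ∉ₗ ds → ∃ (_∈ₗ q)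
  nonempty-frontier {ds} {q} {v} F = go (Anc-root v)
    where
    go : ∀ {v} → Anc G π s v → v ∉ₗ ds → ∃ (_∈ₗ q)
    go here v∉ = s , Frontier.root⇐ F v∉
    go {v} (up {p = p} par anc) v∉ with Any.any? (p Fin.≟_) ds
    ... | yes p∈ = v , Frontier.front⇐ F v∉ par p∈
    ... | no p∉  = go anc p∉

  -- The vertex `x` may be taken from any place. Its children have the most recent parent of all, so
  -- they belong at the end.
  extend-frontier : ∀ {ds x ch} q₁ q₂ → Frontier ds (q₁ ++ x ∷ q₂) → Unique ch → (∀ {w} → w ∈ₗ ch → Parent G π w x) →
    (∀ {w} → Parent G π w x → w ∈ₗ ch) → AllPairs Tie ch → Frontier (x ∷ ds) ((q₁ ++ q₂) ++ ch)
  extend-frontier {ds} {x} {ch} q₁ q₂ F uch ch⇒ ch⇐ tch = record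
    { uniq   = All.tabulate (λ { v∈ refl → fresh x∈q v∈ }) ∷ uniq
    ; unique = AllPairs-++⁺ (AllPairs-++⁺ u₁ (AllPairs.tail u₂) (λ y∈ z∈ → d y∈ (there z∈))) uch
        λ y∈ z∈ → λ { refl → fresh x∈q (parent-visited F (∈q y∈) (ch⇒ z∈)) }
    ; fresh  = fresh′
    ; front⇒ = λ v∈ → case ∈ₗ.∈-++⁻ (q₁ ++ q₂) v∈ of λ
        { (inj₁ v∈q) → Sum.map id (λ (p , par , p∈) → p , par , there p∈) (front⇒ (∈q v∈q))
        ; (inj₂ v∈ch) → inj₂ (x , ch⇒ v∈ch , here refl) }
    ; front⇐ = λ { v∉ par (here refl) → ∈ₗ.∈-++⁺ʳ (q₁ ++ q₂) (ch⇐ par)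
                 ; v∉ par (there p∈) → ∈ₗ.∈-++⁺ˡ (∈q′ (front⇐ (v∉ ∘ there) par p∈) λ { refl → v∉ (here refl) }) }
    ; root⇐  = λ s∉ → ∈ₗ.∈-++⁺ˡ (∈q′ (root⇐ (s∉ ∘ there)) λ { refl → s∉ (here refl) })
    ; closed = λ { (here refl) par → there (parent-visited F x∈q par) ; (there v∈) par → there (closed v∈ par) }
    ; sorted = AllPairs-++⁺
        (AllPairs-++⁺ (AllPairs.map older s₁) (AllPairs.map older (AllPairs.tail s₂)) (λ y∈ z∈ → older (e y∈ (there z∈))))
        (AllPairs-map∈ (λ y∈ z∈ t p r → case parent-unique p (ch⇒ y∈) of λ { refl → case parent-unique r (ch⇒ z∈) of λ
           { refl → inj₁ (refl , here refl) , λ _ → t } }) tch)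
        (λ y∈ z∈ p r → case parent-unique r (ch⇒ z∈) of λ { refl →
           inj₁ (refl , there (parent-visited F (∈q y∈) p)) ,
           λ { refl → ⊥-elim (fresh x∈q (parent-visited F (∈q y∈) p)) } })
    }
    where
    open Frontier F
    x∈q : x ∈ₗ q₁ ++ x ∷ q₂
    x∈q = ∈ₗ.∈-++⁺ʳ q₁ (here refl)
    u₁ = proj₁ (AllPairs-++⁻ q₁ unique)
    u₂ = proj₁ (proj₂ (AllPairs-++⁻ q₁ unique))
    d : ∀ {y z} → y ∈ₗ q₁ → z ∈ₗ x ∷ q₂ → y ≢ z
    d = proj₂ (proj₂ (AllPairs-++⁻ q₁ unique))
    s₁ = proj₁ (AllPairs-++⁻ q₁ sorted)
    s₂ = proj₁ (proj₂ (AllPairs-++⁻ q₁ sorted))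
    e : ∀ {y z} → y ∈ₗ q₁ → z ∈ₗ x ∷ q₂ → Junior ds y z
    e = proj₂ (proj₂ (AllPairs-++⁻ q₁ sorted))
    older : ∀ {y z} → Junior ds y z → Junior (x ∷ ds) y z
    older j p r = inj₂ (proj₁ (j p r)) , proj₂ (j p r)
    ∈q : ∀ {v} → v ∈ₗ q₁ ++ q₂ → v ∈ₗ q₁ ++ x ∷ q₂
    ∈q v∈ with ∈ₗ.∈-++⁻ q₁ v∈
    ... | inj₁ v∈₁ = ∈ₗ.∈-++⁺ˡ v∈₁
    ... | inj₂ v∈₂ = ∈ₗ.∈-++⁺ʳ q₁ (there v∈₂)
    ∈q′ : ∀ {v} → v ∈ₗ q₁ ++ x ∷ q₂ → v ≢ x → v ∈ₗ q₁ ++ q₂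
    ∈q′ v∈ v≢ with ∈ₗ.∈-++⁻ q₁ v∈
    ... | inj₁ v∈₁         = ∈ₗ.∈-++⁺ˡ v∈₁
    ... | inj₂ (here v≡x)  = ⊥-elim (v≢ v≡x)
    ... | inj₂ (there v∈₂) = ∈ₗ.∈-++⁺ʳ q₁ v∈₂
    x∉ : ∀ {v} → v ∈ₗ q₁ ++ q₂ → v ≢ x
    x∉ v∈ refl with ∈ₗ.∈-++⁻ q₁ v∈
    ... | inj₁ v∈₁ = d v∈₁ (here refl) refl
    ... | inj₂ v∈₂ = All.lookup (AllPairs.head u₂) v∈₂ refl
    fresh′ : ∀ {v} → v ∈ₗ (q₁ ++ q₂) ++ ch → v ∉ₗ x ∷ ds
    fresh′ v∈ v∈ds with ∈ₗ.∈-++⁻ (q₁ ++ q₂) v∈ | v∈ds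
    ... | inj₁ v∈q | here v≡x  = x∉ v∈q v≡x
    ... | inj₁ v∈q | there v∈′ = fresh (∈q v∈q) v∈′
    ... | inj₂ v∈ch | here refl = ℕ.<-irrefl refl (proj₂ (proj₁ (ch⇒ v∈ch)))
    ... | inj₂ v∈ch | there v∈′ = fresh x∈q (closed v∈′ (ch⇒ v∈ch))

pushChild : List Assignment
pushChild =
    20 ⟨ var 34 ⟩:= var 26
  ∷ 34 := inc (var 34)
  ∷ []

childBody pushChildren : Program
childBody = block nextArc ⨾ branch ((6 ⟦ var 26 ⟧) ≐ var 25) (block pushChild) skip
pushChildren = block (22 := 10 ⟦ var 25 ⟧ ∷ []) ⨾ while (lit 0 ⋖ var 22) childBody

-- The members of the adjacency list of x whose parent is x are appended to the
-- segment xs of array 20.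
module PushChildren {n : ℕ} (pc : Fin n → ℕ) (x : Fin n) (b : ℕ) (xs : List (Fin n)) where

  kids : List (Fin n) → List (Fin n)
  kids = filter (λ w → pc w ℕ.≟ toℕ x)

  record Inv (ws rem : List (Fin n)) (M : Store) : Set where
    field
      at-x    : M 25 0 ≡ toℕ x
      parents : ∀ v → M 6 (toℕ v) ≡ pc v
      linked  : Linked (M 24 0) (M 11) (M 12) (M 22 0) rem
      ys      : List (Fin n)
      seg     : Seg (M 20) b (xs ++ ys)
      tail    : M 34 0 ≡ b + length (xs ++ ys)
      shape   : ys ++ kids rem ≡ kids ws

  childBody-wp : ∀ {ws w rem M} → Inv ws (w ∷ rem) M → (0 <ᵇ M 22 0) ≡ true × wp childBody 7 (Inv ws rem) M
  childBody-wp {ws} {w} {rem} {M} I with Inv.linked I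
  ... | e , at-e , _ , src-e , rest = cong (0 <ᵇ_) at-e ,
    wp-seq (wp-block nextArc (wp-branch {k = 3}
      (λ t → wp-block pushChild record
        { at-x = at-x ; parents = parents ; linked = linked₁ ; ys = ys ∷ʳ w
        ; seg = subst (Seg (upd (M 20) (M 34 0) w′) b) (List.++-assoc xs ys (w ∷ []))
            (Seg-≗ ((xs ++ ys) ∷ʳ w) (λ j → upd-cong {M 20} {M 20} refl refl at-w) (Seg-snoc (xs ++ ys) tail seg))
        ; tail = trans (cong suc tail) (trans (sym (ℕ.+-suc b (length (xs ++ ys))))
            (cong (b +_) (trans (sym (trans (List.length-++ (xs ++ ys)) (ℕ.+-comm (length (xs ++ ys)) 1)))
              (cong length (List.++-assoc xs ys (w ∷ []))))))
        ; shape = trans (List.++-assoc ys (w ∷ []) (kids rem)) (trans (cong (ys ++_)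
            (sym (List.filter-accept (λ w → pc w ℕ.≟ toℕ x) (trans (sym pc-w) (trans (≡ᵇ-true⁻ {M 6 w′} t) at-x))))) shape)
        })
      (λ t → 1 , _ , skip , s≤s z≤n , record
        { at-x = at-x ; parents = parents ; linked = linked₁ ; ys = ys ; seg = seg ; tail = tail
        ; shape = trans (cong (ys ++_) (sym (List.filter-reject (λ w → pc w ℕ.≟ toℕ x)
            λ q → ≡ᵇ-false⁻ {M 6 w′} t (trans pc-w (trans q (sym at-x)))))) shape
        })))
    where
    open Inv I
    w′ : ℕ
    w′ = M 12 (pred (M 22 0))
    at-w : w′ ≡ toℕ w
    at-w = trans (cong (M 12 ∘ pred) at-e) src-e
    pc-w : M 6 w′ ≡ pc w
    pc-w = trans (cong (M 6) at-w) (parents w)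
    linked₁ : Linked (M 24 0) (M 11) (M 12) (M 11 (pred (M 22 0))) rem
    linked₁ = subst (λ k → Linked (M 24 0) (M 11) (M 12) (M 11 k) rem) (sym (cong pred at-e)) rest

  pushChildren-wp : ∀ {ws M} → M 25 0 ≡ toℕ x → (∀ v → M 6 (toℕ v) ≡ pc v) → LinkedAt M x ws → Seg (M 20) b xs →
    M 34 0 ≡ b + length xs →
    wp pushChildren (3 + length ws * 8) (λ M′ → Seg (M′ 20) b (xs ++ kids ws) × M′ 34 0 ≡ b + length (xs ++ kids ws)) M
  pushChildren-wp {ws} {M} at-x parents linked seg tail =
    wp-seq (wp-block (22 := 10 ⟦ var 25 ⟧ ∷ []) (wp-mono ℕ.≤-refl
      (λ {M′} I → let module I = Inv I ; e = trans (sym (List.++-identityʳ I.ys)) I.shape in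
        subst (λ zs → Seg (M′ 20) b (xs ++ zs)) e I.seg , trans I.tail (cong (λ zs → b + length (xs ++ zs)) e))
      (wp-loop 7 (Inv ws) childBody-wp (λ I → cong (0 <ᵇ_) (Inv.linked I)) ws (record
        { at-x = at-x ; parents = parents
        ; linked = subst (λ k → Linked (M 24 0) (M 11) (M 12) (M 10 k) ws) (sym at-x) linked
        ; ys = [] ; seg = subst (Seg (M 20) b) (sym (List.++-identityʳ xs)) seg
        ; tail = trans tail (cong (λ zs → b + length zs) (sym (List.++-identityʳ xs))) ; shape = refl }))))

-- BFS fills array 7 from the back, so that it contains the reverse order `β` directly. The index 21
-- doubles as the front of the queue, as every visited vertex has been taken from it exactly once.
startBFS nextBFS startDFS nextDFS : List Assignment
startBFS =
    20 ⟨ lit 0 ⟩:= 0 ⟦ lit 1 ⟧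
  ∷ 34 := lit 1
  ∷ 21 := lit 0
  ∷ 35 := var 0
  ∷ []
nextBFS =
    25 := 20 ⟦ var 21 ⟧
  ∷ 35 := dec (var 35)
  ∷ 7 ⟨ var 35 ⟩:= var 25
  ∷ []
startDFS =
    20 ⟨ lit 0 ⟩:= 0 ⟦ lit 1 ⟧
  ∷ 34 := lit 1
  ∷ 21 := lit 0
  ∷ []
nextDFS =
    34 := dec (var 34)
  ∷ 25 := 20 ⟦ var 34 ⟧
  ∷ 4 ⟨ var 21 ⟩:= var 25
  ∷ []

bfsBody dfsBody breadthFirst depthFirst : Program
bfsBody = block nextBFS ⨾ pushChildren ⨾ next-i
dfsBody = block nextDFS ⨾ pushChildren ⨾ next-i
breadthFirst = block startBFS ⨾ while (var 21 ⋖ var 0) bfsBody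
depthFirst = block startDFS ⨾ while (var 21 ⋖ var 0) dfsBody

-- us is the order in which the adjacency lists are sorted, pc v is the number
-- of the parent of v.
module Traverse {n : ℕ} {G : Graph n} {π : Order n} {T : Graph n} {s : Fin n} (L : AdjacencyLists G)
  (is𝓛 : Is𝓛Tree G π T s) (pc : Fin n → ℕ)
  (pc⇒ : ∀ {w x} → pc w ≡ toℕ x → Parent G π w x) (pc⇐ : ∀ {w x} → Parent G π w x → pc w ≡ toℕ x)
  (Tie : Fin n → Fin n → Set) (us : List (Fin n)) (all-us : ∀ v → v ∈ₗ us) (unique-us : Unique us) (tied : AllPairs Tie us) where
  open Accounting L
  open TreeSearch is𝓛 Tie public

  kids : Fin n → List (Fin n)
  kids x = filter (λ w → pc w ℕ.≟ toℕ x) (nbrs G us x)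

  extend : ∀ {ds x} q₁ q₂ → Frontier ds (q₁ ++ x ∷ q₂) → Frontier (x ∷ ds) ((q₁ ++ q₂) ++ kids x)
  extend {x = x} q₁ q₂ F = extend-frontier q₁ q₂ F (filtered unique-us)
    (λ w∈ → pc⇒ (proj₂ (∈ₗ.∈-filter⁻ (λ w → pc w ℕ.≟ toℕ x) {xs = nbrs G us x} w∈)))
    (λ par → ∈ₗ.∈-filter⁺ (λ w → pc w ℕ.≟ toℕ x)
      (∈-nbrs⁺ {L = L} {us = us} (all-us _) (Graph.sym G (proj₁ (proj₁ par)))) (pc⇐ par))
    (filtered tied)
    where
    filtered : ∀ {R : Fin n → Fin n → Set} → AllPairs R us → AllPairs R (kids x)
    filtered r = AllPairs.filter⁺ (λ w → pc w ℕ.≟ toℕ x) (AllPairs.filter⁺ (λ u → x ∈? N G u) r)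

  Rooted : List (Fin n) → Fin n → Set
  Rooted ds d = ∀ {p} → Parent G π d p → p ∈ₗ ds

  BFSStep DFSStep : List (Fin n) → Fin n → Set
  BFSStep ds d = Rooted ds d × (∀ {y} → y ∉ₗ d ∷ ds → ∀ {p r} → Parent G π d p → Parent G π y r → r ∈ₗ ds → Older ds p r)
  DFSStep ds d = Rooted ds d × (∀ {y} → y ∉ₗ d ∷ ds → ∀ {p r} → Parent G π d p → Parent G π y r → r ∈ₗ ds →
    Older ds r p × (r ≡ p → Tie y d))

  bfs-step : ∀ {ds x q} → Frontier ds (x ∷ q) → BFSStep ds x
  bfs-step F = parent-visited F (here refl) , λ y∉ px pr r∈ → case front⇐ (y∉ ∘ there) pr r∈ of λ
    { (here refl) → ⊥-elim (y∉ (here refl)) ; (there y∈) → proj₁ (All.lookup (AllPairs.head sorted) y∈ px pr) }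
    where open Frontier F

  dfs-step : ∀ {ds x} q → Frontier ds (q ++ x ∷ []) → DFSStep ds x
  dfs-step q F = parent-visited F (∈ₗ.∈-++⁺ʳ q (here refl)) , λ y∉ px pr r∈ →
    case ∈ₗ.∈-++⁻ q (front⇐ (y∉ ∘ there) pr r∈) of λ
      { (inj₁ y∈) → proj₂ (proj₂ (AllPairs-++⁻ q sorted)) y∈ (here refl) pr px
      ; (inj₂ (here refl)) → ⊥-elim (y∉ (here refl)) }
    where open Frontier F

  record Progress (Q : List (Fin n) → Fin n → Set) (ds q rem : List (Fin n)) : Set where
    field
      frontier : Frontier ds q
      trail    : Trail Q ds
      rem-uniq : Unique rem
      rem⇒     : ∀ {v} → v ∈ₗ rem → v ∉ₗ ds
      rem⇐     : ∀ {v} → v ∉ₗ ds → v ∈ₗ rem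
      count    : length ds + length rem ≡ n

  initial-progress : ∀ {Q} → Progress Q [] (s ∷ []) us
  initial-progress = record
    { frontier = initial-frontier ; trail = tt ; rem-uniq = unique-us ; rem⇒ = λ _ () ; rem⇐ = λ _ → all-us _
    ; count = sym (unique-length unique-us all-us) }

  advance : ∀ {Q ds x rem} q₁ q₂ → Progress Q ds (q₁ ++ x ∷ q₂) rem → Q ds x →
    ∃ λ rem′ → x ∷ rem′ ↭ rem × Progress Q (x ∷ ds) ((q₁ ++ q₂) ++ kids x) rem′
  advance {ds = ds} {x} q₁ q₂ P Qx
    with ∈ₗ.∈-∃++ (Progress.rem⇐ P (Frontier.fresh (Progress.frontier P) (∈ₗ.∈-++⁺ʳ q₁ (here refl))))
  ... | as , bs , refl with AllPairs-++⁻ as (Progress.rem-uniq P)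
  ...   | u₁ , x∉bs ∷ u₂ , d = as ++ bs , ↭-sym (↭.shift x as bs) , record
    { frontier = extend q₁ q₂ frontier
    ; trail = Qx , trail
    ; rem-uniq = AllPairs-++⁺ u₁ u₂ (λ a∈ b∈ → d a∈ (there b∈))
    ; rem⇒ = λ v∈ → λ
        { (here refl) → case ∈ₗ.∈-++⁻ as v∈ of λ { (inj₁ v∈as) → d v∈as (here refl) refl ; (inj₂ v∈bs) → All.lookup x∉bs v∈bs refl }
        ; (there v∈ds) → rem⇒ (↭.∈-resp-↭ (↭-sym (↭.shift x as bs)) (there v∈)) v∈ds }
    ; rem⇐ = λ v∉ → case ↭.∈-resp-↭ (↭.shift x as bs) (rem⇐ (v∉ ∘ there)) of λ
        { (here refl) → ⊥-elim (v∉ (here refl)) ; (there v∈) → v∈ }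
    ; count = trans (sym (ℕ.+-suc (length ds) _)) (trans (cong (length ds +_) (sym (↭.↭-length (↭.shift x as bs)))) count)
    }
    where open Progress P

  module _ {ρ : Order n} where

    -- `b` is the cell of array 20 where `q` begins: the number of visited vertices for the queue,
    -- and 0 for the stack.
    record Common (ds q rem : List (Fin n)) (Q : List (Fin n) → Fin n → Set) (b : ℕ) (M : Store) : Set where
      field
        progress : Progress Q ds q rem
        index    : M 21 0 ≡ length ds
        seg      : Seg (M 20) b q
        tail     : M 34 0 ≡ b + length q
        input    : Input L s ρ M
        linked   : ∀ w → LinkedAt M w (nbrs G us w)
        parents  : ∀ v → M 6 (toℕ v) ≡ pc v

    common-test : ∀ {ds q y ys Q b M} → Common ds q (y ∷ ys) Q b M → (M 21 0 <ᵇ M 0 0) ≡ true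
    common-test {ds} {M = M} C = trans (cong (M 21 0 <ᵇ_) (Input.size input))
      (<ᵇ-true (subst (M 21 0 <_) (trans (cong (_+ _) index) (Progress.count progress)) (ℕ.m<m+n _ (s≤s z≤n))))
      where open Common C

    common-stop : ∀ {ds q Q b M} → Common ds q [] Q b M → (M 21 0 <ᵇ M 0 0) ≡ false
    common-stop {ds} {M = M} C = trans (cong (M 21 0 <ᵇ_) (Input.size input))
      (<ᵇ-false (ℕ.≤-reflexive (trans (sym (Progress.count progress)) (trans (ℕ.+-identityʳ (length ds)) (sym index)))))
      where open Common C

    cost-kids : ∀ x → 4 + ((3 + length (nbrs G us x) * 8) + 2) ≤ 17 * weight x
    cost-kids x = ℕ.≤-trans (ℕ.≤-reflexive (cong (7 +_) (ℕ.+-comm (length (nbrs G us x) * 8) 2)))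
      (ℕ.≤-trans (ℕ.+-monoʳ-≤ 9 (ℕ.*-monoˡ-≤ 8 (nbrs-length {L = L} x unique-us))) (affine-≤ 9 8 (deg x)))

    BFSInv : List (Fin n) → Store → Set
    BFSInv rem M = ∃₂ λ ds q → Common ds q rem BFSStep (length ds) M × Seg (M 7) (M 35 0) ds × M 35 0 + length ds ≡ n

    bfsBody-wp : ∀ {y ys M} → BFSInv (y ∷ ys) M → (M 21 0 <ᵇ M 0 0) ≡ true ×
      ∃ λ x → wp bfsBody (17 * weight x) (λ M′ → ∃ λ rem → x ∷ rem ↭ y ∷ ys × BFSInv rem M′) M
    bfsBody-wp {y} {ys} {M} (ds , q , C , β-seg , β-count) =
      common-test C , go q C (proj₂ (nonempty-frontier (Progress.frontier (Common.progress C)) (Progress.rem⇒ (Common.progress C) (here refl))))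
      where
      go : ∀ {z} q → Common ds q (y ∷ ys) BFSStep (length ds) M → z ∈ₗ q →
        ∃ λ x → wp bfsBody (17 * weight x) (λ M′ → ∃ λ rem → x ∷ rem ↭ y ∷ ys × BFSInv rem M′) M
      go (x ∷ q) C _ = x , wp-mono (cost-kids x) id (wp-seq (wp-block nextBFS (wp-seq (wp-after
        (PushChildren.pushChildren-wp pc x (suc (length ds)) q {nbrs G us x} at-x parents (linked x) (proj₂ seg)
          (trans tail (ℕ.+-suc (length ds) (length q))))
        λ {M₂} f (seg′ , tail′) → wp-block (21 := inc (var 21) ∷ []) (case advance [] q progress (bfs-step (Progress.frontier progress)) of λ
          (rem , perm , P) → rem , perm , x ∷ ds , q ++ kids x , record
          { progress = P
          ; index = cong suc (trans (f 21 refl 0) index)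
          ; seg = seg′ ; tail = tail′
          ; input = Input-≗ (f 0 refl) (f 1 refl) (f 2 refl) (f 3 refl) input
          ; linked = λ w → LinkedAt-frame {P = pushChildren} {M₁} {M₂} {w} {nbrs G us w} f refl refl refl refl (linked w)
          ; parents = λ v → trans (f 6 refl _) (parents v) } ,
          subst (λ k → Seg (M₂ 7) k (x ∷ ds)) (sym (f 35 refl 0))
            (trans (f 7 refl r) (trans (upd-same {M 7} {r} refl) at-x) ,
             Seg-≗ ds (f 7 refl) (Seg-upd ds (inj₁ ℕ.≤-refl) (subst (λ k → Seg (M 7) k ds) r≡ β-seg))) ,
          trans (cong (_+ suc (length ds)) (f 35 refl 0))
            (trans (ℕ.+-suc r (length ds)) (trans (cong (_+ length ds) (sym r≡)) β-count)))))))
        where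
        open Common C
        M₁ : Store
        M₁ = run nextBFS M
        r : ℕ
        r = pred (M 35 0)
        r≡ : M 35 0 ≡ suc r
        r≡ = sym (ℕ.suc-pred (M 35 0) {{ℕ.≢-nonZero λ e → ℕ.<-irrefl (trans (cong (_+ length ds) (sym e)) β-count)
          (subst (length ds <_) (Progress.count progress) (ℕ.m<m+n (length ds) (s≤s z≤n)))}})
        at-x : M 20 (M 21 0) ≡ toℕ x
        at-x = trans (cong (M 20) index) (proj₁ seg)

    breadthFirst-wp : ∀ {M} → Input L s ρ M → (∀ w → LinkedAt M w (nbrs G us w)) → (∀ v → M 6 (toℕ v) ≡ pc v) →
      wp breadthFirst (5 + suc (18 * total)) (λ M′ → ∃ λ ds → Unique ds × (∀ v → v ∈ₗ ds) × Trail BFSStep ds × Seg (M′ 7) 0 ds) M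
    breadthFirst-wp {M} input linked parents = wp-seq (wp-block startBFS
      (wp-mono (s≤s (sum-weights-≤ 17 unique-us all-us)) finish
        (wp-while-↭ BFSInv (λ v → 17 * weight v) bfsBody-wp (λ (_ , _ , C , _) → common-stop C) us
          ([] , s ∷ [] , record
            { progress = initial-progress ; index = refl ; seg = Input.root input , tt ; tail = refl
            ; input = Input-≗ (λ _ → refl) (λ _ → refl) (λ _ → refl) (λ _ → refl) input
            ; linked = linked ; parents = parents } , tt , trans (ℕ.+-identityʳ (M 0 0)) (Input.size input)))))
      where
      finish : ∀ {M′} → BFSInv [] M′ → ∃ λ ds → Unique ds × (∀ v → v ∈ₗ ds) × Trail BFSStep ds × Seg (M′ 7) 0 ds
      finish {M′} (ds , q , C , β-seg , β-count) = ds , Frontier.uniq frontier , all , trail ,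
        subst (λ k → Seg (M′ 7) k ds) (ℕ.+-cancelʳ-≡ (length ds) (M′ 35 0) 0
          (trans β-count (trans (sym count) (ℕ.+-identityʳ (length ds))))) β-seg
        where
        open Progress (Common.progress C)
        all : ∀ v → v ∈ₗ ds
        all v with Any.any? (v Fin.≟_) ds
        ... | yes v∈ = v∈
        ... | no v∉ with () ← rem⇐ v∉

    DFSInv : List (Fin n) → Store → Set
    DFSInv rem M = ∃₂ λ ds q → Common ds q rem DFSStep 0 M × Seg (M 4) 0 (reverse ds)

    dfsBody-wp : ∀ {y ys M} → DFSInv (y ∷ ys) M → (M 21 0 <ᵇ M 0 0) ≡ true ×
      ∃ λ x → wp dfsBody (17 * weight x) (λ M′ → ∃ λ rem → x ∷ rem ↭ y ∷ ys × DFSInv rem M′) M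
    dfsBody-wp {y} {ys} {M} (ds , q , C , σ-seg) =
      common-test C , go q C (proj₂ (nonempty-frontier (Progress.frontier (Common.progress C)) (Progress.rem⇒ (Common.progress C) (here refl))))
      where
      go : ∀ {z} q → Common ds q (y ∷ ys) DFSStep 0 M → z ∈ₗ q →
        ∃ λ x → wp dfsBody (17 * weight x) (λ M′ → ∃ λ rem → x ∷ rem ↭ y ∷ ys × DFSInv rem M′) M
      go q C z∈ with List.initLast q
      go .[] C () | List.[]
      go .(q ++ x ∷ []) C _ | q List.∷ʳ′ x = x , wp-mono (cost-kids x) id (wp-seq (wp-block nextDFS (wp-seq (wp-after
        (PushChildren.pushChildren-wp pc x 0 q {nbrs G us x} at-x parents (linked x) (proj₁ (Seg-++⁻ q seg)) tail₁)
        λ {M₂} f (seg′ , tail′) → wp-block (21 := inc (var 21) ∷ []) (case advance q [] progress (dfs-step q (Progress.frontier progress)) of λ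
          (rem , perm , P) → rem , perm , x ∷ ds , q ++ kids x , record
          { progress = subst (λ zs → Progress DFSStep (x ∷ ds) (zs ++ kids x) rem) (List.++-identityʳ q) P
          ; index = cong suc (trans (f 21 refl 0) index)
          ; seg = seg′ ; tail = tail′
          ; input = Input-≗ (f 0 refl) (f 1 refl) (f 2 refl) (f 3 refl) input
          ; linked = λ w → LinkedAt-frame {P = pushChildren} {M₁} {M₂} {w} {nbrs G us w} f refl refl refl refl (linked w)
          ; parents = λ v → trans (f 6 refl _) (parents v) } ,
          subst (Seg (M₂ 4) 0) (sym (List.unfold-reverse x ds))
            (Seg-≗ (reverse ds ∷ʳ x) (λ j → trans (f 4 refl j) (upd-cong {M 4} {M 4} refl refl at-x))
              (Seg-snoc (reverse ds) (trans index (sym (List.length-reverse ds))) σ-seg)))))))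
        where
        open Common C
        M₁ : Store
        M₁ = run nextDFS M
        tail₁ : pred (M 34 0) ≡ length q
        tail₁ = cong pred (trans tail (trans (List.length-++ q) (ℕ.+-comm (length q) 1)))
        at-x : M 20 (pred (M 34 0)) ≡ toℕ x
        at-x = trans (cong (M 20) tail₁) (proj₁ (proj₂ (Seg-++⁻ q seg)))

    depthFirst-wp : ∀ {M} → Input L s ρ M → (∀ w → LinkedAt M w (nbrs G us w)) → (∀ v → M 6 (toℕ v) ≡ pc v) →
      wp depthFirst (4 + suc (18 * total)) (λ M′ → ∃ λ ds → Unique ds × (∀ v → v ∈ₗ ds) × Trail DFSStep ds × Seg (M′ 4) 0 (reverse ds)) M
    depthFirst-wp {M} input linked parents = wp-seq (wp-block startDFS
      (wp-mono (s≤s (sum-weights-≤ 17 unique-us all-us)) finish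
        (wp-while-↭ DFSInv (λ v → 17 * weight v) dfsBody-wp (λ (_ , _ , C , _) → common-stop C) us
          ([] , s ∷ [] , record
            { progress = initial-progress ; index = refl ; seg = Input.root input , tt ; tail = refl
            ; input = Input-≗ (λ _ → refl) (λ _ → refl) (λ _ → refl) (λ _ → refl) input
            ; linked = linked ; parents = parents } , tt))))
      where
      finish : ∀ {M′} → DFSInv [] M′ → ∃ λ ds → Unique ds × (∀ v → v ∈ₗ ds) × Trail DFSStep ds × Seg (M′ 4) 0 (reverse ds)
      finish {M′} (ds , q , C , σ-seg) = ds , Frontier.uniq frontier , all , trail , σ-seg
        where
        open Progress (Common.progress C)
        all : ∀ v → v ∈ₗ ds
        all v with Any.any? (v Fin.≟_) ds
        ... | yes v∈ = v∈
        ... | no v∉ with () ← rem⇐ v∉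

-- Refinement along the reverse breadth first order

loadβ unflag : List Assignment
loadβ = 25 := 7 ⟦ var 21 ⟧ ∷ []
unflag =
    18 ⟨ var 25 ⟩:= lit 0
  ∷ 21 := inc (var 21)
  ∷ []

-- LexBFS leaves every flag at 1. A flag is cleared once the round of its vertex is over, so the
-- unflagged neighbours of the current vertex are those before it in `β`, as the refining set
-- requires.
rankBody rankAll : Program
rankBody = block loadβ ⨾ refineBy ⨾ block unflag
rankAll = block (21 := lit 0 ∷ []) ⨾ while (var 21 ⋖ var 0) rankBody

module RankAll {n : ℕ} {G : Graph n} (L : AdjacencyLists G) (s : Fin n) (ρ β : Order n) where
  open Accounting L

  ρ⁻ : List (Fin n)
  ρ⁻ = reverse (toList ρ)

  record Inv (us : List (Fin n)) (M : Store) : Set where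
    field
      bs       : List (Fin n)
      shape    : reverse bs ++ us ≡ toList β
      l        : List (Fin n)
      part     : Partition ρ (map (family G β) bs) l M
      all-l    : ∀ v → v ∈ₗ l
      index    : M 21 0 + length us ≡ n
      seg      : Seg (M 7) (M 21 0) us
      done     : ∀ {v} → v ∈ₗ bs → M 18 (toℕ v) ≡ 0
      waiting  : ∀ {v} → v ∉ₗ bs → M 18 (toℕ v) ≡ 1
      input    : Input L s ρ M
      linked   : ∀ w → LinkedAt M w (nbrs G ρ⁻ w)

  rankBody-wp : ∀ {u us M} → Inv (u ∷ us) M → (M 21 0 <ᵇ M 0 0) ≡ true × wp rankBody (37 * weight u) (Inv us) M
  rankBody-wp {u} {us} {M} I =
    trans (cong (M 21 0 <ᵇ_) (Input.size input)) (<ᵇ-true (subst (M 21 0 <_) index (ℕ.m<m+n _ (s≤s z≤n)))) ,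
    wp-mono cost id (wp-seq (wp-block loadβ (wp-seq (wp-after
      (RefineBy.refineBy-wp {ρ = ρ} {map (family G β) bs} {l} {u} {nbrs G ρ⁻ u} flag (λ v → M 19 (toℕ v)) S S⇒ S⇐ {M₁}
        part (proj₁ seg) (linked u) desc (λ _ → refl) (λ _ → refl))
      λ {M₂} f ((l′ , perm , P) , _) → wp-block unflag record
      { bs      = u ∷ bs
      ; shape   = trans (cong (_++ us) (List.unfold-reverse u bs)) (trans (List.++-assoc (reverse bs) (u ∷ []) us) shape)
      ; l       = l′
      ; part    = Partition-cong ρ M₂ (λ {a} _ → S-family a) P
      ; all-l   = λ v → ↭.∈-resp-↭ (↭-sym perm) (all-l v)
      ; index   = trans (cong (λ k → suc k + length us) (f 21 refl 0)) (trans (sym (ℕ.+-suc _ (length us))) index)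
      ; seg     = Seg-≗ us (f 7 refl) (subst (λ k → Seg (M 7) k us) (cong suc (sym (f 21 refl 0))) (proj₂ seg))
      ; done    = λ { (here refl) → upd-same {M₂ 18} (sym (trans (f 25 refl 0) (proj₁ seg)))
                    ; {v} (there v∈) → trans (upd-other {M₂ 18} λ e → u∉bs (subst (_∈ₗ bs)
                        (Fin.toℕ-injective (trans e (trans (f 25 refl 0) (proj₁ seg)))) v∈)) (trans (f 18 refl (toℕ v)) (done v∈)) }
      ; waiting = λ {v} v∉ → trans (upd-other {M₂ 18} λ e → v∉ (here (Fin.toℕ-injective (trans e (trans (f 25 refl 0) (proj₁ seg))))))
          (trans (f 18 refl (toℕ v)) (waiting (v∉ ∘ there)))
      ; input   = Input-≗ (f 0 refl) (f 1 refl) (f 2 refl) (f 3 refl) input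
      ; linked  = λ w → LinkedAt-frame {P = refineBy} {M₁} {M₂} {w} {nbrs G ρ⁻ w} f refl refl refl refl (linked w)
      }))))
    where
    open Inv I
    M₁ : Store
    M₁ = run loadβ M
    flag : Fin n → ℕ
    flag v = M 18 (toℕ v)
    S : Fin n → Bool
    S a = nb G u a ∧ (flag a ≡ᵇ 0)
    desc : AllPairs (λ a b → b ≺[ ρ ] a) (nbrs G ρ⁻ u)
    desc = AllPairs.filter⁺ (λ v → u ∈? N G v) (AllPairs-reverse (AllPairs-toList⁺ ρ id))
    β-cut = AllPairs-++⁻ (reverse bs) (subst (AllPairs (λ a b → a ≺[ β ] b)) (sym shape) (AllPairs-toList⁺ β id))
    before-u : ∀ {a} → a ∈ₗ bs → a ≺[ β ] u
    before-u a∈ = proj₂ (proj₂ β-cut) (Any.reverse⁺ a∈) (here refl)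
    u∉bs : u ∉ₗ bs
    u∉bs u∈ = ℕ.<-irrefl refl (before-u u∈)
    u-before : ∀ {a} → a ≺[ β ] u → a ∈ₗ bs
    u-before {a} a≺ with ∈ₗ.∈-++⁻ (reverse bs) (subst (a ∈ₗ_) (sym shape) (∈-toList β a))
    ... | inj₁ a∈            = Any.reverse⁻ a∈
    ... | inj₂ (here refl)   = ⊥-elim (ℕ.<-irrefl refl a≺)
    ... | inj₂ (there a∈)    = ⊥-elim (ℕ.<-asym a≺ (All.lookup (AllPairs.head (proj₁ (proj₂ β-cut))) a∈))
    flag-0 : ∀ {a} → flag a ≡ 0 → a ∈ₗ bs
    flag-0 {a} e with Any.any? (a Fin.≟_) bs
    ... | yes a∈ = a∈
    ... | no a∉ with () ← trans (sym (waiting a∉)) e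
    S⇒ : ∀ {a} → S a ≡ true → a ∈ₗ nbrs G ρ⁻ u × flag a ≡ 0 × a ∈ₗ l
    S⇒ {a} e with a ∈? N G u | flag a ≡ᵇ 0 in t
    ... | yes a∈ | true = ∈-nbrs⁺ {L = L} {us = ρ⁻} (Any.reverse⁺ (∈-toList ρ a)) a∈ , ≡ᵇ-true⁻ t , all-l a
    S⇐ : ∀ {a} → a ∈ₗ nbrs G ρ⁻ u → flag a ≡ 0 → S a ≡ true
    S⇐ {a} a∈ e = cong₂ _∧_ (bits⁺ (proj₂ (∈-nbrs⁻ {L = L} {us = ρ⁻} a∈))) (≡ᵇ-true e)
    S-family : ∀ a → S a ≡ family G β u a
    S-family a with S a in e | family G β u a in e′
    ... | true  | true  = refl
    ... | false | false = refl
    ... | true  | false = trans (sym (family⁺ G β (proj₂ (∈-nbrs⁻ {L = L} {us = ρ⁻} (proj₁ (S⇒ e)))) (before-u (flag-0 (proj₁ (proj₂ (S⇒ e))))))) e′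
    ... | false | true  with family⁻ G β {u} {a} e′
    ...   | a∈ , a≺ = trans (sym e) (S⇐ (∈-nbrs⁺ {L = L} {us = ρ⁻} (Any.reverse⁺ (∈-toList ρ a)) a∈) (done (u-before a≺)))
    len : ℕ
    len = length (nbrs G ρ⁻ u)
    cost : 2 + ((4 + len * 28) + 3) ≤ 37 * weight u
    cost = ℕ.≤-trans (ℕ.≤-reflexive (cong (6 +_) (ℕ.+-comm (len * 28) 3)))
      (ℕ.≤-trans (ℕ.+-monoʳ-≤ 9 (ℕ.*-monoˡ-≤ 28 (nbrs-length {L = L} u (unique-reverse (toList-unique ρ))))) (affine-≤ 9 28 (deg u)))

  rankAll-wp : ∀ {M} → Partition ρ [] ρ⁻ M → Input L s ρ M → (∀ w → LinkedAt M w (nbrs G ρ⁻ w)) →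
    (∀ v → M 18 (toℕ v) ≡ 1) → Seg (M 7) 0 (toList β) →
    wp rankAll (3 + 38 * total) (λ M′ → ∃ λ l → Partition ρ (ranking G β) l M′ × (∀ v → v ∈ₗ l)) M
  rankAll-wp {M} P input linked flags seg = wp-seq (wp-block (21 := lit 0 ∷ []) (wp-mono ℕ.≤-refl finish
    (wp-vertices 37 Inv rankBody-wp
      (λ {M′} I → trans (cong (M′ 21 0 <ᵇ_) (Input.size (Inv.input I)))
        (<ᵇ-false (ℕ.≤-reflexive (trans (sym (Inv.index I)) (ℕ.+-identityʳ (M′ 21 0))))))
      (toList-unique β) (∈-toList β) (record
        { bs = [] ; shape = refl ; l = ρ⁻ ; part = P ; all-l = λ v → Any.reverse⁺ (∈-toList ρ v)
        ; index = List.length-tabulate (at β) ; seg = seg ; done = λ () ; waiting = λ {v} _ → flags v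
        ; input = Input-≗ (λ _ → refl) (λ _ → refl) (λ _ → refl) (λ _ → refl) input ; linked = linked }))))
    where
    finish : ∀ {M′} → Inv [] M′ → ∃ λ l → Partition ρ (ranking G β) l M′ × (∀ v → v ∈ₗ l)
    finish {M′} I = l , subst (λ bs → Partition ρ (map (family G β) bs) l M′)
      (trans (sym (List.reverse-involutive bs)) (cong reverse (trans (sym (List.++-identityʳ (reverse bs))) shape))) part , all-l
      where open Inv I

startWrite writeVertex : List Assignment
startWrite =
    8 ⟨ dec (var 0) ⟩:= 0 ⟦ lit 1 ⟧
  ∷ 9 ⟨ lit 0 ⟩:= 0 ⟦ lit 1 ⟧
  ∷ 10 ⟨ lit 0 ⟩:= lit 0
  ∷ 22 := 13 ⟦ lit 0 ⟧
  ∷ 21 := lit 1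
  ∷ 35 := dec (var 0)
  ∷ []
writeVertex =
    26 := dec (var 22)
  ∷ 35 := dec (var 35)
  ∷ 8 ⟨ var 35 ⟩:= var 26
  ∷ 9 ⟨ var 21 ⟩:= var 26
  ∷ 10 ⟨ var 21 ⟩:= lit 0
  ∷ 22 := 13 ⟦ var 22 ⟧
  ∷ 21 := inc (var 21)
  ∷ []

-- Writes s, followed by the list without its last element s, to array 9 and
-- the reverse of this to array 8, and clears array 10.
writeOut : Program
writeOut = block startWrite ⨾ while (var 21 ⋖ var 0) (block writeVertex)

module WriteOut {n : ℕ} (s : Fin n) (rest : List (Fin n)) (size : suc (length rest) ≡ n) where

  record Inv (us : List (Fin n)) (M : Store) : Set where
    field
      bs     : List (Fin n)
      shape  : reverse bs ++ us ≡ rest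
      doubly : Doubly (M 13) (M 14) (rest ++ s ∷ [])
      n≡     : M 0 0 ≡ n
      index  : M 21 0 ≡ suc (length bs)
      count  : M 21 0 + length us ≡ n
      down   : M 35 0 ≡ length us
      link   : M 22 0 ≡ headCode (us ++ s ∷ [])
      τ-seg  : Seg (M 8) (M 35 0) (bs ++ s ∷ [])
      a-seg  : Seg (M 9) 0 (s ∷ reverse bs)
      clear  : ∀ {j} → j < M 21 0 → M 10 j ≡ 0

  writeVertex-run : ∀ {u us M} → Inv (u ∷ us) M → Inv us (run writeVertex M)
  writeVertex-run {u} {us} {M} I = record
    { bs     = u ∷ bs
    ; shape  = trans (cong (_++ us) (List.unfold-reverse u bs)) (trans (List.++-assoc (reverse bs) (u ∷ []) us) shape)
    ; doubly = doubly
    ; n≡     = n≡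
    ; index  = cong suc index
    ; count  = trans (sym (ℕ.+-suc (M 21 0) (length us))) count
    ; down   = cong pred down
    ; link   = trans (cong (M 13) link) (Doubly-next {g = M 14} (reverse bs)
        (subst (Doubly (M 13) (M 14)) (trans (cong (_++ s ∷ []) (sym shape)) (List.++-assoc (reverse bs) (u ∷ us) (s ∷ []))) doubly))
    ; τ-seg  = trans (upd-same {M 8} {pred (M 35 0)} refl) at-u ,
        Seg-upd (bs ++ s ∷ []) (inj₁ ℕ.≤-refl) (subst (λ k → Seg (M 8) k (bs ++ s ∷ []))
          (trans down (cong suc (sym (cong pred down)))) τ-seg)
    ; a-seg  = subst (Seg (upd (M 9) (M 21 0) (pred (M 22 0))) 0) (cong (s ∷_) (sym (List.unfold-reverse u bs)))
        (Seg-≗ (s ∷ reverse bs ∷ʳ u) (λ j → upd-cong {M 9} {M 9} refl refl at-u)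
          (Seg-snoc (s ∷ reverse bs) (trans index (cong suc (sym (List.length-reverse bs)))) a-seg))
    ; clear  = clear′
    }
    where
    open Inv I
    at-u : pred (M 22 0) ≡ toℕ u
    at-u = cong pred link
    clear′ : ∀ {j} → j < suc (M 21 0) → upd (M 10) (M 21 0) 0 j ≡ 0
    clear′ {j} (s≤s le) with ℕ.m≤n⇒m<n∨m≡n le
    ... | inj₂ e  = upd-same {M 10} e
    ... | inj₁ lt = trans (upd-other {M 10} (ℕ.<⇒≢ lt)) (clear lt)

  writeOut-wp : ∀ {M} → M 0 0 ≡ n → M 0 1 ≡ toℕ s → Doubly (M 13) (M 14) (rest ++ s ∷ []) →
    wp writeOut (8 + length rest * 9)
      (λ M′ → Seg (M′ 8) 0 (reverse (s ∷ rest)) × Seg (M′ 9) 0 (s ∷ rest) × (∀ (v : Fin n) → M′ 10 (toℕ v) ≡ 0)) M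
  writeOut-wp {M} n≡₀ root doubly₀ = wp-seq (wp-block startWrite (wp-mono ℕ.≤-refl finish
    (wp-loop 8 Inv
      (λ {u} {us} {M′} I → trans (cong (M′ 21 0 <ᵇ_) (Inv.n≡ I)) (<ᵇ-true (subst (M′ 21 0 <_) (Inv.count I) (ℕ.m<m+n _ (s≤s z≤n)))) ,
        wp-block writeVertex (writeVertex-run I))
      (λ {M′} I → trans (cong (M′ 21 0 <ᵇ_) (Inv.n≡ I))
        (<ᵇ-false (ℕ.≤-reflexive (trans (sym (Inv.count I)) (ℕ.+-identityʳ (M′ 21 0))))))
      rest (record
        { bs = [] ; shape = refl ; doubly = doubly₀ ; n≡ = n≡₀ ; index = refl ; count = size
        ; down = cong pred (trans n≡₀ (sym size))
        ; link = Doubly-head {g = M 14} (rest ++ s ∷ []) doubly₀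
        ; τ-seg = trans (upd-same {M 8} {pred (M 0 0)} refl) root , tt
        ; a-seg = root , tt
        ; clear = λ { (s≤s z≤n) → refl } }))))
    where
    finish : ∀ {M′} → Inv [] M′ → Seg (M′ 8) 0 (reverse (s ∷ rest)) × Seg (M′ 9) 0 (s ∷ rest) × (∀ (v : Fin n) → M′ 10 (toℕ v) ≡ 0)
    finish {M′} I = subst₂ (Seg (M′ 8)) down (trans (cong (_++ s ∷ []) bs≡) (sym (List.unfold-reverse s rest))) τ-seg ,
      subst (λ l → Seg (M′ 9) 0 (s ∷ l)) (trans (sym (List.++-identityʳ (reverse bs))) shape) a-seg ,
      λ v → clear (subst (toℕ v <_) (trans (sym count) (ℕ.+-identityʳ (M′ 21 0))) (Fin.toℕ<n v))
      where
      open Inv I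
      bs≡ : bs ≡ reverse rest
      bs≡ = trans (sym (List.reverse-involutive bs)) (cong reverse (trans (sym (List.++-identityʳ (reverse bs))) shape))

-- Assembly

length-filter-¬ : ∀ {A : Set} {P : A → Set} (P? : ∀ a → Dec (P a)) xs →
  length xs ≡ length (filter P? xs) + length (filter (λ a → ¬? (P? a)) xs)
length-filter-¬ P? []       = refl
length-filter-¬ P? (x ∷ xs) with P? x
... | yes _ = cong suc (length-filter-¬ P? xs)
... | no _  = trans (cong suc (length-filter-¬ P? xs)) (sym (ℕ.+-suc _ _))

module Handshake {n : ℕ} {G : Graph n} (L : AdjacencyLists G) where
  open AdjacencyLists L
  open Accounting L

  arcsFrom : Fin n → List (Fin n × Fin n)
  arcsFrom v = map (v ,_) (list v)

  arcs : List (Fin n × Fin n)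
  arcs = concatMap arcsFrom (allFin n)

  ∈-arcs⁻ : ∀ {v w} → (v , w) ∈ₗ arcs → w ∈ N G v
  ∈-arcs⁻ {v} {w} a∈ with Any.satisfied (∈ₗ.∈-concatMap⁻ arcsFrom {xs = allFin n} a∈)
  ... | u , p∈ with ∈ₗ.∈-map⁻ (u ,_) p∈
  ...   | _ , w∈ , refl = Equivalence.to (complete w v) w∈

  arcs-unique : Unique arcs
  arcs-unique = AllPairs.concat⁺
    (All.map⁺ (All.tabulate λ {v} _ → Unique.map⁺ (λ { refl → refl }) (unique v)))
    (AllPairs.map⁺ (AllPairs.map (λ {u} {v} u≢v → All.tabulate λ a∈ → All.tabulate λ b∈ → λ { refl →
        u≢v (trans (sym (source a∈)) (source b∈)) }) (Unique.allFin⁺ n)))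
    where
    source : ∀ {u v w} → (v , w) ∈ₗ arcsFrom u → v ≡ u
    source {u} a∈ with ∈ₗ.∈-map⁻ (u ,_) a∈
    ... | _ , _ , refl = refl

  Up : Fin n × Fin n → Set
  Up (u , v) = u Fin.< v

  up? : ∀ a → Dec (Up a)
  up? (u , v) = u Fin.<? v

  ∈-edges : ∀ {u v} → u Fin.< v → v ∈ N G u → (u , v) ∈ₗ edges G
  ∈-edges {u} {v} lt v∈ = ∈ₗ.∈-filter⁺ (λ (u , v) → (u Fin.<? v) ×-dec (v ∈? N G u))
    (∈ₗ.∈-cartesianProduct⁺ (∈ₗ.∈-allFin u) (∈ₗ.∈-allFin v)) (lt , v∈)

  swap : Fin n × Fin n → Fin n × Fin n
  swap (u , v) = v , u

  -- The upward arcs, and the downward arcs after swapping their ends, each embed into the list of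
  -- edges.
  arcs-length : length arcs ≤ ∣E∣ G + ∣E∣ G
  arcs-length = ℕ.≤-trans (ℕ.≤-reflexive (length-filter-¬ up? arcs)) (ℕ.+-mono-≤
    (unique-⊆-length (Unique.filter⁺ up? arcs-unique) λ a∈ →
      case ∈ₗ.∈-filter⁻ up? {xs = arcs} a∈ of λ (a∈′ , lt) → ∈-edges lt (∈-arcs⁻ a∈′))
    (ℕ.≤-trans (ℕ.≤-reflexive (sym (List.length-map swap (filter (λ a → ¬? (up? a)) arcs))))
      (unique-⊆-length (Unique.map⁺ (λ { refl → refl }) (Unique.filter⁺ (λ a → ¬? (up? a)) arcs-unique)) λ b∈ →
        case ∈ₗ.∈-map⁻ swap b∈ of λ { ((u , v) , a∈ , refl) → case ∈ₗ.∈-filter⁻ (λ a → ¬? (up? a)) {xs = arcs} a∈ of λ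
          (a∈′ , u≮v) → ∈-edges (ℕ.≤∧≢⇒< (ℕ.≮⇒≥ u≮v) λ e → Graph.irrefl G u
            (subst (_∈ N G u) (Fin.toℕ-injective e) (∈-arcs⁻ a∈′))) (Graph.sym G (∈-arcs⁻ a∈′)) })))

  total-arcs : ∀ vs → sum (map weight vs) ≡ length vs + length (concatMap arcsFrom vs)
  total-arcs []       = refl
  total-arcs (v ∷ vs) = cong suc (begin
    deg v + sum (map weight vs)                        ≡⟨ cong (deg v +_) (total-arcs vs) ⟩
    deg v + (length vs + rest)                         ≡⟨ sym (ℕ.+-assoc (deg v) (length vs) rest) ⟩
    deg v + length vs + rest                           ≡⟨ cong (_+ rest) (ℕ.+-comm (deg v) (length vs)) ⟩
    length vs + deg v + rest                           ≡⟨ ℕ.+-assoc (length vs) (deg v) rest ⟩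
    length vs + (deg v + rest)                         ≡⟨ cong (length vs +_) (sym (trans (List.length-++ (arcsFrom v)) (cong (_+ rest) (List.length-map (v ,_) (list v))))) ⟩
    length vs + length (arcsFrom v ++ concatMap arcsFrom vs) ∎)
    where
    open ≡-Reasoning
    rest = length (concatMap arcsFrom vs)

  total-≤ : total ≤ 2 * (n + ∣E∣ G)
  total-≤ = begin
    total                                ≡⟨ total-arcs (allFin n) ⟩
    length (allFin n) + length arcs      ≡⟨ cong (_+ length arcs) (List.length-tabulate {n = n} id) ⟩
    n + length arcs                      ≤⟨ ℕ.+-mono-≤ (ℕ.m≤m+n n n) arcs-length ⟩
    (n + n) + (∣E∣ G + ∣E∣ G)            ≡⟨ rearrange n (∣E∣ G) ⟩
    2 * (n + ∣E∣ G)                      ∎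
    where
    open ℕ.≤-Reasoning
    rearrange : ∀ a b → (a + a) + (b + b) ≡ 2 * (a + b)
    rearrange a b = trans (cong₂ _+_ (cong (a +_) (sym (ℕ.+-identityʳ a))) (cong (b +_) (sym (ℕ.+-identityʳ b))))
      (sym (ℕ.*-distribˡ-+ 2 a b))

  n≤total : n ≤ total
  n≤total = ℕ.≤-trans (ℕ.m≤m+n n (length arcs))
    (ℕ.≤-reflexive (sym (trans (total-arcs (allFin n)) (cong (_+ length arcs) (List.length-tabulate {n = n} id)))))

cells-applyUpTo : ∀ (f : ℕ → ℕ) {m k} → k < m → cells (List.applyUpTo f m) k ≡ f k
cells-applyUpTo f {suc m} {zero}  _        = refl
cells-applyUpTo f {suc m} {suc k} (s≤s lt) = cells-applyUpTo (f ∘ suc) lt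

Seg-shift : ∀ {n} {f : ℕ → ℕ} (xs : List (Fin n)) {k} → Seg (f ∘ suc) k xs → Seg f (suc k) xs
Seg-shift []       _       = tt
Seg-shift (x ∷ xs) (p , q) = p , Seg-shift xs q

Seg-cells : ∀ {n} (ps xs : List (Fin n)) → Seg (cells (map toℕ (ps ++ xs))) (length ps) xs
Seg-cells []       []       = tt
Seg-cells []       (x ∷ xs) = refl , Seg-shift xs (Seg-cells [] xs)
Seg-cells (p ∷ ps) xs       = Seg-shift xs (Seg-cells ps xs)

input-store : ∀ {n} {G : Graph n} (L : AdjacencyLists G) s (ρ : Order n) → Input L s ρ (inputStore L s ρ)
input-store {n} L s ρ = record
  { size  = refl
  ; root  = refl
  ; arcs  = λ v → trans (offset (suc (toℕ v)) (s≤s (Fin.toℕ<n v))) (trans (off-suc v)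
      (cong (_+ length (list v)) (sym (offset (toℕ v) (ℕ.m≤n⇒m≤1+n (Fin.toℕ<n v)))))) ,
      subst (λ k → Seg (cells targets) k (list v)) (sym (offset (toℕ v) (ℕ.m≤n⇒m≤1+n (Fin.toℕ<n v)))) (segment v)
  ; order = Seg-cells [] (toList ρ)
  }
  where
  open AdjacencyLists L
  lists : List (List (Fin n))
  lists = tabulate list
  off : ℕ → ℕ
  off k = length (concat (take k lists))
  offset : ∀ k → k < suc n → cells offsets k ≡ off k
  offset k lt = trans (cong (λ l → cells l k) (List.map-upTo off (suc n))) (cells-applyUpTo off lt)
  off-suc : ∀ v → off (suc (toℕ v)) ≡ off (toℕ v) + length (list v)
  off-suc v = begin
    length (concat (take (suc (toℕ v)) lists))                  ≡⟨ cong (length ∘ concat) (List.take-suc-tabulate list v) ⟩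
    length (concat (take (toℕ v) lists ∷ʳ list v))              ≡⟨ cong length (sym (List.concat-++ (take (toℕ v) lists) (list v ∷ []))) ⟩
    length (concat (take (toℕ v) lists) ++ (list v ++ []))      ≡⟨ List.length-++ (concat (take (toℕ v) lists)) ⟩
    off (toℕ v) + length (list v ++ [])                         ≡⟨ cong (λ l → off (toℕ v) + length l) (List.++-identityʳ (list v)) ⟩
    off (toℕ v) + length (list v)                               ∎
    where open ≡-Reasoning
  segment : ∀ v → Seg (cells targets) (off (toℕ v)) (list v)
  segment v = proj₁ (Seg-++⁻ (list v) (subst (λ l → Seg (cells (map toℕ l)) (off (toℕ v)) (list v ++ concat (drop (suc (toℕ v)) lists)))
    (trans (List.concat-++ (take (toℕ v) lists) (list v ∷ drop (suc (toℕ v)) lists)) (cong concat (sym (tabulate-split list v))))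
    (Seg-cells (concat (take (toℕ v) lists)) _)))

before-sorted : ∀ {n} (σ : Order n) i → AllPairs (λ p q → q ≺[ σ ] p) (before σ i)
before-sorted {n} σ i = AllPairs.map⁺ (AllPairs.map (λ {p} {q} → subst₂ Fin._<_ (sym (pos-at σ q)) (sym (pos-at σ p))) (recent-sorted n (toℕ i)))

Older-≼ : ∀ {n} (σ : Order n) {bs a b} → AllPairs (λ p q → q ≺[ σ ] p) bs → Older bs a b → a ≼[ σ ] b
Older-≼ σ (_ ∷ _)  (inj₁ (refl , here refl)) = ℕ.≤-refl
Older-≼ σ (d> ∷ _) (inj₁ (refl , there a∈))  = ℕ.<⇒≤ (All.lookup d> a∈)
Older-≼ σ (_ ∷ ps) (inj₂ o)                  = Older-≼ σ ps o

module SearchOrder {n : ℕ} {G : Graph n} {π : Order n} {T : Graph n} {s : Fin n} (is𝓛 : Is𝓛Tree G π T s) (ω : Order n)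
  (rooted : ∀ i {p} → Parent G π (at ω i) p → p ∈ₗ before ω i) where
  open Tree is𝓛
  open Ancestry G π

  parent≺ : ∀ {v p} → Parent G π v p → p ≺[ ω ] v
  parent≺ {v} {p} par = ∈-before⁻ ω (pos ω v) (rooted (pos ω v) (subst (λ x → Parent G π x p) (sym (at-pos ω v)) par))

  starts : Starts ω s
  starts with ℕ.m≤n⇒m<n∨m≡n {0} {toℕ (pos ω s)} z≤n
  ... | inj₂ e   = sym e
  ... | inj₁ 0<s with at ω i Fin.≟ s
    where i = Fin.fromℕ< (ℕ.<-trans 0<s (Fin.toℕ<n (pos ω s)))
  ...   | yes e = trans (cong (toℕ ∘ pos ω) (sym e)) (trans (cong toℕ (pos-at ω _)) (Fin.toℕ-fromℕ< _))
  ...   | no ne with parent _ ne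
  ...     | p , par with () ← subst (toℕ (pos ω p) <_) (trans (cong toℕ (pos-at ω _)) (Fin.toℕ-fromℕ< _)) (parent≺ par)

  step-parent : ∀ i → 0 < toℕ i → ∃ (Parent G π (at ω i))
  step-parent i 0<i = parent (at ω i) λ e → ℕ.<-irrefl (sym (trans (cong toℕ (trans (sym (pos-at ω i)) (cong (pos ω) e))) starts)) 0<i

  active-child : ∀ {i x w} → Visited ω i x → w ∈ N T x → Unvisited ω i w → Parent G π w x
  active-child x<i w∈ i≤w with T⇒Parent w∈
  ... | inj₂ par = par
  ... | inj₁ par = ⊥-elim (ℕ.<⇒≱ x<i (ℕ.≤-trans i≤w (ℕ.<⇒≤ (parent≺ par))))

  visited-parent : ∀ {i p} → Parent G π (at ω i) p → Visited ω i p
  visited-parent {i} par = ∈-before⁻ ω i (rooted i par)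

  at-unvisited : ∀ i → Unvisited ω i (at ω i)
  at-unvisited i = ℕ.≤-reflexive (cong toℕ (sym (pos-at ω i)))

  active-parent : ∀ {i p} → Parent G π (at ω i) p → Active T ω i p
  active-parent {i} par = visited-parent par , at ω i , Parent⇒T par , at-unvisited i

  -- An active vertex is the parent of some unvisited vertex, so comparing the parents of unvisited
  -- vertices with that of the chosen one compares the active vertices.
  isBFS : (∀ i {y} → Unvisited ω i y → y ≢ at ω i → ∀ {p r} → Parent G π (at ω i) p → Parent G π y r →
    r ∈ₗ before ω i → Older (before ω i) p r) → IsBFS T s ω
  isBFS h = record { start = starts ; step = λ i 0<i → case step-parent i 0<i of λ (p , par) →
    p , (active-parent par , earliest i par) , Parent⇒T par }
    where
    earliest : ∀ i {p} → Parent G π (at ω i) p → ∀ x → Active T ω i x → p ≼[ ω ] x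
    earliest i {p} par x (x<i , w , w∈ , i≤w) with active-child x<i w∈ i≤w | w Fin.≟ at ω i
    ... | par′ | yes refl = ℕ.≤-reflexive (cong (toℕ ∘ pos ω) (parent-unique par par′))
    ... | par′ | no w≢    = Older-≼ ω (before-sorted ω i) (h i i≤w w≢ par par′ (∈-before⁺ ω {i} x<i))

  isDFS⁺ : ∀ {τ} → Ends τ s → (∀ i {y} → Unvisited ω i y → y ≢ at ω i → ∀ {p r} → Parent G π (at ω i) p → Parent G π y r →
    r ∈ₗ before ω i → Older (before ω i) r p × (r ≡ p → y ≺[ τ ] at ω i)) → IsDFS⁺ τ T ω
  isDFS⁺ {τ} end h = record
    { start = λ v sv → subst (Ends τ) (starts-unique ω starts sv) end
    ; step = λ i 0<i → case step-parent i 0<i of λ (p , par) →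
        p , (active-parent par , recent′ i par) , Parent⇒T par , rightmost i par }
    where
    recent′ : ∀ i {p} → Parent G π (at ω i) p → ∀ x → Active T ω i x → x ≼[ ω ] p
    recent′ i {p} par x (x<i , w , w∈ , i≤w) with active-child x<i w∈ i≤w | w Fin.≟ at ω i
    ... | par′ | yes refl = ℕ.≤-reflexive (cong (toℕ ∘ pos ω) (parent-unique par′ par))
    ... | par′ | no w≢    = Older-≼ ω (before-sorted ω i) (proj₁ (h i i≤w w≢ par par′ (∈-before⁺ ω {i} x<i)))
    rightmost : ∀ i {p} → Parent G π (at ω i) p → ∀ w → w ∈ N T p → Unvisited ω i w → w ≼[ τ ] at ω i
    rightmost i {p} par w w∈ i≤w with w Fin.≟ at ω i
    ... | yes refl = ℕ.≤-refl
    ... | no w≢    = ℕ.<⇒≤ (proj₂ (h i i≤w w≢ par (active-child (visited-parent par) w∈ i≤w) (rooted i par)) refl)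

Ends-last : ∀ {n} (τ : Order n) {s} → (∀ w → w ≼[ τ ] s) → Ends τ s
Ends-last {n} τ {s} last with ℕ.m≤n⇒m<n∨m≡n (Fin.toℕ<n (pos τ s))
... | inj₂ e  = e
... | inj₁ lt = ⊥-elim (ℕ.<-irrefl refl (subst (_≤ toℕ (pos τ s))
  (trans (cong toℕ (pos-at τ (Fin.fromℕ< lt))) (Fin.toℕ-fromℕ< lt)) (last (at τ (Fin.fromℕ< lt)))))

refineAndSearch rankAndSearch lexDFSProgram : Program
refineAndSearch = writeOut ⨾ sortAdjacency 9 ⨾ depthFirst
rankAndSearch = initList ⨾ rankAll ⨾ refineAndSearch
lexDFSProgram = sortAdjacency 3 ⨾ initList ⨾ lexBFS ⨾ breadthFirst ⨾ rankAndSearch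

module Assembly {n : ℕ} {G : Graph n} (L : AdjacencyLists G) (s : Fin n) (ρ : Order n)
  (connected : Connected G) (chordal : Chordal G) (end : Ends ρ s) where
  open Accounting L
  open Handshake L using (n≤total; total-≤)

  Post : Store → Set
  Post M = ∃ λ σ → Σ (LexDFS⁺-Chordal G s ρ σ) λ run → Records M run

  1≤total : 1 ≤ total
  1≤total = ℕ.≤-trans (ℕ.≤-trans (s≤s z≤n) (Fin.toℕ<n s)) n≤total

  -- The vertex `s` makes `total` positive, so that it absorbs constants.
  linear : ∀ a b {k} → k ≤ total → a + b * k ≤ (a + b) * total
  linear a b k≤ = ℕ.≤-trans (ℕ.+-mono-≤
      (ℕ.≤-trans (ℕ.≤-reflexive (sym (ℕ.*-identityʳ a))) (ℕ.*-monoʳ-≤ a 1≤total)) (ℕ.*-monoʳ-≤ b k≤))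
    (ℕ.≤-reflexive (sym (ℕ.*-distribʳ-+ total a b)))

  linear′ : ∀ a b {k} → k ≤ total → a + k * b ≤ (a + b) * total
  linear′ a b {k} k≤ = ℕ.≤-trans (ℕ.≤-reflexive (cong (a +_) (ℕ.*-comm k b))) (linear a b k≤)

  wp-seq* : ∀ a b {P P′} {R : Store → Set} {M} → wp P (a * total) (wp P′ (b * total) R) M → wp (P ⨾ P′) ((a + b) * total) R M
  wp-seq* a b p = wp-mono (ℕ.≤-reflexive (sym (ℕ.*-distribʳ-+ total a b))) id (wp-seq p)

  ρ⁻ : List (Fin n)
  ρ⁻ = reverse (toList ρ)

  ∈-ρ⁻ : ∀ v → v ∈ₗ ρ⁻
  ∈-ρ⁻ v = Any.reverse⁺ (∈-toList ρ v)

  module Search = LexBFSRun L s ρ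

  module AfterLexBFS {M₃ : Store} (final : Search.Inv [] M₃) (π : Order n) (π≡ : toList π ≡ reverse (Search.Inv.ds final)) where
    module J = Search.Inv final

    ds≡ : reverse (toList π) ≡ J.ds
    ds≡ = trans (cong reverse π≡) (List.reverse-involutive J.ds)

    open LexBFSOrder {G = G} s ρ π connected end
      (subst (History (λ ds → Ahead ρ (map (nb G) ds))) (sym ds≡) J.history)
    open Tree is𝓛Tree using (parent; no-parent)

    span : Graph n
    span = tree G π

    pc : Fin n → ℕ
    pc v = M₃ 6 (toℕ v)

    pc-last : ∀ v → pc v ≡ lastNb G (noParent s) (before π (pos π v)) v
    pc-last = Parents-at π {G} {noParent s} {M₃ 6} (subst (λ ds → Parents G (noParent s) ds (M₃ 6)) (sym ds≡) J.parents)

    pc⇐ : ∀ {w x} → Parent G π w x → pc w ≡ toℕ x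
    pc⇐ {w} par = trans (pc-last w) (lastNb-Parent π {G} {noParent s} par)

    pc-s : pc s ≡ n
    pc-s = trans (pc-last s) (trans (lastNb-first π {G} {noParent s} starts) (noParent-root s))

    pc⇒ : ∀ {w x} → pc w ≡ toℕ x → Parent G π w x
    pc⇒ {w} {x} e with w Fin.≟ s
    ... | yes refl = ⊥-elim (ℕ.<⇒≢ (Fin.toℕ<n x) (trans (sym e) pc-s))
    ... | no w≢s with parent w w≢s
    ...   | p , par with refl ← Fin.toℕ-injective (trans (sym (pc⇐ par)) e) = par

    mns : MNS⁺ G ρ π
    mns = LexLabels.isLexBFS⁺⇒MNS⁺ G {s} {ρ} {π} starts end isLexBFS⁺

    record Kept (M : Store) : Set where
      field
        input   : Input L s ρ M
        π-seg   : Seg (M 5) 0 (toList π)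
        parents : ∀ v → M 6 (toℕ v) ≡ pc v

    Kept-frame : ∀ {P M M′} → M′ ≐⟨ P ⟩ M → (0 ∉ᵇ writes P) ≡ true → (1 ∉ᵇ writes P) ≡ true → (2 ∉ᵇ writes P) ≡ true →
      (3 ∉ᵇ writes P) ≡ true → (5 ∉ᵇ writes P) ≡ true → (6 ∉ᵇ writes P) ≡ true → Kept M → Kept M′
    Kept-frame f e₀ e₁ e₂ e₃ e₅ e₆ K = record
      { input = Input-≗ (f 0 e₀) (f 1 e₁) (f 2 e₂) (f 3 e₃) input ; π-seg = Seg-≗ (toList π) (f 5 e₅) π-seg
      ; parents = λ v → trans (f 6 e₆ _) (parents v) }
      where open Kept K

    -- Any order of the children yields a BFS order; the one at hand comes from the adjacency lists
    -- sorted by `ρ`.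
    module B = Traverse L is𝓛Tree pc pc⇒ pc⇐ (λ y z → z ≺[ ρ ] y) ρ⁻ ∈-ρ⁻ (unique-reverse (toList-unique ρ))
      (AllPairs-reverse (AllPairs-toList⁺ ρ id))

    module AfterBFS {bs : List (Fin n)} (trail : Trail B.BFSStep bs)
      (bfs : Order n) (bfs≡ : toList bfs ≡ reverse bs) where

      bs≡ : reverse (toList bfs) ≡ bs
      bs≡ = trans (cong reverse bfs≡) (List.reverse-involutive bs)

      bfs-trail : ∀ i → B.BFSStep (before bfs i) (at bfs i)
      bfs-trail = Trail-at bfs {B.BFSStep} (subst (Trail B.BFSStep) (sym bs≡) trail)

      isBFS : IsBFS span s bfs
      isBFS = SearchOrder.isBFS is𝓛Tree bfs (λ i → proj₁ (bfs-trail i)) λ i i≤y y≢ p r →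
        Later-at bfs {i = i} (λ y∉ → proj₂ (bfs-trail i) y∉) i≤y y≢ p r

      open Ranked chordal mns is𝓛Tree isBFS using (β; s-last; arranged; module DFSOrder)

      β≡ : toList β ≡ bs
      β≡ = trans (toList-⁻ bfs) bs≡

      module Ranking (A : Arrangement.Arranged G s ρ β s-last) where
        open Arrangement.Arranged A

        ranked-all : AllPairs (Ahead ρ (ranking G β)) (rest ++ s ∷ [])
        ranked-all = AllPairs-++⁺ sorted ([] ∷ []) λ { {x} x∈ (here refl) → inj₁ (s-last x λ { refl → s∉rest x∈ }) }

        all-ranked : ∀ v → v ∈ₗ rest ++ s ∷ []
        all-ranked v with v Fin.≟ s
        ... | yes refl = ∈ₗ.∈-++⁺ʳ rest (here refl)
        ... | no v≢s   = ∈ₗ.∈-++⁺ˡ (∈-rest v≢s)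

        unique-ranked : Unique (s ∷ rest)
        unique-ranked = All.tabulate (λ { v∈ refl → s∉rest v∈ }) ∷
          AllPairs.map (λ { a refl → Ahead-asym ρ (ranking G β) a a }) sorted

        all-s∷rest : ∀ v → v ∈ₗ s ∷ rest
        all-s∷rest v with v Fin.≟ s
        ... | yes refl = here refl
        ... | no v≢s   = there (∈-rest v≢s)

        module AfterRanking (τ : Order n) (τ≡ : toList τ ≡ reverse (s ∷ rest)) where

          isτ : toList τ ≡ reverse (arrangement G s ρ β)
          isτ = trans τ≡ (cong reverse (sym shape))

          τ-end : Ends τ s
          τ-end = Ends-last τ λ w → case w Fin.≟ s of λ
            { (yes refl) → ℕ.≤-refl
            ; (no w≢s) → ℕ.<⇒≤ (proj₂ (proj₂ (AllPairs-++⁻ (reverse rest)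
                (subst (AllPairs (λ a b → a ≺[ τ ] b)) (trans τ≡ (List.unfold-reverse s rest)) (AllPairs-toList⁺ τ id))))
                (Any.reverse⁺ (∈-rest w≢s)) (here refl)) }

          -- With the lists sorted along `τ`, the child pushed last, and hence taken first, is the
          -- rightmost in `τ`.
          module D = Traverse L is𝓛Tree pc pc⇒ pc⇐ (λ y z → y ≺[ τ ] z) (toList τ) (∈-toList τ) (toList-unique τ) (AllPairs-toList⁺ τ id)

          finish : ∀ {M ds} → Kept M → Seg (M 7) 0 (toList β) → Seg (M 8) 0 (toList τ) →
            Trail D.DFSStep ds → Seg (M 4) 0 (reverse ds) → (σ : Order n) → toList σ ≡ reverse ds → Post M
          finish {M} {ds} K β-seg τ-seg dfs-trail σ-seg σ σ≡ = σ , record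
            { π = π ; isLexBFS⁺ = isLexBFS⁺ ; T = span ; is𝓛Tree = is𝓛Tree
            ; ordering = record
              { input = σ , isDFS , is𝓛Tree-σ ; bfs = bfs ; isBFS = isBFS ; τ = τ ; isτ = isτ ; output = isDFS⁺ } } , record
            { output  = Holds⁺ {M = M} {4} σ (subst (Seg (M 4) 0) (sym σ≡) σ-seg)
            ; lexBFS  = Holds⁺ {M = M} {5} π (Kept.π-seg K)
            ; tree    = λ v p par → trans (Kept.parents K v) (pc⇐ par)
            ; revBFS  = Holds⁺ {M = M} {7} β β-seg
            ; refined = Holds⁺ {M = M} {8} τ τ-seg
            }
            where
            σ-trail : ∀ i → D.DFSStep (before σ i) (at σ i)
            σ-trail = Trail-at σ {D.DFSStep} (subst (Trail D.DFSStep)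
              (sym (trans (cong reverse σ≡) (List.reverse-involutive ds))) dfs-trail)
            isDFS⁺ : IsDFS⁺ τ span σ
            isDFS⁺ = SearchOrder.isDFS⁺ is𝓛Tree σ (λ i → proj₁ (σ-trail i)) {τ} τ-end λ i i≤y y≢ p r →
              Later-at σ {i = i} (λ y∉ → proj₂ (σ-trail i) y∉) i≤y y≢ p r
            open DFSOrder {τ} {σ} isτ isDFS⁺ using (isDFS; is𝓛Tree-σ)

          outputs-wp : ∀ {M l} → Kept M → Seg (M 7) 0 (toList β) → Partition ρ (ranking G β) l M → (∀ v → v ∈ₗ l) →
            wp refineAndSearch (59 * total) Post M
          outputs-wp {M} {l} K β-seg P all-l = wp-seq* 17 42
            (wp-after (wp-mono (linear′ 8 9 (ℕ.≤-trans (ℕ.n≤1+n _) (ℕ.≤-trans (ℕ.≤-reflexive size) n≤total))) id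
              (WriteOut.writeOut-wp s rest size (Input.size (Kept.input K)) (Input.root (Kept.input K))
                (subst (Doubly (M 13) (M 14)) l≡ (PartitionArrays.doubly P))))
            λ {M₁} f₁ (τ-seg , a-seg , clear) → let K₁ = Kept-frame {writeOut} f₁ refl refl refl refl refl refl K in wp-seq* 19 23
            (wp-after (wp-mono (linear 3 16 ℕ.≤-refl) id
              (sortAdjacency-wp {L = L} {s} {ρ} {9} {s ∷ rest} refl unique-ranked all-s∷rest (Kept.input K₁) a-seg clear))
            λ {M₂} f₂ (I₂ , linked) → let K₂ = Kept-frame {sortAdjacency 9} f₂ refl refl refl refl refl refl K₁ in
            wp-after (wp-mono (linear 5 18 ℕ.≤-refl) id (D.depthFirst-wp {ρ} {M₂} I₂
              (λ w → subst (λ us → LinkedAt M₂ w (nbrs G us w)) (sym τ≡) (linked w)) (Kept.parents K₂)))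
            λ {M₃} f₃ (ds , u , all , t , σ-seg) →
              case fromList (unique-reverse u) (λ v → Any.reverse⁺ (all v)) of λ (σ , σ≡) →
              finish (Kept-frame {depthFirst} f₃ refl refl refl refl refl refl K₂)
                (Seg-≗ (toList β) (λ j → trans (f₃ 7 refl j) (trans (f₂ 7 refl j) (f₁ 7 refl j))) β-seg)
                (Seg-≗ (toList τ) (λ j → trans (f₃ 8 refl j) (f₂ 8 refl j)) (subst (Seg (M₁ 8) 0) (sym τ≡) τ-seg))
                t σ-seg σ σ≡))
            where
            l≡ : l ≡ rest ++ s ∷ []
            l≡ = sorted-unique {R = Ahead ρ (ranking G β)} (Ahead-asym ρ (ranking G β)) (PartitionArrays.sorted P) ranked-all
              (λ _ → all-ranked _) (λ _ → all-l _)
            size : suc (length rest) ≡ n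
            size = sym (unique-length unique-ranked all-s∷rest)

        refineAndSearch-wp : ∀ {M l} → Kept M → Seg (M 7) 0 (toList β) → Partition ρ (ranking G β) l M → (∀ v → v ∈ₗ l) →
          wp refineAndSearch (59 * total) Post M
        refineAndSearch-wp K β-seg P all-l =
          case fromList (unique-reverse unique-ranked) (λ v → Any.reverse⁺ (all-s∷rest v)) of λ (τ , τ≡) →
          AfterRanking.outputs-wp τ τ≡ K β-seg P all-l

      rankAndSearch-wp : ∀ {M} → Kept M → Seg (M 7) 0 (toList β) → (∀ w → LinkedAt M w (nbrs G ρ⁻ w)) →
        (∀ v → M 18 (toℕ v) ≡ 1) → (∀ c → M 17 c < M 27 0) → wp rankAndSearch (121 * total) Post M
      rankAndSearch-wp {M} K β-seg linked flags fresh = wp-seq* 21 100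
        (wp-after (wp-mono (linear′ 9 12 n≤total) id (InitList.initList-wp ρ (Input.size (Kept.input K)) (Input.order (Kept.input K))
          (λ c → ℕ.m≤n⇒m≤1+n (fresh c))))
        λ {M₁} f₁ P₁ → let K₁ = Kept-frame {initList} f₁ refl refl refl refl refl refl K
                           β-seg₁ = Seg-≗ (toList β) (f₁ 7 refl) β-seg in wp-seq* 41 59
        (wp-after (wp-mono (linear 3 38 ℕ.≤-refl) id (RankAll.rankAll-wp L s ρ β P₁ (Kept.input K₁)
          (λ w → LinkedAt-frame {P = initList} {M} {M₁} {w} {nbrs G ρ⁻ w} f₁ refl refl refl refl (linked w))
          (λ v → trans (f₁ 18 refl _) (flags v)) β-seg₁))
        λ {M₂} f₂ (l , P₂ , all-l) → Ranking.refineAndSearch-wp arranged (Kept-frame {rankAll} f₂ refl refl refl refl refl refl K₁)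
          (Seg-≗ (toList β) (f₂ 7 refl) β-seg₁) P₂ all-l))

    breadthFirstOn-wp : (∀ v → v ∈ₗ J.ds) → wp (breadthFirst ⨾ rankAndSearch) (145 * total) Post M₃
    breadthFirstOn-wp all-ds = wp-seq* 24 121
      (wp-after (wp-mono (linear 6 18 ℕ.≤-refl) id (B.breadthFirst-wp {ρ} {M₃} J.input J.linked (λ _ → refl)))
      λ {M₄} f (bs , u , all , t , β-seg) → case fromList (unique-reverse u) (λ v → Any.reverse⁺ (all v)) of λ (bfs , bfs≡) →
        AfterBFS.rankAndSearch-wp t bfs bfs≡
        (Kept-frame {breadthFirst} f refl refl refl refl refl refl record
          { input = J.input ; π-seg = subst (Seg (M₃ 5) 0) (sym π≡) J.written ; parents = λ _ → refl })
        (subst (Seg (M₄ 7) 0) (sym (AfterBFS.β≡ t bfs bfs≡)) β-seg)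
        (λ w → LinkedAt-frame {P = breadthFirst} {M₃} {M₄} {w} {nbrs G ρ⁻ w} f refl refl refl refl (J.linked w))
        (λ v → trans (f 18 refl _) (J.visited (all-ds v)))
        (λ c → subst₂ _<_ (sym (f 17 refl c)) (sym (f 27 refl 0)) (PartitionArrays.fresh J.part c)))

  afterLexBFS-wp : ∀ {M₃} → Search.Inv [] M₃ → wp (breadthFirst ⨾ rankAndSearch) (145 * total) Post M₃
  afterLexBFS-wp final = case fromList (unique-reverse (Search.Inv.uniq final)) (λ v → Any.reverse⁺ (all-ds v)) of λ (π , π≡) →
    AfterLexBFS.breadthFirstOn-wp final π π≡ all-ds
    where
    all-ds : ∀ v → v ∈ₗ Search.Inv.ds final
    all-ds v with Search.Inv.covers final v
    ... | inj₁ v∈ = v∈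

  -- In units of `total`, the nine phases cost 19, 21, 51, 24, 21, 41, 17, 19 and 23.
  program-wp : wp lexDFSProgram (236 * total) Post (inputStore L s ρ)
  program-wp = wp-seq* 19 217
    (wp-after (wp-mono (linear 3 16 ℕ.≤-refl) id
      (sortAdjacency-wp {L = L} {s} {ρ} {3} {toList ρ} refl (toList-unique ρ) (∈-toList ρ) (input-store L s ρ)
        (Input.order (input-store L s ρ)) (λ _ → refl)))
    λ {M₁} f₁ (I₁ , linked₁) → wp-seq* 21 196
    (wp-after (wp-mono (linear′ 9 12 n≤total) id (InitList.initList-wp ρ (Input.size I₁) (Input.order I₁)
      (λ c → subst (_< suc (M₁ 27 0)) (sym (f₁ 17 refl c)) (s≤s z≤n))))
    λ {M₂} f₂ P₂ → wp-seq* 51 145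
    (wp-mono (linear 4 47 ℕ.≤-refl) afterLexBFS-wp
      (Search.lexBFS-wp P₂ (Input-≗ (f₂ 0 refl) (f₂ 1 refl) (f₂ 2 refl) (f₂ 3 refl) I₁)
        (λ w → LinkedAt-frame {P = initList} {M₁} {M₂} {w} {nbrs G ρ⁻ w} f₂ refl refl refl refl (linked₁ w))
        (λ j → trans (f₂ 18 refl j) (f₁ 18 refl j)) (λ j → trans (f₂ 19 refl j) (f₁ 19 refl j))))))

adjacencyLists : ∀ {n} (G : Graph n) → AdjacencyLists G
adjacencyLists {n} G = record
  { list     = λ v → filter (_∈? N G v) (allFin n)
  ; unique   = λ v → Unique.filter⁺ (_∈? N G v) (Unique.allFin⁺ n)
  ; complete = λ u v → mk⇔ (λ u∈ → proj₂ (∈ₗ.∈-filter⁻ (_∈? N G v) {xs = allFin n} u∈))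
                           (∈ₗ.∈-filter⁺ (_∈? N G v) (∈ₗ.∈-allFin u))
  }

theorem16 : (∀ {n} (G : Graph n) (s : Fin n) (ρ : Order n) →
    Connected G → Chordal G → Ends ρ s →
    (∃[ σ ] LexDFS⁺-Chordal G s ρ σ) ×
    (∀ σ → LexDFS⁺-Chordal G s ρ σ → IsLexDFS⁺ G s ρ σ × Starts σ s))
    ×
    (∃[ P ] ∃[ c ]
    ∀ {n} (G : Graph n) (s : Fin n) (ρ : Order n) (L : AdjacencyLists G) →
    Connected G → Chordal G → Ends ρ s →
    ∃[ σ ] Σ[ run ∈ LexDFS⁺-Chordal G s ρ σ ] ∃[ t ] ∃[ M ]
    (⟨ P , inputStore L s ρ ⟩⇓[ t ] M) ×
    t ≤ c * (n + ∣E∣ G) ×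
    Records M run)
theorem16 =
  -- A run is extracted from the program, started on adjacency lists obtained by filtering all
  -- vertices.
  (λ G s ρ connected chordal end →
    (case Assembly.program-wp (adjacencyLists G) s ρ connected chordal end of λ (_ , _ , _ , _ , σ , run , _) → σ , run) ,
    lexDFS⁺-chordal-correct G s ρ chordal end) ,
  -- Twice 236, by `total-≤`.
  lexDFSProgram , 472 , λ {n} G s ρ L connected chordal end →
    case Assembly.program-wp L s ρ connected chordal end of λ (t , M , ⇓ , t≤ , σ , run , records) →
      σ , run , t , M , ⇓ ,
      ℕ.≤-trans t≤ (ℕ.≤-trans (ℕ.*-monoʳ-≤ 236 (Handshake.total-≤ L)) (ℕ.≤-reflexive (sym (ℕ.*-assoc 236 2 (n + ∣E∣ G))))) ,
      records
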